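{- Let $n,t,s$ be positive integers with $n\geq 5s(t+1)^{2}$. Suppose that $\mathcal{F},\mathcal{G}\subseteq\binom{[n]}{t+1}$ are $s$-almost cross-$t$-intersecting families with $\left|\bigcap_{H\in\mathcal{F}\cup\mathcal{G}}H\right|<t$ and $|\mathcal{F}|\leq|\mathcal{G}|$, and that $|\mathcal{F}||\mathcal{G}|$ is maximum among all such pairs. (i) If $t\geq s+2$, then there exists $Y\in\binom{[n]}{t+1}$ such that $\mathcal{F}=\{Y\}$ and $\mathcal{G}=\mathcal{M}_1(Y;t+1,t)\cup\mathcal{C}$, where $\mathcal{C}$ is an $s$-subset of $\binom{[n]}{t+1}\setminus\mathcal{M}_1(Y;t+1,t)$. (ii) If $t\leq s+1$, then there exist $Z\in\binom{[n]}{t+s+2}$ and $W\in\binom{Z}{t}$ such that $\mathcal{F}=\mathcal{H}_1(Z,W;t+1)$ and $\mathcal{G}=\mathcal{H}_1([n],W;t+1)\cup\mathcal{D}$, where $\mathcal{D}$ is an $(s+2)$-subset of $\mathcal{M}_2(Z,W;t)$ such that each element of $Z\setminus W$ is contained in exactly two members of $\mathcal{D}$.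
   Context: $[n]=\{1,\dots,n\}$ and $\binom{X}{k}$ denotes the family of all $k$-subsets of $X$. Two sets are $t$-disjoint if they share fewer than $t$ elements. Families $\mathcal{F},\mathcal{G}$ are $s$-almost cross-$t$-intersecting if each member of $\mathcal{F}$ is $t$-disjoint with at most $s$ members of $\mathcal{G}$ and vice versa. For subsets $W\subseteq X$ and $Y$ of $[n]$: $\mathcal{H}_1(X,W;k)=\{F\in\binom{X}{k}: W\subseteq F\}$, $\mathcal{M}_1(Y;k,t)=\{F\in\binom{[n]}{k}: |F\cap Y|\geq t\}$, and $\mathcal{M}_2(X,W;t)=\{F\in\binom{X}{t+1}: |F\cap W|=t-1\}$. -}

module Defs where

open import Data.Nat using (ℕ; zero; suc; _+_; _∸_; _<_; _≤_; _≟_; _<?_; _≤?_)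
open import Data.Bool using (Bool; true; false; _∧_; _∨_; not)
open import Data.List using (List; []; _∷_; _++_; map; filter; length)
open import Data.Vec using (_∷_)
open import Data.Fin using (Fin)
open import Data.Fin.Subset using (Subset; _∩_; ∣_∣; ⋂; _∈_; _⊆_)
open import Data.Fin.Subset.Properties using (_⊆?_; _∈?_)
open import Relation.Nullary.Decidable using (⌊_⌋; does)
open import Relation.Binary.PropositionalEquality using (_≡_)
open import Data.Product using (_×_)

allSubsets : (n : ℕ) → List (Subset n)
allSubsets zero = Data.Vec.[] ∷ []
allSubsets (suc n) = map (true ∷_) (allSubsets n) ++ map (false ∷_) (allSubsets n)

Family : ℕ → Set
Family n = Subset n → Bool

_∈F_ : {n : ℕ} → Subset n → Family n → Set
A ∈F 𝓕 = 𝓕 A ≡ true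

members : {n : ℕ} → Family n → List (Subset n)
members {n} 𝓕 = filter (λ A → 𝓕 A Data.Bool.≟ true) (allSubsets n)

card : {n : ℕ} → Family n → ℕ
card 𝓕 = length (members 𝓕)

_≐_ : {n : ℕ} → Family n → Family n → Set
𝓕 ≐ 𝓖 = ∀ A → 𝓕 A ≡ 𝓖 A

_⊆F_ : {n : ℕ} → Family n → Family n → Set
𝓕 ⊆F 𝓖 = ∀ A → A ∈F 𝓕 → A ∈F 𝓖

_∪F_ : {n : ℕ} → Family n → Family n → Family n
(𝓕 ∪F 𝓖) A = 𝓕 A ∨ 𝓖 A

Uniform : {n : ℕ} → ℕ → Family n → Set
Uniform k 𝓕 = ∀ A → A ∈F 𝓕 → ∣ A ∣ ≡ k

tDisjoint? : {n : ℕ} → ℕ → Subset n → Subset n → Bool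
tDisjoint? t A B = ⌊ ∣ A ∩ B ∣ <? t ⌋

disjCount : {n : ℕ} → ℕ → Subset n → Family n → ℕ
disjCount t A 𝓖 = card (λ B → 𝓖 B ∧ tDisjoint? t A B)

AlmostCrossInt : {n : ℕ} → ℕ → ℕ → Family n → Family n → Set
AlmostCrossInt s t 𝓕 𝓖 =
  (∀ A → A ∈F 𝓕 → disjCount t A 𝓖 ≤ s) ×
  (∀ B → B ∈F 𝓖 → disjCount t B 𝓕 ≤ s)

bigCap : {n : ℕ} → Family n → Subset n
bigCap 𝓕 = ⋂ (members 𝓕)

Admissible : (n t s : ℕ) → Family n → Family n → Set
Admissible n t s 𝓕 𝓖 =
  Uniform (suc t) 𝓕 × Uniform (suc t) 𝓖 × AlmostCrossInt s t 𝓕 𝓖 ×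
  (∣ bigCap (𝓕 ∪F 𝓖) ∣ < t) × (card 𝓕 ≤ card 𝓖)

H₁ : {n : ℕ} → Subset n → Subset n → ℕ → Family n
H₁ X W k F = ⌊ F ⊆? X ⌋ ∧ ⌊ ∣ F ∣ ≟ k ⌋ ∧ ⌊ W ⊆? F ⌋

M₁ : {n : ℕ} → Subset n → ℕ → ℕ → Family n
M₁ Y k t F = ⌊ ∣ F ∣ ≟ k ⌋ ∧ ⌊ t ≤? ∣ F ∩ Y ∣ ⌋

M₂ : {n : ℕ} → Subset n → Subset n → ℕ → Family n
M₂ X W t F = ⌊ F ⊆? X ⌋ ∧ ⌊ ∣ F ∣ ≟ suc t ⌋ ∧ ⌊ ∣ F ∩ W ∣ ≟ t ∸ 1 ⌋

Binom : {n : ℕ} → ℕ → Family n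
Binom k F = ⌊ ∣ F ∣ ≟ k ⌋

Single : {n : ℕ} → Subset n → Family n
Single Y F = ⌊ Data.Vec.Properties.≡-dec Data.Bool._≟_ F Y ⌋
  where import Data.Vec.Properties

containCount : {n : ℕ} → Fin n → Family n → ℕ
containCount x 𝓓 = card (λ D → 𝓓 D ∧ ⌊ x ∈? D ⌋)

-- Two explicit admissible pairs bound the maximal product |𝓕| |𝓖| from below by Lᵢ = 1 + (t+1)(n−t−1) + s
-- (𝓕 = {Y}, 𝓖 = M₁(Y;t+1,t) plus s further sets) and by Lᵢᵢ = (s+2)(n−t+s+2) (𝓕 = H₁(Z,W;t+1), 𝓖 = the star
-- of W plus s+2 sets of M₂(Z,W;t) forming a cycle). Conversely, if |𝓕| = 1 then all but at most s members of 𝓖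
-- lie in M₁(Y;t+1,t), so |𝓕| |𝓖| ≤ Lᵢ with equality only in configuration (i). If |𝓕| ≥ 2 and 𝓕 contains two
-- t-disjoint sets, or 𝓕 is t-intersecting without a common t-subset, then |𝓖| is bounded in terms of s and t
-- alone and |𝓕| |𝓖| ≤ |𝓖|² < Lᵢᵢ since n ≥ 5s(t+1)². Otherwise all members of 𝓕 contain a t-set W; a member of
-- 𝓖 not containing W t-intersects at most two members of 𝓕, so double counting t-disjoint pairs bounds the
-- family 𝓓 of such members by |𝓓| (|𝓕| − 2) ≤ |𝓕| s. This beats Lᵢᵢ unless |𝓕| = s + 2, where equality forces
-- configuration (ii). Finally Lᵢ < Lᵢᵢ exactly when t ≤ s + 1, which decides between (i) and (ii).
module Submission where

open import Defs
open import Data.Nat using (ℕ; suc; _+_; _*_; _≤_; _<_; _^_)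
open import Data.Bool using (not)
open import Data.Fin using (Fin)
open import Data.Fin.Subset using (Subset; ⊤; ∣_∣; _⊆_; _∈_; _∉_)
open import Data.Product using (Σ; _×_; _,_)
open import Relation.Binary.PropositionalEquality using (_≡_)

module NatFacts where

  open import Data.Nat using (suc; _+_; _*_; _∸_; _≤_; _<_; s≤s)
  open import Data.Nat.Properties
  open import Data.Product using (_×_; _,_)
  open import Relation.Binary.PropositionalEquality
  open import Data.Nat.Tactic.RingSolver using (solve-∀)

  +-≤-tight : ∀ {a A b B} → a ≤ A → b ≤ B → A + B ≤ a + b → a ≡ A × b ≡ B
  +-≤-tight {a} {A} {b} {B} a≤A b≤B A+B≤a+b =
    ≤-antisym a≤A (+-cancelʳ-≤ B A a (≤-trans A+B≤a+b (+-monoʳ-≤ a b≤B))) ,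
    ≤-antisym b≤B (+-cancelˡ-≤ A B b (≤-trans A+B≤a+b (+-monoˡ-≤ b a≤A)))

  m≤n+2⇒m∸2≤n : ∀ m n → m ≤ n + 2 → m ∸ 2 ≤ n
  m≤n+2⇒m∸2≤n m n m≤n+2 = ≤-trans (∸-monoˡ-≤ 2 m≤n+2) (≤-reflexive (m+n∸n≡m n 2))

  t+t≤m+n⇒n<t⇒t<m : ∀ t m n → t + t ≤ m + n → n < t → t < m
  t+t≤m+n⇒n<t⇒t<m t m n t+t≤m+n n<t = +-cancelʳ-≤ n (suc t) m (begin
    suc t + n  ≡⟨ +-comm (suc t) n ⟩
    n + suc t  ≡⟨ +-suc n t ⟩
    suc n + t  ≤⟨ +-monoˡ-≤ t n<t ⟩
    t + t      ≤⟨ t+t≤m+n ⟩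
    m + n      ∎)
    where open ≤-Reasoning

  c[f∸2]≤fs⇒c≤3s : ∀ c f s → c * (f ∸ 2) ≤ f * s → 3 ≤ f → c ≤ 3 * s
  c[f∸2]≤fs⇒c≤3s c 1 s _ (s≤s ())
  c[f∸2]≤fs⇒c≤3s c 2 s _ (s≤s (s≤s ()))
  c[f∸2]≤fs⇒c≤3s c (suc (suc (suc k))) s c[f∸2]≤fs _ = ≮⇒≥ λ 3s<c → <⇒≱ (begin-strict
    suc (suc (suc k)) * s                    ≤⟨ m≤m+n _ (2 * k * s + k) ⟩
    suc (suc (suc k)) * s + (2 * k * s + k)  <⟨ ≤-reflexive (rearrange k s) ⟩
    suc (3 * s) * suc k                      ≤⟨ *-monoˡ-≤ (suc k) 3s<c ⟩
    c * suc k                                ∎) c[f∸2]≤fs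
    where
    open ≤-Reasoning
    rearrange : ∀ k s → suc (suc (suc (suc k)) * s + (2 * k * s + k)) ≡ suc (3 * s) * suc k
    rearrange = solve-∀


module Counting where

  open import Defs
  open import Data.Nat using (ℕ; zero; suc; _+_; _*_; _≤_; _<_; z≤n; s≤s)
  open import Data.Nat.Properties
  open import Data.Bool using (Bool; true; false; _∧_; _∨_; not; if_then_else_)
  open import Data.Bool.Properties using (∧-conicalˡ; ∧-conicalʳ; ∧-zeroʳ; ∧-identityʳ; ∨-zeroʳ; not-injective)
  open import Data.List using (List; []; _∷_; _++_; map; filter; length)
  open import Data.Vec using (_∷_)
  import Data.Vec.Properties as Vec
  import Data.Bool as Bool
  open import Data.Fin.Subset using (Subset)
  open import Data.Product using (Σ-syntax; _×_; _,_)
  open import Data.Sum using (_⊎_; inj₁; inj₂)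
  open import Data.Empty using (⊥-elim)
  open import Relation.Binary.PropositionalEquality
  open import Relation.Nullary using (¬_; Dec; yes; no; contradiction)
  open import Relation.Nullary.Decidable using (⌊_⌋)
  open import Data.Nat.Tactic.RingSolver using (solve-∀)

  private variable
    n : ℕ
    X Y : Set

  ∧-true : {a b : Bool} → a ≡ true → b ≡ true → a ∧ b ≡ true
  ∧-true refl refl = refl

  module _ {P : Set} where

    ⌊⌋-true : (d : Dec P) → P → ⌊ d ⌋ ≡ true
    ⌊⌋-true (yes _) _ = refl
    ⌊⌋-true (no ¬p) p = contradiction p ¬p

    ⌊⌋-false : (d : Dec P) → ¬ P → ⌊ d ⌋ ≡ false
    ⌊⌋-false (yes p) ¬p = contradiction p ¬p
    ⌊⌋-false (no _)  _  = refl

    ⌊⌋-true⁻¹ : (d : Dec P) → ⌊ d ⌋ ≡ true → P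
    ⌊⌋-true⁻¹ (yes p) _ = p

    ⌊⌋-false⁻¹ : (d : Dec P) → ⌊ d ⌋ ≡ false → ¬ P
    ⌊⌋-false⁻¹ (no ¬p) _ = ¬p

  bool-ext : (a b : Bool) → (a ≡ true → b ≡ true) → (b ≡ true → a ≡ true) → a ≡ b
  bool-ext true  b a⇒b _   = sym (a⇒b refl)
  bool-ext false true _ b⇒a = b⇒a refl
  bool-ext false false _ _ = refl

  _∩F_ : Family n → Family n → Family n
  (𝓕 ∩F 𝓟) A = 𝓕 A ∧ 𝓟 A

  _∖F_ : Family n → Family n → Family n
  (𝓕 ∖F 𝓟) A = 𝓕 A ∧ not (𝓟 A)

  ∅F : Family n
  ∅F _ = false

  infixl 7 _∩F_ _∖F_

  ∪F⁺ˡ : (𝓕 𝓖 : Family n) → 𝓕 ⊆F (𝓕 ∪F 𝓖)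
  ∪F⁺ˡ 𝓕 𝓖 A A∈𝓕 rewrite A∈𝓕 = refl

  ∪F⁺ʳ : (𝓕 𝓖 : Family n) → 𝓖 ⊆F (𝓕 ∪F 𝓖)
  ∪F⁺ʳ 𝓕 𝓖 A A∈𝓖 rewrite A∈𝓖 = ∨-zeroʳ (𝓕 A)

  ∪F⁻ : (𝓕 𝓖 : Family n) (A : Subset n) → A ∈F (𝓕 ∪F 𝓖) → A ∈F 𝓕 ⊎ A ∈F 𝓖
  ∪F⁻ 𝓕 𝓖 A A∈ with 𝓕 A
  ... | true  = inj₁ refl
  ... | false = inj₂ A∈

  Single-≡ : (Y A : Subset n) → A ∈F Single Y → A ≡ Y
  Single-≡ Y A = ⌊⌋-true⁻¹ (Vec.≡-dec Bool._≟_ A Y)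

  Single-∋ : (Y : Subset n) → Y ∈F Single Y
  Single-∋ Y = ⌊⌋-true (Vec.≡-dec Bool._≟_ Y Y) refl

  Single-∌ : (Y A : Subset n) → ¬ A ≡ Y → Single Y A ≡ false
  Single-∌ Y A = ⌊⌋-false (Vec.≡-dec Bool._≟_ A Y)

  𝟙 : Bool → ℕ
  𝟙 true  = 1
  𝟙 false = 0

  ∑ : List X → (X → ℕ) → ℕ
  ∑ []       f = 0
  ∑ (x ∷ xs) f = f x + ∑ xs f

  ∑-cong : (xs : List X) {f g : X → ℕ} → (∀ x → f x ≡ g x) → ∑ xs f ≡ ∑ xs g
  ∑-cong []       f≗g = refl
  ∑-cong (x ∷ xs) f≗g = cong₂ _+_ (f≗g x) (∑-cong xs f≗g)

  ∑-mono : (xs : List X) {f g : X → ℕ} → (∀ x → f x ≤ g x) → ∑ xs f ≤ ∑ xs g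
  ∑-mono []       f≤g = z≤n
  ∑-mono (x ∷ xs) f≤g = +-mono-≤ (f≤g x) (∑-mono xs f≤g)

  ∑-+ : (xs : List X) (f g : X → ℕ) → ∑ xs (λ x → f x + g x) ≡ ∑ xs f + ∑ xs g
  ∑-+ []       f g = refl
  ∑-+ (x ∷ xs) f g = trans (cong (f x + g x +_) (∑-+ xs f g)) (interchange (f x) (g x) (∑ xs f) (∑ xs g))
    where
    interchange : ∀ a b c d → a + b + (c + d) ≡ a + c + (b + d)
    interchange = solve-∀

  ∑-zero : (xs : List X) → ∑ xs (λ _ → 0) ≡ 0
  ∑-zero []       = refl
  ∑-zero (x ∷ xs) = ∑-zero xs

  ∑-*ʳ : (xs : List X) (f : X → ℕ) (c : ℕ) → ∑ xs f * c ≡ ∑ xs (λ x → f x * c)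
  ∑-*ʳ []       f c = refl
  ∑-*ʳ (x ∷ xs) f c = trans (*-distribʳ-+ c (f x) _) (cong (f x * c +_) (∑-*ʳ xs f c))

  ∑-++ : (xs ys : List X) (f : X → ℕ) → ∑ (xs ++ ys) f ≡ ∑ xs f + ∑ ys f
  ∑-++ []       ys f = refl
  ∑-++ (x ∷ xs) ys f = trans (cong (f x +_) (∑-++ xs ys f)) (sym (+-assoc (f x) _ _))

  ∑-map : (g : Y → X) (ys : List Y) (f : X → ℕ) → ∑ (map g ys) f ≡ ∑ ys (λ y → f (g y))
  ∑-map g []       f = refl
  ∑-map g (y ∷ ys) f = cong (f (g y) +_) (∑-map g ys f)

  ∑-comm : (xs : List X) (ys : List Y) (h : X → Y → ℕ) →
    ∑ xs (λ x → ∑ ys (h x)) ≡ ∑ ys (λ y → ∑ xs (λ x → h x y))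
  ∑-comm []       ys h = sym (∑-zero ys)
  ∑-comm (x ∷ xs) ys h =
    trans (cong (∑ ys (h x) +_) (∑-comm xs ys h)) (sym (∑-+ ys (h x) (λ y → ∑ xs (λ x → h x y))))

  ∑-positive : (xs : List X) (f : X → ℕ) → 1 ≤ ∑ xs f → Σ[ x ∈ X ] 1 ≤ f x
  ∑-positive (x ∷ xs) f 1≤ with f x in fx≡
  ... | zero  = ∑-positive xs f 1≤
  ... | suc _ = x , subst (1 ≤_) (sym fx≡) (s≤s z≤n)

  card≡∑𝟙 : (𝓕 : Family n) → card 𝓕 ≡ ∑ (allSubsets n) (λ A → 𝟙 (𝓕 A))
  card≡∑𝟙 {n} 𝓕 = go (allSubsets n)
    where
    go : (As : List (Subset n)) → length (filter (λ A → 𝓕 A Bool.≟ true) As) ≡ ∑ As (λ A → 𝟙 (𝓕 A))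
    go []       = refl
    go (A ∷ As) with 𝓕 A
    ... | true  = cong suc (go As)
    ... | false = go As

  card-cong : (𝓕 𝓖 : Family n) → 𝓕 ≐ 𝓖 → card 𝓕 ≡ card 𝓖
  card-cong {n} 𝓕 𝓖 𝓕≐𝓖 = begin
    card 𝓕                              ≡⟨ card≡∑𝟙 𝓕 ⟩
    ∑ (allSubsets n) (λ A → 𝟙 (𝓕 A))    ≡⟨ ∑-cong (allSubsets n) (λ A → cong 𝟙 (𝓕≐𝓖 A)) ⟩
    ∑ (allSubsets n) (λ A → 𝟙 (𝓖 A))    ≡⟨ card≡∑𝟙 𝓖 ⟨
    card 𝓖                              ∎
    where open ≡-Reasoning

  card-mono : (𝓕 𝓖 : Family n) → 𝓕 ⊆F 𝓖 → card 𝓕 ≤ card 𝓖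
  card-mono {n} 𝓕 𝓖 𝓕⊆𝓖 = subst₂ _≤_ (sym (card≡∑𝟙 𝓕)) (sym (card≡∑𝟙 𝓖))
    (∑-mono (allSubsets n) (λ A → 𝟙-mono (𝓕 A) (𝓖 A) (𝓕⊆𝓖 A)))
    where
    𝟙-mono : (a b : Bool) → (a ≡ true → b ≡ true) → 𝟙 a ≤ 𝟙 b
    𝟙-mono true  b a⇒b rewrite a⇒b refl = ≤-refl
    𝟙-mono false b _   = z≤n

  card-split : (𝓕 𝓟 : Family n) → card 𝓕 ≡ card (𝓕 ∩F 𝓟) + card (𝓕 ∖F 𝓟)
  card-split {n} 𝓕 𝓟 = begin
    card 𝓕
      ≡⟨ card≡∑𝟙 𝓕 ⟩
    ∑ As (λ A → 𝟙 (𝓕 A))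
      ≡⟨ ∑-cong As (λ A → 𝟙-split (𝓕 A) (𝓟 A)) ⟩
    ∑ As (λ A → 𝟙 ((𝓕 ∩F 𝓟) A) + 𝟙 ((𝓕 ∖F 𝓟) A))
      ≡⟨ ∑-+ As _ _ ⟩
    ∑ As (λ A → 𝟙 ((𝓕 ∩F 𝓟) A)) + ∑ As (λ A → 𝟙 ((𝓕 ∖F 𝓟) A))
      ≡⟨ cong₂ _+_ (card≡∑𝟙 (𝓕 ∩F 𝓟)) (card≡∑𝟙 (𝓕 ∖F 𝓟)) ⟨
    card (𝓕 ∩F 𝓟) + card (𝓕 ∖F 𝓟)
      ∎
    where
    open ≡-Reasoning
    As = allSubsets n
    𝟙-split : (a b : Bool) → 𝟙 a ≡ 𝟙 (a ∧ b) + 𝟙 (a ∧ not b)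
    𝟙-split true  true  = refl
    𝟙-split true  false = refl
    𝟙-split false b     = refl

  card-∷ : (𝓕 : Family (suc n)) → card 𝓕 ≡ card (λ B → 𝓕 (true ∷ B)) + card (λ B → 𝓕 (false ∷ B))
  card-∷ {n} 𝓕 = begin
    card 𝓕
      ≡⟨ card≡∑𝟙 𝓕 ⟩
    ∑ (map (true ∷_) As ++ map (false ∷_) As) (λ A → 𝟙 (𝓕 A))
      ≡⟨ ∑-++ (map (true ∷_) As) _ _ ⟩
    ∑ (map (true ∷_) As) (λ A → 𝟙 (𝓕 A)) + ∑ (map (false ∷_) As) (λ A → 𝟙 (𝓕 A))
      ≡⟨ cong₂ _+_ (∑-map (true ∷_) As _) (∑-map (false ∷_) As _) ⟩
    ∑ As (λ B → 𝟙 (𝓕 (true ∷ B))) + ∑ As (λ B → 𝟙 (𝓕 (false ∷ B)))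
      ≡⟨ cong₂ _+_ (card≡∑𝟙 (λ B → 𝓕 (true ∷ B))) (card≡∑𝟙 (λ B → 𝓕 (false ∷ B))) ⟨
    card (λ B → 𝓕 (true ∷ B)) + card (λ B → 𝓕 (false ∷ B))
      ∎
    where
    open ≡-Reasoning
    As = allSubsets n

  card-∅ : (𝓕 : Family n) → (∀ A → 𝓕 A ≡ false) → card 𝓕 ≡ 0
  card-∅ {n} 𝓕 𝓕≐∅ =
    trans (card≡∑𝟙 𝓕) (trans (∑-cong (allSubsets n) (λ A → cong 𝟙 (𝓕≐∅ A))) (∑-zero (allSubsets n)))

  member-or-empty : (𝓕 : Family n) → (Σ[ A ∈ Subset n ] A ∈F 𝓕) ⊎ card 𝓕 ≡ 0
  member-or-empty {n} 𝓕 with card 𝓕 in card≡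
  ... | zero  = inj₂ refl
  ... | suc _ with ∑-positive (allSubsets n) (λ A → 𝟙 (𝓕 A)) (subst (1 ≤_) (trans (sym card≡) (card≡∑𝟙 𝓕)) (s≤s z≤n))
  ...   | A , 1≤𝟙 = inj₁ (A , 𝟙-positive (𝓕 A) 1≤𝟙)
    where
    𝟙-positive : (b : Bool) → 1 ≤ 𝟙 b → b ≡ true
    𝟙-positive true _ = refl

  card≡1 : (𝓕 : Family n) (Y : Subset n) → Y ∈F 𝓕 → (∀ A → A ∈F 𝓕 → A ≡ Y) → card 𝓕 ≡ 1
  card≡1 {zero}  𝓕 Data.Vec.[] Y∈ _ rewrite Y∈ = refl
  card≡1 {suc n} 𝓕 (true ∷ Y) Y∈ unique = trans (card-∷ 𝓕) (cong₂ _+_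
    (card≡1 _ Y Y∈ (λ A A∈ → Vec.∷-injectiveʳ (unique _ A∈)))
    (card-∅ _ (λ A → not-member (false ∷ A) (λ ()))))
    where
    not-member : ∀ A → ¬ A ≡ true ∷ Y → 𝓕 A ≡ false
    not-member A A≢ with 𝓕 A in A∈
    ... | true  = ⊥-elim (A≢ (unique A A∈))
    ... | false = refl
  card≡1 {suc n} 𝓕 (false ∷ Y) Y∈ unique = trans (card-∷ 𝓕) (cong₂ _+_
    (card-∅ _ (λ A → not-member (true ∷ A) (λ ())))
    (card≡1 _ Y Y∈ (λ A A∈ → Vec.∷-injectiveʳ (unique _ A∈))))
    where
    not-member : ∀ A → ¬ A ≡ false ∷ Y → 𝓕 A ≡ false
    not-member A A≢ with 𝓕 A in A∈
    ... | true  = ⊥-elim (A≢ (unique A A∈))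
    ... | false = refl

  card-Single : (Y : Subset n) → card (Single Y) ≡ 1
  card-Single Y = card≡1 (Single Y) Y (Single-∋ Y) (Single-≡ Y)

  card-< : (𝓕 𝓖 : Family n) (A : Subset n) → 𝓕 ⊆F 𝓖 → A ∈F 𝓖 → 𝓕 A ≡ false → card 𝓕 < card 𝓖
  card-< 𝓕 𝓖 A 𝓕⊆𝓖 A∈𝓖 A∉𝓕 = begin-strict
    card 𝓕                                 <⟨ s≤s (card-mono 𝓕 (𝓖 ∖F Single A) 𝓕⊆𝓖∖A) ⟩
    1 + card (𝓖 ∖F Single A)               ≡⟨ cong (_+ card (𝓖 ∖F Single A)) card-𝓖∩A ⟨
    card (𝓖 ∩F Single A) + card (𝓖 ∖F Single A) ≡⟨ card-split 𝓖 (Single A) ⟨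
    card 𝓖                                 ∎
    where
    open ≤-Reasoning
    card-𝓖∩A : card (𝓖 ∩F Single A) ≡ 1
    card-𝓖∩A = card≡1 _ A (∧-true A∈𝓖 (Single-∋ A)) (λ B B∈ → Single-≡ A B (∧-conicalʳ (𝓖 B) _ B∈))
    𝓕⊆𝓖∖A : 𝓕 ⊆F (𝓖 ∖F Single A)
    𝓕⊆𝓖∖A B B∈𝓕 with Single A B in B∈A
    ... | false = ∧-true (𝓕⊆𝓖 B B∈𝓕) refl
    ... | true with Single-≡ A B B∈A
    ...   | refl = contradiction (trans (sym B∈𝓕) A∉𝓕) λ ()

  card-≥⇒⊇ : (𝓕 𝓖 : Family n) → 𝓕 ⊆F 𝓖 → card 𝓖 ≤ card 𝓕 → 𝓖 ⊆F 𝓕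
  card-≥⇒⊇ 𝓕 𝓖 𝓕⊆𝓖 𝓖≤𝓕 A A∈𝓖 with 𝓕 A in A∈𝓕
  ... | true  = refl
  ... | false = ⊥-elim (<⇒≱ (card-< 𝓕 𝓖 A 𝓕⊆𝓖 A∈𝓖 A∈𝓕) 𝓖≤𝓕)

  member⇒card≥1 : (𝓕 : Family n) (A : Subset n) → A ∈F 𝓕 → 1 ≤ card 𝓕
  member⇒card≥1 {n} 𝓕 A A∈ = subst (_< card 𝓕) (card-∅ {n} ∅F (λ _ → refl)) (card-< ∅F 𝓕 A (λ _ ()) A∈ refl)

  card≡0⇒∉ : (𝓕 : Family n) → card 𝓕 ≡ 0 → ∀ A → 𝓕 A ≡ false
  card≡0⇒∉ 𝓕 card≡0 A with 𝓕 A in A∈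
  ... | true  = ⊥-elim (<-irrefl (sym card≡0) (member⇒card≥1 𝓕 A A∈))
  ... | false = refl

  card-∪ : (𝓕 𝓖 : Family n) → (∀ A → A ∈F 𝓕 → 𝓖 A ≡ false) → card (𝓕 ∪F 𝓖) ≡ card 𝓕 + card 𝓖
  card-∪ 𝓕 𝓖 disjoint = trans (card-split (𝓕 ∪F 𝓖) 𝓕) (cong₂ _+_ (card-cong _ _ left) (card-cong _ _ right))
    where
    left : ∀ A → (𝓕 A ∨ 𝓖 A) ∧ 𝓕 A ≡ 𝓕 A
    left A with 𝓕 A
    ... | true  = refl
    ... | false = ∧-zeroʳ (𝓖 A)
    right : ∀ A → (𝓕 A ∨ 𝓖 A) ∧ not (𝓕 A) ≡ 𝓖 A
    right A with 𝓕 A in A∈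
    ... | true  = sym (disjoint A A∈)
    ... | false = ∧-identityʳ (𝓖 A)

  card-insert : (A : Subset n) (𝓖 : Family n) → 𝓖 A ≡ false → card (Single A ∪F 𝓖) ≡ suc (card 𝓖)
  card-insert A 𝓖 A∉ =
    trans (card-∪ (Single A) 𝓖 (λ B B∈ → subst (λ X → 𝓖 X ≡ false) (sym (Single-≡ A B B∈)) A∉))
          (cong (_+ card 𝓖) (card-Single A))

  abstract
    subfamily-of-size : (𝓧 : Family n) (s : ℕ) → s ≤ card 𝓧 → Σ[ 𝓒 ∈ Family n ] 𝓒 ⊆F 𝓧 × card 𝓒 ≡ s
    subfamily-of-size {n} 𝓧 zero _ = ∅F , (λ _ ()) , card-∅ {n} ∅F (λ _ → refl)
    subfamily-of-size 𝓧 (suc s) s<𝓧 with subfamily-of-size 𝓧 s (<⇒≤ s<𝓧)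
    ... | 𝓒 , 𝓒⊆𝓧 , card𝓒 with member-or-empty (𝓧 ∖F 𝓒)
    ...   | inj₁ (A , A∈) =
      Single A ∪F 𝓒 , A∪𝓒⊆𝓧 , trans (card-insert A 𝓒 (not-injective (∧-conicalʳ (𝓧 A) _ A∈))) (cong suc card𝓒)
      where
      A∪𝓒⊆𝓧 : (Single A ∪F 𝓒) ⊆F 𝓧
      A∪𝓒⊆𝓧 B B∈ with ∪F⁻ (Single A) 𝓒 B B∈
      ... | inj₁ B∈A rewrite Single-≡ A B B∈A = ∧-conicalˡ (𝓧 A) _ A∈
      ... | inj₂ B∈𝓒 = 𝓒⊆𝓧 B B∈𝓒
    ...   | inj₂ 𝓧∖𝓒≡0 = contradiction s<𝓧 (<-irrefl (begin
      s                              ≡⟨ card𝓒 ⟨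
      card 𝓒                         ≡⟨ card-cong _ _ 𝓧∩𝓒≐𝓒 ⟨
      card (𝓧 ∩F 𝓒)                  ≡⟨ +-identityʳ _ ⟨
      card (𝓧 ∩F 𝓒) + 0              ≡⟨ cong (card (𝓧 ∩F 𝓒) +_) 𝓧∖𝓒≡0 ⟨
      card (𝓧 ∩F 𝓒) + card (𝓧 ∖F 𝓒)  ≡⟨ card-split 𝓧 𝓒 ⟨
      card 𝓧                         ∎))
      where
      open ≡-Reasoning
      𝓧∩𝓒≐𝓒 : ∀ A → 𝓧 A ∧ 𝓒 A ≡ 𝓒 A
      𝓧∩𝓒≐𝓒 A with 𝓒 A in A∈
      ... | true rewrite 𝓒⊆𝓧 A A∈ = refl
      ... | false = ∧-zeroʳ (𝓧 A)

  card≥2⇒two-members : (𝓕 : Family n) → 2 ≤ card 𝓕 →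
    Σ[ A ∈ Subset n ] Σ[ B ∈ Subset n ] A ∈F 𝓕 × B ∈F 𝓕 × ¬ A ≡ B
  card≥2⇒two-members 𝓕 2≤ with member-or-empty 𝓕
  ... | inj₂ card≡0 = ⊥-elim (<-irrefl (sym card≡0) (≤-trans (s≤s z≤n) 2≤))
  ... | inj₁ (A , A∈) with member-or-empty (𝓕 ∖F Single A)
  ...   | inj₁ (B , B∈) = A , B , A∈ , ∧-conicalˡ (𝓕 B) _ B∈ , A≢B
    where
    A≢B : ¬ A ≡ B
    A≢B refl = contradiction (trans (sym (∧-conicalʳ (𝓕 A) _ B∈)) (cong not (Single-∋ A))) λ ()
  ...   | inj₂ card≡0 = contradiction 2≤ (<-irrefl (sym (begin
      card 𝓕                                      ≡⟨ card-split 𝓕 (Single A) ⟩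
      card (𝓕 ∩F Single A) + card (𝓕 ∖F Single A) ≡⟨ cong₂ _+_ card-𝓕∩A card≡0 ⟩
      1                                           ∎)))
    where
    open ≡-Reasoning
    card-𝓕∩A : card (𝓕 ∩F Single A) ≡ 1
    card-𝓕∩A = card≡1 _ A (∧-true A∈ (Single-∋ A)) (λ B B∈ → Single-≡ A B (∧-conicalʳ (𝓕 B) _ B∈))

  ∑F : Family n → (Subset n → ℕ) → ℕ
  ∑F {n} 𝓕 f = ∑ (allSubsets n) (λ A → if 𝓕 A then f A else 0)

  syntax ∑F 𝓕 (λ A → e) = ∑[ A ∈ 𝓕 ] e

  ∑F-monoʳ : (𝓕 : Family n) {f g : Subset n → ℕ} → (∀ A → A ∈F 𝓕 → f A ≤ g A) → ∑F 𝓕 f ≤ ∑F 𝓕 g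
  ∑F-monoʳ {n} 𝓕 {f} {g} f≤g = ∑-mono (allSubsets n) pointwise
    where
    pointwise : ∀ A → (if 𝓕 A then f A else 0) ≤ (if 𝓕 A then g A else 0)
    pointwise A with 𝓕 A in A∈
    ... | true  = f≤g A A∈
    ... | false = z≤n

  ∑F-monoˡ : (𝓕 𝓖 : Family n) (f : Subset n → ℕ) → 𝓕 ⊆F 𝓖 → ∑F 𝓕 f ≤ ∑F 𝓖 f
  ∑F-monoˡ {n} 𝓕 𝓖 f 𝓕⊆𝓖 = ∑-mono (allSubsets n) pointwise
    where
    pointwise : ∀ A → (if 𝓕 A then f A else 0) ≤ (if 𝓖 A then f A else 0)
    pointwise A with 𝓕 A in A∈
    ... | true rewrite 𝓕⊆𝓖 A A∈ = ≤-refl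
    ... | false = z≤n

  ∑F-const : (𝓕 : Family n) (c : ℕ) → ∑F 𝓕 (λ _ → c) ≡ card 𝓕 * c
  ∑F-const {n} 𝓕 c = begin
    ∑ As (λ A → if 𝓕 A then c else 0) ≡⟨ ∑-cong As (λ A → if-𝟙 (𝓕 A)) ⟩
    ∑ As (λ A → 𝟙 (𝓕 A) * c)          ≡⟨ ∑-*ʳ As (λ A → 𝟙 (𝓕 A)) c ⟨
    ∑ As (λ A → 𝟙 (𝓕 A)) * c          ≡⟨ cong (_* c) (card≡∑𝟙 𝓕) ⟨
    card 𝓕 * c                         ∎
    where
    open ≡-Reasoning
    As = allSubsets n
    if-𝟙 : (b : Bool) → (if b then c else 0) ≡ 𝟙 b * c
    if-𝟙 true  = sym (+-identityʳ c)
    if-𝟙 false = refl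

  ∑F-≤ : (𝓕 : Family n) (f : Subset n → ℕ) (c : ℕ) → (∀ A → A ∈F 𝓕 → f A ≤ c) → ∑F 𝓕 f ≤ card 𝓕 * c
  ∑F-≤ 𝓕 f c f≤c = ≤-trans (∑F-monoʳ 𝓕 f≤c) (≤-reflexive (∑F-const 𝓕 c))

  ∑F-≥ : (𝓕 : Family n) (f : Subset n → ℕ) (c : ℕ) → (∀ A → A ∈F 𝓕 → c ≤ f A) → card 𝓕 * c ≤ ∑F 𝓕 f
  ∑F-≥ 𝓕 f c c≤f = ≤-trans (≤-reflexive (sym (∑F-const 𝓕 c))) (∑F-monoʳ 𝓕 c≤f)

  ∑F-card : (𝓕 𝓖 : Family n) (R : Subset n → Subset n → Bool) →
    ∑F 𝓕 (λ A → card (𝓖 ∩F R A)) ≡ ∑ (allSubsets n) (λ A → ∑ (allSubsets n) (λ B → 𝟙 (𝓕 A ∧ (𝓖 B ∧ R A B))))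
  ∑F-card {n} 𝓕 𝓖 R = ∑-cong (allSubsets n) (λ A → if-card (𝓕 A) A)
    where
    if-card : (b : Bool) (A : Subset n) →
      (if b then card (𝓖 ∩F R A) else 0) ≡ ∑ (allSubsets n) (λ B → 𝟙 (b ∧ (𝓖 B ∧ R A B)))
    if-card true  A = card≡∑𝟙 (𝓖 ∩F R A)
    if-card false A = sym (∑-zero (allSubsets n))

  double-counting : (𝓕 𝓖 : Family n) (R : Subset n → Subset n → Bool) →
    ∑[ A ∈ 𝓕 ] card (𝓖 ∩F R A) ≡ ∑[ B ∈ 𝓖 ] card (𝓕 ∩F (λ A → R A B))
  double-counting {n} 𝓕 𝓖 R = begin
    ∑[ A ∈ 𝓕 ] card (𝓖 ∩F R A)
      ≡⟨ ∑F-card 𝓕 𝓖 R ⟩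
    ∑ As (λ A → ∑ As (λ B → 𝟙 (𝓕 A ∧ (𝓖 B ∧ R A B))))
      ≡⟨ ∑-comm As As _ ⟩
    ∑ As (λ B → ∑ As (λ A → 𝟙 (𝓕 A ∧ (𝓖 B ∧ R A B))))
      ≡⟨ ∑-cong As (λ B → ∑-cong As (λ A → cong 𝟙 (∧-swap (𝓕 A) (𝓖 B) (R A B)))) ⟩
    ∑ As (λ B → ∑ As (λ A → 𝟙 (𝓖 B ∧ (𝓕 A ∧ R A B))))
      ≡⟨ ∑F-card 𝓖 𝓕 (λ B A → R A B) ⟨
    ∑[ B ∈ 𝓖 ] card (𝓕 ∩F (λ A → R A B))
      ∎
    where
    open ≡-Reasoning
    As = allSubsets n
    ∧-swap : (a b c : Bool) → a ∧ (b ∧ c) ≡ b ∧ (a ∧ c)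
    ∧-swap true  b c = refl
    ∧-swap false true  c = refl
    ∧-swap false false c = refl

  ∑F-tight : (𝓕 : Family n) (g : Subset n → ℕ) (c : ℕ) → card 𝓕 * c ≤ ∑F 𝓕 g → (∀ A → A ∈F 𝓕 → g A ≤ c) →
    ∀ A → A ∈F 𝓕 → g A ≡ c
  ∑F-tight {n} 𝓕 g c 𝓕c≤∑g g≤c A₀ A₀∈ with m≤n⇒m<n∨m≡n (g≤c A₀ A₀∈)
  ... | inj₂ gA₀≡c = gA₀≡c
  ... | inj₁ gA₀<c = contradiction (∑F-≤ 𝓕 bumped c bumped≤c) (<⇒≱ (begin-strict
      card 𝓕 * c          ≤⟨ 𝓕c≤∑g ⟩
      ∑F 𝓕 g              <⟨ m<m+n (∑F 𝓕 g) (s≤s z≤n) ⟩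
      ∑F 𝓕 g + 1          ≡⟨ ∑F-bumped ⟨
      ∑F 𝓕 bumped         ∎))
    where
    open ≤-Reasoning
    bumped : Subset n → ℕ
    bumped A = g A + 𝟙 (Single A₀ A)
    bumped≤c : ∀ A → A ∈F 𝓕 → bumped A ≤ c
    bumped≤c A A∈ with Single A₀ A in A∈A₀
    ... | true rewrite Single-≡ A₀ A A∈A₀ = subst (_≤ c) (+-comm 1 (g A₀)) gA₀<c
    ... | false = subst (_≤ c) (sym (+-identityʳ _)) (g≤c A A∈)
    ∑F-bumped : ∑F 𝓕 bumped ≡ ∑F 𝓕 g + 1
    ∑F-bumped = begin-equality
      ∑F 𝓕 bumped
        ≡⟨ ∑-cong (allSubsets n) (λ A → if-+ (𝓕 A) A) ⟩
      ∑ (allSubsets n) (λ A → (if 𝓕 A then g A else 0) + 𝟙 ((𝓕 ∩F Single A₀) A))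
        ≡⟨ ∑-+ (allSubsets n) _ _ ⟩
      ∑F 𝓕 g + ∑ (allSubsets n) (λ A → 𝟙 ((𝓕 ∩F Single A₀) A))
        ≡⟨ cong (∑F 𝓕 g +_) (card≡∑𝟙 (𝓕 ∩F Single A₀)) ⟨
      ∑F 𝓕 g + card (𝓕 ∩F Single A₀)
        ≡⟨ cong (∑F 𝓕 g +_) (card≡1 _ A₀ (∧-true A₀∈ (Single-∋ A₀)) (λ B B∈ → Single-≡ A₀ B (∧-conicalʳ (𝓕 B) _ B∈))) ⟩
      ∑F 𝓕 g + 1
        ∎
      where
      if-+ : (b : Bool) (A : Subset n) →
        (if b then bumped A else 0) ≡ (if b then g A else 0) + 𝟙 (b ∧ Single A₀ A)
      if-+ true  A = refl
      if-+ false A = refl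

  two-members⇒card≥2 : (𝓕 : Family n) (A B : Subset n) → A ∈F 𝓕 → B ∈F 𝓕 → ¬ A ≡ B → 2 ≤ card 𝓕
  two-members⇒card≥2 𝓕 A B A∈ B∈ A≢B = subst (_< card 𝓕) (card-Single A)
    (card-< (Single A) 𝓕 B (λ C C∈ → subst (_∈F 𝓕) (sym (Single-≡ A C C∈)) A∈) B∈ (Single-∌ A B (λ B≡A → A≢B (sym B≡A))))

  three-members⇒card≥3 : (𝓕 : Family n) (A B C : Subset n) → A ∈F 𝓕 → B ∈F 𝓕 → C ∈F 𝓕 →
    ¬ A ≡ B → ¬ C ≡ A → ¬ C ≡ B → 3 ≤ card 𝓕
  three-members⇒card≥3 𝓕 A B C A∈ B∈ C∈ A≢B C≢A C≢B = subst (_< card 𝓕) card-AB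
    (card-< (Single A ∪F Single B) 𝓕 C AB⊆𝓕 C∈ (cong₂ _∨_ (Single-∌ A C C≢A) (Single-∌ B C C≢B)))
    where
    card-AB : card (Single A ∪F Single B) ≡ 2
    card-AB = trans (card-insert A (Single B) (Single-∌ B A A≢B)) (cong suc (card-Single B))
    AB⊆𝓕 : (Single A ∪F Single B) ⊆F 𝓕
    AB⊆𝓕 D D∈ with ∪F⁻ (Single A) (Single B) D D∈
    ... | inj₁ D∈A = subst (_∈F 𝓕) (sym (Single-≡ A D D∈A)) A∈
    ... | inj₂ D∈B = subst (_∈F 𝓕) (sym (Single-≡ B D D∈B)) B∈

  card≡1⇒≐Single : (𝓕 : Family n) (A : Subset n) → card 𝓕 ≡ 1 → A ∈F 𝓕 → 𝓕 ≐ Single A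
  card≡1⇒≐Single 𝓕 A card≡1 A∈ B with 𝓕 B in B∈ | Single A B in B∈A
  ... | true  | true  = refl
  ... | false | false = refl
  ... | false | true  = contradiction (trans (sym B∈) (trans (cong 𝓕 (Single-≡ A B B∈A)) A∈)) λ ()
  ... | true  | false = contradiction (two-members⇒card≥2 𝓕 A B A∈ B∈ A≢B) (<-irrefl (sym card≡1))
    where
    A≢B : ¬ A ≡ B
    A≢B refl = contradiction (trans (sym B∈A) (Single-∋ A)) λ ()

  card-∩≤ : (𝓐 𝓟 : Family n) (c : ℕ) → card 𝓐 ≡ c + 2 → 2 ≤ card (𝓐 ∖F 𝓟) → card (𝓐 ∩F 𝓟) ≤ c
  card-∩≤ 𝓐 𝓟 c card𝓐≡ 2≤ = +-cancelʳ-≤ 2 _ _ (begin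
    card (𝓐 ∩F 𝓟) + 2              ≤⟨ +-monoʳ-≤ (card (𝓐 ∩F 𝓟)) 2≤ ⟩
    card (𝓐 ∩F 𝓟) + card (𝓐 ∖F 𝓟)  ≡⟨ card-split 𝓐 𝓟 ⟨
    card 𝓐                         ≡⟨ card𝓐≡ ⟩
    c + 2                          ∎)
    where open ≤-Reasoning

  card-∖≤ : (𝓐 𝓟 : Family n) (c : ℕ) → card 𝓐 ≡ c + 2 → 2 ≤ card (𝓐 ∩F 𝓟) → card (𝓐 ∖F 𝓟) ≤ c
  card-∖≤ 𝓐 𝓟 c card𝓐≡ 2≤ = +-cancelˡ-≤ 2 _ _ (begin
    2 + card (𝓐 ∖F 𝓟)              ≤⟨ +-monoˡ-≤ (card (𝓐 ∖F 𝓟)) 2≤ ⟩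
    card (𝓐 ∩F 𝓟) + card (𝓐 ∖F 𝓟)  ≡⟨ card-split 𝓐 𝓟 ⟨
    card 𝓐                         ≡⟨ card𝓐≡ ⟩
    c + 2                          ≡⟨ +-comm c 2 ⟩
    2 + c                          ∎)
    where open ≤-Reasoning

  ≐-∪∖ : (𝓖 𝓜 𝓟 : Family n) → 𝓜 ⊆F 𝓖 → (∀ B → B ∈F 𝓖 → 𝓟 B ≡ 𝓜 B) → 𝓖 ≐ (𝓜 ∪F (𝓖 ∖F 𝓟))
  ≐-∪∖ 𝓖 𝓜 𝓟 𝓜⊆𝓖 𝓟≡𝓜 B with 𝓖 B in B∈𝓖 | 𝓜 B in B∈𝓜
  ... | true  | true  = refl
  ... | true  | false rewrite 𝓟≡𝓜 B B∈𝓖 | B∈𝓜 = refl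
  ... | false | true  = contradiction (trans (sym B∈𝓖) (𝓜⊆𝓖 B B∈𝓜)) λ ()
  ... | false | false = refl


module SubsetSize where

  open import Data.Nat using (ℕ; zero; suc; _+_; _∸_; _≤_; _<_; s≤s)
  open import Data.Nat.Properties
  open import Data.Bool using (true; false)
  open import Data.Vec using ([]; _∷_; here; there)
  open import Data.Fin using (Fin; zero; suc)
  import Data.Fin as Fin
  open import Data.Fin.Subset
  open import Data.Fin.Subset.Properties
  open import Data.Product using (Σ-syntax; _,_)
  open import Data.Sum using (_⊎_; inj₁; inj₂)
  open import Relation.Binary.PropositionalEquality
  open import Relation.Nullary using (¬_; contradiction)
  open import Relation.Nullary.Decidable using (decidable-stable)

  private variable
    n : ℕ

  ∣p∩q∣+∣p∩∁q∣≡∣p∣ : (p q : Subset n) → ∣ p ∩ q ∣ + ∣ p ∩ ∁ q ∣ ≡ ∣ p ∣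
  ∣p∩q∣+∣p∩∁q∣≡∣p∣ []          []          = refl
  ∣p∩q∣+∣p∩∁q∣≡∣p∣ (true ∷ p)  (true ∷ q)  = cong suc (∣p∩q∣+∣p∩∁q∣≡∣p∣ p q)
  ∣p∩q∣+∣p∩∁q∣≡∣p∣ (true ∷ p)  (false ∷ q) = trans (+-suc _ _) (cong suc (∣p∩q∣+∣p∩∁q∣≡∣p∣ p q))
  ∣p∩q∣+∣p∩∁q∣≡∣p∣ (false ∷ p) (_ ∷ q)     = ∣p∩q∣+∣p∩∁q∣≡∣p∣ p q

  ∣p∩∁q∣≡∣p∣∸∣p∩q∣ : (p q : Subset n) → ∣ p ∩ ∁ q ∣ ≡ ∣ p ∣ ∸ ∣ p ∩ q ∣
  ∣p∩∁q∣≡∣p∣∸∣p∩q∣ p q = trans (sym (m+n∸m≡n ∣ p ∩ q ∣ _)) (cong (_∸ ∣ p ∩ q ∣) (∣p∩q∣+∣p∩∁q∣≡∣p∣ p q))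

  inclusion-exclusion : (r p q : Subset n) → ∣ r ∩ (p ∪ q) ∣ + ∣ r ∩ (p ∩ q) ∣ ≡ ∣ r ∩ p ∣ + ∣ r ∩ q ∣
  inclusion-exclusion []          []          []          = refl
  inclusion-exclusion (false ∷ r) (_ ∷ p)     (_ ∷ q)     = inclusion-exclusion r p q
  inclusion-exclusion (true ∷ r)  (true ∷ p)  (true ∷ q)  =
    cong suc (trans (+-suc _ _) (trans (cong suc (inclusion-exclusion r p q)) (sym (+-suc _ _))))
  inclusion-exclusion (true ∷ r)  (true ∷ p)  (false ∷ q) = cong suc (inclusion-exclusion r p q)
  inclusion-exclusion (true ∷ r)  (false ∷ p) (true ∷ q)  = trans (cong suc (inclusion-exclusion r p q)) (sym (+-suc _ _))
  inclusion-exclusion (true ∷ r)  (false ∷ p) (false ∷ q) = inclusion-exclusion r p q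

  ∣p∪q∣+∣p∩q∣≡∣p∣+∣q∣ : (p q : Subset n) → ∣ p ∪ q ∣ + ∣ p ∩ q ∣ ≡ ∣ p ∣ + ∣ q ∣
  ∣p∪q∣+∣p∩q∣≡∣p∣+∣q∣ p q = begin
    ∣ p ∪ q ∣ + ∣ p ∩ q ∣             ≡⟨ cong₂ (λ a b → ∣ a ∣ + ∣ b ∣) (∩-identityˡ (p ∪ q)) (∩-identityˡ (p ∩ q)) ⟨
    ∣ ⊤ ∩ (p ∪ q) ∣ + ∣ ⊤ ∩ (p ∩ q) ∣ ≡⟨ inclusion-exclusion ⊤ p q ⟩
    ∣ ⊤ ∩ p ∣ + ∣ ⊤ ∩ q ∣             ≡⟨ cong₂ (λ a b → ∣ a ∣ + ∣ b ∣) (∩-identityˡ p) (∩-identityˡ q) ⟩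
    ∣ p ∣ + ∣ q ∣                     ∎
    where open ≡-Reasoning

  ∣p∩q∣≡∣q∩p∣ : (p q : Subset n) → ∣ p ∩ q ∣ ≡ ∣ q ∩ p ∣
  ∣p∩q∣≡∣q∩p∣ p q = cong ∣_∣ (∩-comm p q)

  empty⇒∣p∣≡0 : (p : Subset n) → (∀ x → x ∉ p) → ∣ p ∣ ≡ 0
  empty⇒∣p∣≡0 {n} p p-empty = trans (cong ∣_∣ (Empty-unique (λ (x , x∈p) → p-empty x x∈p))) (∣⊥∣≡0 n)

  ∣p∣≥1⇒nonempty : (p : Subset n) → 1 ≤ ∣ p ∣ → Σ[ x ∈ Fin n ] x ∈ p
  ∣p∣≥1⇒nonempty (true ∷ p)  _ = zero , here
  ∣p∣≥1⇒nonempty (false ∷ p) 1≤ with ∣p∣≥1⇒nonempty p 1≤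
  ... | x , x∈p = suc x , there x∈p

  x∈p⇒∣p∣≥1 : {p : Subset n} {x : Fin n} → x ∈ p → 1 ≤ ∣ p ∣
  x∈p⇒∣p∣≥1 {x = x} x∈p = subst (_≤ _) (∣⁅x⁆∣≡1 x) (p⊆q⇒∣p∣≤∣q∣ (λ y∈⁅x⁆ → subst (_∈ _) (sym (x∈⁅y⁆⇒x≡y _ y∈⁅x⁆)) x∈p))

  x≢y∈p⇒∣p∣≥2 : {p : Subset n} {x y : Fin n} → x ∈ p → y ∈ p → ¬ x ≡ y → 2 ≤ ∣ p ∣
  x≢y∈p⇒∣p∣≥2 {p = true ∷ p}  here      here      x≢y = contradiction refl x≢y
  x≢y∈p⇒∣p∣≥2 {p = true ∷ p}  here      (there y) _   = s≤s (x∈p⇒∣p∣≥1 y)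
  x≢y∈p⇒∣p∣≥2 {p = true ∷ p}  (there x) here      _   = s≤s (x∈p⇒∣p∣≥1 x)
  x≢y∈p⇒∣p∣≥2 {p = true ∷ p}  (there x) (there y) x≢y = m≤n⇒m≤1+n (x≢y∈p⇒∣p∣≥2 x y (λ x≡y → x≢y (cong suc x≡y)))
  x≢y∈p⇒∣p∣≥2 {p = false ∷ p} (there x) (there y) x≢y = x≢y∈p⇒∣p∣≥2 x y (λ x≡y → x≢y (cong suc x≡y))

  ∣p∣≤1⇒x≡y : {p : Subset n} {x y : Fin n} → ∣ p ∣ ≤ 1 → x ∈ p → y ∈ p → x ≡ y
  ∣p∣≤1⇒x≡y {x = x} {y} ∣p∣≤1 x∈p y∈p =
    decidable-stable (x Fin.≟ y) (λ x≢y → <-irrefl refl (≤-trans (x≢y∈p⇒∣p∣≥2 x∈p y∈p x≢y) ∣p∣≤1))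

  p⊆q⇒p∩q≡p : {p q : Subset n} → p ⊆ q → p ∩ q ≡ p
  p⊆q⇒p∩q≡p {p = []}      {[]}      _   = refl
  p⊆q⇒p∩q≡p {p = true ∷ p} {true ∷ q} p⊆q = cong (true ∷_) (p⊆q⇒p∩q≡p (drop-∷-⊆ p⊆q))
  p⊆q⇒p∩q≡p {p = true ∷ p} {false ∷ q} p⊆q with p⊆q here
  ... | ()
  p⊆q⇒p∩q≡p {p = false ∷ p} {_ ∷ q} p⊆q = cong (false ∷_) (p⊆q⇒p∩q≡p (drop-∷-⊆ p⊆q))

  p⊆q⇒∣p∩q∣≡∣p∣ : {p q : Subset n} → p ⊆ q → ∣ p ∩ q ∣ ≡ ∣ p ∣
  p⊆q⇒∣p∩q∣≡∣p∣ p⊆q = cong ∣_∣ (p⊆q⇒p∩q≡p p⊆q)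

  q⊆p⇒∣p∩q∣≡∣q∣ : {p q : Subset n} → q ⊆ p → ∣ p ∩ q ∣ ≡ ∣ q ∣
  q⊆p⇒∣p∩q∣≡∣q∣ {p = p} {q} q⊆p = trans (∣p∩q∣≡∣q∩p∣ p q) (p⊆q⇒∣p∩q∣≡∣p∣ q⊆p)

  ∣p∣≤∣p∩q∣⇒p⊆q : (p q : Subset n) → ∣ p ∣ ≤ ∣ p ∩ q ∣ → p ⊆ q
  ∣p∣≤∣p∩q∣⇒p⊆q (true ∷ p)  (true ∷ q)  _  here      = here
  ∣p∣≤∣p∩q∣⇒p⊆q (true ∷ p)  (true ∷ q)  ≤∩ (there x) = there (∣p∣≤∣p∩q∣⇒p⊆q p q (≤-pred ≤∩) x)
  ∣p∣≤∣p∩q∣⇒p⊆q (true ∷ p)  (false ∷ q) ≤∩ _         = contradiction (≤-trans ≤∩ (∣p∩q∣≤∣p∣ p q)) (<-irrefl refl)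
  ∣p∣≤∣p∩q∣⇒p⊆q (false ∷ p) (_ ∷ q)     ≤∩ (there x) = there (∣p∣≤∣p∩q∣⇒p⊆q p q ≤∩ x)

  ∣q∣≤∣p∩q∣⇒q⊆p : (p q : Subset n) → ∣ q ∣ ≤ ∣ p ∩ q ∣ → q ⊆ p
  ∣q∣≤∣p∩q∣⇒q⊆p p q ≤∩ = ∣p∣≤∣p∩q∣⇒p⊆q q p (subst (∣ q ∣ ≤_) (∣p∩q∣≡∣q∩p∣ p q) ≤∩)

  p⊄q⇒∣p∩q∣<∣p∣ : (p q : Subset n) → ¬ p ⊆ q → ∣ p ∩ q ∣ < ∣ p ∣
  p⊄q⇒∣p∩q∣<∣p∣ p q p⊄q = ≤∧≢⇒< (∣p∩q∣≤∣p∣ p q) (λ ∣p∩q∣≡∣p∣ → p⊄q (∣p∣≤∣p∩q∣⇒p⊆q p q (≤-reflexive (sym ∣p∩q∣≡∣p∣))))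

  q⊄p⇒∣p∩q∣<∣q∣ : (p q : Subset n) → ¬ q ⊆ p → ∣ p ∩ q ∣ < ∣ q ∣
  q⊄p⇒∣p∩q∣<∣q∣ p q q⊄p = subst (_< ∣ q ∣) (∣p∩q∣≡∣q∩p∣ q p) (p⊄q⇒∣p∩q∣<∣p∣ q p q⊄p)

  p⊆q⇒∣q∣≤∣p∣⇒p≡q : {p q : Subset n} → p ⊆ q → ∣ q ∣ ≤ ∣ p ∣ → p ≡ q
  p⊆q⇒∣q∣≤∣p∣⇒p≡q {p = []}        {[]}        _   _  = refl
  p⊆q⇒∣q∣≤∣p∣⇒p≡q {p = true ∷ p}  {true ∷ q}  p⊆q q≤p = cong (true ∷_) (p⊆q⇒∣q∣≤∣p∣⇒p≡q (drop-∷-⊆ p⊆q) (≤-pred q≤p))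
  p⊆q⇒∣q∣≤∣p∣⇒p≡q {p = true ∷ p}  {false ∷ q} p⊆q _ with p⊆q here
  ... | ()
  p⊆q⇒∣q∣≤∣p∣⇒p≡q {p = false ∷ p} {true ∷ q}  p⊆q q≤p =
    contradiction (≤-trans q≤p (p⊆q⇒∣p∣≤∣q∣ (drop-∷-⊆ p⊆q))) (<-irrefl refl)
  p⊆q⇒∣q∣≤∣p∣⇒p≡q {p = false ∷ p} {false ∷ q} p⊆q q≤p = cong (false ∷_) (p⊆q⇒∣q∣≤∣p∣⇒p≡q (drop-∷-⊆ p⊆q) q≤p)

  p∩q⊆r∩q : {p r : Subset n} (q : Subset n) → p ⊆ r → p ∩ q ⊆ r ∩ q
  p∩q⊆r∩q {p = p} q p⊆r x∈p∩q = let (x∈p , x∈q) = x∈p∩q⁻ p q x∈p∩q in x∈p∩q⁺ (p⊆r x∈p , x∈q)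

  ∣⁅x⁆∩p∣≡1 : (p : Subset n) (x : Fin n) → x ∈ p → ∣ ⁅ x ⁆ ∩ p ∣ ≡ 1
  ∣⁅x⁆∩p∣≡1 p x x∈p = trans (cong ∣_∣ (p⊆q⇒p∩q≡p (λ y∈⁅x⁆ → subst (_∈ p) (sym (x∈⁅y⁆⇒x≡y _ y∈⁅x⁆)) x∈p))) (∣⁅x⁆∣≡1 x)

  ∣⁅x⁆∩p∣≡0 : (p : Subset n) (x : Fin n) → x ∉ p → ∣ ⁅ x ⁆ ∩ p ∣ ≡ 0
  ∣⁅x⁆∩p∣≡0 p x x∉p = empty⇒∣p∣≡0 _ (λ y y∈ → let (y∈⁅x⁆ , y∈p) = x∈p∩q⁻ _ p y∈ in
    x∉p (subst (_∈ p) (x∈⁅y⁆⇒x≡y _ y∈⁅x⁆) y∈p))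

  ∣p∪⁅x⁆∣≡1+∣p∣ : (p : Subset n) (x : Fin n) → x ∉ p → ∣ p ∪ ⁅ x ⁆ ∣ ≡ suc ∣ p ∣
  ∣p∪⁅x⁆∣≡1+∣p∣ p x x∉p = begin
    ∣ p ∪ ⁅ x ⁆ ∣                     ≡⟨ +-identityʳ _ ⟨
    ∣ p ∪ ⁅ x ⁆ ∣ + 0                 ≡⟨ cong (∣ p ∪ ⁅ x ⁆ ∣ +_) (trans (∣p∩q∣≡∣q∩p∣ p ⁅ x ⁆) (∣⁅x⁆∩p∣≡0 p x x∉p)) ⟨
    ∣ p ∪ ⁅ x ⁆ ∣ + ∣ p ∩ ⁅ x ⁆ ∣     ≡⟨ ∣p∪q∣+∣p∩q∣≡∣p∣+∣q∣ p ⁅ x ⁆ ⟩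
    ∣ p ∣ + ∣ ⁅ x ⁆ ∣                 ≡⟨ cong (∣ p ∣ +_) (∣⁅x⁆∣≡1 x) ⟩
    ∣ p ∣ + 1                         ≡⟨ +-comm ∣ p ∣ 1 ⟩
    suc ∣ p ∣                         ∎
    where open ≡-Reasoning

  x∈p∪⁅x⁆ : (p : Subset n) (x : Fin n) → x ∈ p ∪ ⁅ x ⁆
  x∈p∪⁅x⁆ p x = x∈p∪q⁺ (inj₂ (x∈⁅x⁆ x))

  x∈p∪⁅y⁆⁻ : {p : Subset n} {x y : Fin n} → x ∈ p ∪ ⁅ y ⁆ → x ∈ p ⊎ x ≡ y
  x∈p∪⁅y⁆⁻ {p = p} {y = y} x∈ with x∈p∪q⁻ p ⁅ y ⁆ x∈
  ... | inj₁ x∈p   = inj₁ x∈p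
  ... | inj₂ x∈⁅y⁆ = inj₂ (x∈⁅y⁆⇒x≡y _ x∈⁅y⁆)

  p⊆q∖⁅x,y⁆⇒∣p∣+2≤∣q∣ : {p q : Subset n} {x y : Fin n} → p ⊆ q → x ∈ q → y ∈ q → x ∉ p → y ∉ p → ¬ x ≡ y →
    ∣ p ∣ + 2 ≤ ∣ q ∣
  p⊆q∖⁅x,y⁆⇒∣p∣+2≤∣q∣ {p = p} {q} p⊆q x∈q y∈q x∉p y∉p x≢y = begin
    ∣ p ∣ + 2                  ≤⟨ +-monoʳ-≤ ∣ p ∣ (x≢y∈p⇒∣p∣≥2 (x∈p∩q⁺ (x∈q , x∉p⇒x∈∁p x∉p))
                                                                 (x∈p∩q⁺ (y∈q , x∉p⇒x∈∁p y∉p)) x≢y) ⟩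
    ∣ p ∣ + ∣ q ∩ ∁ p ∣         ≡⟨ cong (_+ ∣ q ∩ ∁ p ∣) (q⊆p⇒∣p∩q∣≡∣q∣ p⊆q) ⟨
    ∣ q ∩ p ∣ + ∣ q ∩ ∁ p ∣     ≡⟨ ∣p∩q∣+∣p∩∁q∣≡∣p∣ q p ⟩
    ∣ q ∣                      ∎
    where open ≤-Reasoning

  p≢q⇒∣p∩q∣≤k : {p q : Subset n} {k : ℕ} → ∣ p ∣ ≡ suc k → ∣ q ∣ ≡ suc k → ¬ p ≡ q → ∣ p ∩ q ∣ ≤ k
  p≢q⇒∣p∩q∣≤k {p = p} {q} ∣p∣≡ ∣q∣≡ p≢q = ≤-pred (subst (∣ p ∩ q ∣ <_) ∣p∣≡ (p⊄q⇒∣p∩q∣<∣p∣ p q p⊄q))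
    where
    p⊄q : ¬ p ⊆ q
    p⊄q p⊆q = p≢q (p⊆q⇒∣q∣≤∣p∣⇒p≡q p⊆q (≤-reflexive (trans ∣q∣≡ (sym ∣p∣≡))))

  ∣p∩∁q∣≡1 : (p q : Subset n) {k : ℕ} → ∣ p ∣ ≡ suc k → ∣ p ∩ q ∣ ≡ k → ∣ p ∩ ∁ q ∣ ≡ 1
  ∣p∩∁q∣≡1 p q {k} ∣p∣≡ ∣p∩q∣≡ = +-cancelˡ-≡ k _ _ (begin
    k + ∣ p ∩ ∁ q ∣          ≡⟨ cong (_+ ∣ p ∩ ∁ q ∣) ∣p∩q∣≡ ⟨
    ∣ p ∩ q ∣ + ∣ p ∩ ∁ q ∣  ≡⟨ ∣p∩q∣+∣p∩∁q∣≡∣p∣ p q ⟩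
    ∣ p ∣                    ≡⟨ trans ∣p∣≡ (+-comm 1 k) ⟩
    k + 1                    ∎)
    where open ≡-Reasoning

  p∩[q∩∁p]≡⊥ : (p q : Subset n) → p ∩ (q ∩ ∁ p) ≡ ⊥
  p∩[q∩∁p]≡⊥ p q = begin
    p ∩ (q ∩ ∁ p)  ≡⟨ cong (p ∩_) (∩-comm q (∁ p)) ⟩
    p ∩ (∁ p ∩ q)  ≡⟨ ∩-assoc p (∁ p) q ⟨
    (p ∩ ∁ p) ∩ q  ≡⟨ cong (_∩ q) (∩-inverseʳ p) ⟩
    ⊥ ∩ q          ≡⟨ ∩-zeroˡ q ⟩
    ⊥              ∎
    where open ≡-Reasoning


module Profile where

  open import Defs
  open Counting
  open SubsetSize
  open import Data.Nat using (ℕ; zero; suc; _+_; _*_; _≤_; s≤s; _≟_)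
  open import Data.Nat.Properties
  open import Data.Nat.Combinatorics using (_C_; nCk+nC[k+1]≡[n+1]C[k+1]; nC1≡n; nCk≡nC[n∸k])
  open import Data.Bool using (true; false; _∧_)
  open import Data.Bool.Properties using (∧-conicalˡ; ∧-conicalʳ)
  open import Data.Vec using ([]; _∷_)
  open import Data.Vec.Properties using (∷-injectiveʳ)
  open import Data.Fin.Subset
  open import Data.Fin.Subset.Properties using (∩-zeroʳ; ∣⊥∣≡0)
  open import Data.Product using (_×_; _,_)
  open import Relation.Binary.PropositionalEquality
  open import Relation.Nullary using (Dec; yes; does)
  open import Relation.Nullary.Decidable using (dec-true)
  open import Data.Nat.Tactic.RingSolver using (solve-∀)

  private variable
    n : ℕ

  ∣p∣≡profile : (P Q B : Subset n) → P ∩ Q ≡ ⊥ → ∣ B ∣ ≡ ∣ B ∩ P ∣ + ∣ B ∩ Q ∣ + ∣ B ∩ ∁ (P ∪ Q) ∣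
  ∣p∣≡profile {n} P Q B P∩Q≡⊥ = begin
    ∣ B ∣
      ≡⟨ ∣p∩q∣+∣p∩∁q∣≡∣p∣ B (P ∪ Q) ⟨
    ∣ B ∩ (P ∪ Q) ∣ + ∣ B ∩ ∁ (P ∪ Q) ∣
      ≡⟨ cong (_+ ∣ B ∩ ∁ (P ∪ Q) ∣) (+-identityʳ _) ⟨
    ∣ B ∩ (P ∪ Q) ∣ + 0 + ∣ B ∩ ∁ (P ∪ Q) ∣
      ≡⟨ cong (λ x → ∣ B ∩ (P ∪ Q) ∣ + x + ∣ B ∩ ∁ (P ∪ Q) ∣) ∣B∩[P∩Q]∣≡0 ⟨
    ∣ B ∩ (P ∪ Q) ∣ + ∣ B ∩ (P ∩ Q) ∣ + ∣ B ∩ ∁ (P ∪ Q) ∣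
      ≡⟨ cong (_+ ∣ B ∩ ∁ (P ∪ Q) ∣) (inclusion-exclusion B P Q) ⟩
    ∣ B ∩ P ∣ + ∣ B ∩ Q ∣ + ∣ B ∩ ∁ (P ∪ Q) ∣
      ∎
    where
    open ≡-Reasoning
    ∣B∩[P∩Q]∣≡0 : ∣ B ∩ (P ∩ Q) ∣ ≡ 0
    ∣B∩[P∩Q]∣≡0 = trans (cong (λ X → ∣ B ∩ X ∣) P∩Q≡⊥) (trans (cong ∣_∣ (∩-zeroʳ B)) (∣⊥∣≡0 n))

  -- Abstract, so that unification recovers the arguments of profile from a membership proof; written with
  -- does instead of ⌊_⌋ because does (suc x ≟ suc i) reduces to does (x ≟ i), which card-profile relies on.
  abstract

    profile : (P Q : Subset n) (i j l : ℕ) → Family n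
    profile P Q i j l B = does (∣ B ∩ P ∣ ≟ i) ∧ (does (∣ B ∩ Q ∣ ≟ j) ∧ does (∣ B ∩ ∁ (P ∪ Q) ∣ ≟ l))

    private
      does-true⁻¹ : {A : Set} (d : Dec A) → does d ≡ true → A
      does-true⁻¹ (yes a) _ = a

      pascal : ∀ m i b c → (m C i) * b * c + (m C suc i) * b * c ≡ (suc m C suc i) * b * c
      pascal m i b c = trans (sym (distrib (m C i) (m C suc i) b c)) (cong (λ a → a * b * c) (nCk+nC[k+1]≡[n+1]C[k+1] m i))
        where
        distrib : ∀ a a′ b c → (a + a′) * b * c ≡ a * b * c + a′ * b * c
        distrib = solve-∀

    card-profile : (P Q : Subset n) → P ∩ Q ≡ ⊥ → ∀ i j l →
      card (profile P Q i j l) ≡ (∣ P ∣ C i) * (∣ Q ∣ C j) * (∣ ∁ (P ∪ Q) ∣ C l)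
    card-profile [] [] _ zero    zero    zero    = refl
    card-profile [] [] _ zero    zero    (suc l) = refl
    card-profile [] [] _ zero    (suc j) l       = refl
    card-profile [] [] _ (suc i) j       l       = refl
    card-profile (true ∷ P) (false ∷ Q) P∩Q≡⊥ zero j l =
      trans (card-∷ (profile (true ∷ P) (false ∷ Q) zero j l))
        (cong₂ _+_ (card-∅ (λ B → profile (true ∷ P) (false ∷ Q) zero j l (true ∷ B)) (λ _ → refl))
                   (card-profile P Q (∷-injectiveʳ P∩Q≡⊥) zero j l))
    card-profile (true ∷ P) (false ∷ Q) P∩Q≡⊥ (suc i) j l = begin
      card (profile (true ∷ P) (false ∷ Q) (suc i) j l)
        ≡⟨ card-∷ (profile (true ∷ P) (false ∷ Q) (suc i) j l) ⟩
      card (profile P Q i j l) + card (profile P Q (suc i) j l)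
        ≡⟨ cong₂ _+_ (card-profile P Q P∩Q≡⊥′ i j l) (card-profile P Q P∩Q≡⊥′ (suc i) j l) ⟩
      (∣ P ∣ C i) * (∣ Q ∣ C j) * (∣ ∁ (P ∪ Q) ∣ C l) + (∣ P ∣ C suc i) * (∣ Q ∣ C j) * (∣ ∁ (P ∪ Q) ∣ C l)
        ≡⟨ pascal ∣ P ∣ i _ _ ⟩
      (suc ∣ P ∣ C suc i) * (∣ Q ∣ C j) * (∣ ∁ (P ∪ Q) ∣ C l)
        ∎
      where
      open ≡-Reasoning
      P∩Q≡⊥′ : P ∩ Q ≡ ⊥
      P∩Q≡⊥′ = ∷-injectiveʳ P∩Q≡⊥
    card-profile (false ∷ P) (true ∷ Q) P∩Q≡⊥ i zero l =
      trans (card-∷ (profile (false ∷ P) (true ∷ Q) i zero l))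
        (cong₂ _+_ (card-∅ (λ B → profile (false ∷ P) (true ∷ Q) i zero l (true ∷ B)) empty)
                   (card-profile P Q (∷-injectiveʳ P∩Q≡⊥) i zero l))
      where
      empty : ∀ B → profile (false ∷ P) (true ∷ Q) i zero l (true ∷ B) ≡ false
      empty B with does (∣ B ∩ P ∣ ≟ i)
      ... | true  = refl
      ... | false = refl
    card-profile (false ∷ P) (true ∷ Q) P∩Q≡⊥ i (suc j) l = begin
      card (profile (false ∷ P) (true ∷ Q) i (suc j) l)
        ≡⟨ card-∷ (profile (false ∷ P) (true ∷ Q) i (suc j) l) ⟩
      card (profile P Q i j l) + card (profile P Q i (suc j) l)
        ≡⟨ cong₂ _+_ (card-profile P Q P∩Q≡⊥′ i j l) (card-profile P Q P∩Q≡⊥′ i (suc j) l) ⟩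
      (∣ P ∣ C i) * (∣ Q ∣ C j) * (∣ ∁ (P ∪ Q) ∣ C l) + (∣ P ∣ C i) * (∣ Q ∣ C suc j) * (∣ ∁ (P ∪ Q) ∣ C l)
        ≡⟨ pascal′ ((∣ P ∣ C i)) ∣ Q ∣ j ((∣ ∁ (P ∪ Q) ∣ C l)) ⟩
      (∣ P ∣ C i) * (suc ∣ Q ∣ C suc j) * (∣ ∁ (P ∪ Q) ∣ C l)
        ∎
      where
      open ≡-Reasoning
      P∩Q≡⊥′ : P ∩ Q ≡ ⊥
      P∩Q≡⊥′ = ∷-injectiveʳ P∩Q≡⊥
      pascal′ : ∀ a m j c → a * (m C j) * c + a * (m C suc j) * c ≡ a * (suc m C suc j) * c
      pascal′ a m j c = trans (sym (distrib a (m C j) (m C suc j) c)) (cong (λ b → a * b * c) (nCk+nC[k+1]≡[n+1]C[k+1] m j))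
        where
        distrib : ∀ a b b′ c → a * (b + b′) * c ≡ a * b * c + a * b′ * c
        distrib = solve-∀
    card-profile (false ∷ P) (false ∷ Q) P∩Q≡⊥ i j zero =
      trans (card-∷ (profile (false ∷ P) (false ∷ Q) i j zero))
        (cong₂ _+_ (card-∅ (λ B → profile (false ∷ P) (false ∷ Q) i j zero (true ∷ B)) empty)
                   (card-profile P Q (∷-injectiveʳ P∩Q≡⊥) i j zero))
      where
      empty : ∀ B → profile (false ∷ P) (false ∷ Q) i j zero (true ∷ B) ≡ false
      empty B with does (∣ B ∩ P ∣ ≟ i) | does (∣ B ∩ Q ∣ ≟ j)
      ... | true  | true  = refl
      ... | true  | false = refl
      ... | false | _     = refl
    card-profile (false ∷ P) (false ∷ Q) P∩Q≡⊥ i j (suc l) = begin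
      card (profile (false ∷ P) (false ∷ Q) i j (suc l))
        ≡⟨ card-∷ (profile (false ∷ P) (false ∷ Q) i j (suc l)) ⟩
      card (profile P Q i j l) + card (profile P Q i j (suc l))
        ≡⟨ cong₂ _+_ (card-profile P Q P∩Q≡⊥′ i j l) (card-profile P Q P∩Q≡⊥′ i j (suc l)) ⟩
      (∣ P ∣ C i) * (∣ Q ∣ C j) * (∣ ∁ (P ∪ Q) ∣ C l) + (∣ P ∣ C i) * (∣ Q ∣ C j) * (∣ ∁ (P ∪ Q) ∣ C suc l)
        ≡⟨ sym (*-distribˡ-+ ((∣ P ∣ C i) * (∣ Q ∣ C j)) _ _) ⟩
      (∣ P ∣ C i) * (∣ Q ∣ C j) * ((∣ ∁ (P ∪ Q) ∣ C l) + (∣ ∁ (P ∪ Q) ∣ C suc l))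
        ≡⟨ cong ((∣ P ∣ C i) * (∣ Q ∣ C j) *_) (nCk+nC[k+1]≡[n+1]C[k+1] ∣ ∁ (P ∪ Q) ∣ l) ⟩
      (∣ P ∣ C i) * (∣ Q ∣ C j) * (suc ∣ ∁ (P ∪ Q) ∣ C suc l)
        ∎
      where
      open ≡-Reasoning
      P∩Q≡⊥′ : P ∩ Q ≡ ⊥
      P∩Q≡⊥′ = ∷-injectiveʳ P∩Q≡⊥

    counts⇒profile : {P Q : Subset n} {i j l : ℕ} (B : Subset n) →
      ∣ B ∩ P ∣ ≡ i → ∣ B ∩ Q ∣ ≡ j → ∣ B ∩ ∁ (P ∪ Q) ∣ ≡ l → B ∈F profile P Q i j l
    counts⇒profile {P = P} {Q} {i} {j} {l} B ≡i ≡j ≡l =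
      ∧-true (dec-true (∣ B ∩ P ∣ ≟ i) ≡i) (∧-true (dec-true (∣ B ∩ Q ∣ ≟ j) ≡j) (dec-true (∣ B ∩ ∁ (P ∪ Q) ∣ ≟ l) ≡l))

    profile⁻ : {P Q : Subset n} {i j l : ℕ} (B : Subset n) →
      B ∈F profile P Q i j l → ∣ B ∩ P ∣ ≡ i × ∣ B ∩ Q ∣ ≡ j × ∣ B ∩ ∁ (P ∪ Q) ∣ ≡ l
    profile⁻ {P = P} {Q} {i} {j} {l} B B∈ =
      does-true⁻¹ (∣ B ∩ P ∣ ≟ i) (∧-conicalˡ (does (∣ B ∩ P ∣ ≟ i)) _ B∈) ,
      does-true⁻¹ (∣ B ∩ Q ∣ ≟ j) (∧-conicalˡ (does (∣ B ∩ Q ∣ ≟ j)) _ B∈Q,l) ,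
      does-true⁻¹ (∣ B ∩ ∁ (P ∪ Q) ∣ ≟ l) (∧-conicalʳ (does (∣ B ∩ Q ∣ ≟ j)) _ B∈Q,l)
      where
      B∈Q,l : does (∣ B ∩ Q ∣ ≟ j) ∧ does (∣ B ∩ ∁ (P ∪ Q) ∣ ≟ l) ≡ true
      B∈Q,l = ∧-conicalʳ (does (∣ B ∩ P ∣ ≟ i)) _ B∈

  module _ {P Q : Subset n} {i j l : ℕ} (P∩Q≡⊥ : P ∩ Q ≡ ⊥) (B : Subset n) where

    profile⁺ : ∣ B ∩ P ∣ ≡ i → ∣ B ∩ Q ∣ ≡ j → ∣ B ∣ ≡ i + j + l → B ∈F profile P Q i j l
    profile⁺ ∣B∩P∣≡i ∣B∩Q∣≡j ∣B∣≡ = counts⇒profile B ∣B∩P∣≡i ∣B∩Q∣≡j (+-cancelˡ-≡ (i + j) _ _ (begin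
      i + j + ∣ B ∩ ∁ (P ∪ Q) ∣                  ≡⟨ cong₂ (λ a b → a + b + ∣ B ∩ ∁ (P ∪ Q) ∣) ∣B∩P∣≡i ∣B∩Q∣≡j ⟨
      ∣ B ∩ P ∣ + ∣ B ∩ Q ∣ + ∣ B ∩ ∁ (P ∪ Q) ∣  ≡⟨ ∣p∣≡profile P Q B P∩Q≡⊥ ⟨
      ∣ B ∣                                      ≡⟨ ∣B∣≡ ⟩
      i + j + l                                  ∎))
      where open ≡-Reasoning

    profile⁻-∣∣ : B ∈F profile P Q i j l → ∣ B ∣ ≡ i + j + l
    profile⁻-∣∣ B∈ = let (≡i , ≡j , ≡l) = profile⁻ B B∈ in
      trans (∣p∣≡profile P Q B P∩Q≡⊥) (cong₂ _+_ (cong₂ _+_ ≡i ≡j) ≡l)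

  card≤profile : (𝓐 : Family n) (P Q : Subset n) {i j l : ℕ} → P ∩ Q ≡ ⊥ →
    (∀ B → B ∈F 𝓐 → ∣ B ∩ P ∣ ≡ i × ∣ B ∩ Q ∣ ≡ j × ∣ B ∣ ≡ i + j + l) →
    card 𝓐 ≤ (∣ P ∣ C i) * (∣ Q ∣ C j) * (∣ ∁ (P ∪ Q) ∣ C l)
  card≤profile 𝓐 P Q {i} {j} {l} P∩Q≡⊥ 𝓐⊆ = subst (card 𝓐 ≤_) (card-profile P Q P∩Q≡⊥ i j l)
    (card-mono 𝓐 (profile P Q i j l) (λ B B∈ → let (≡i , ≡j , ≡size) = 𝓐⊆ B B∈ in profile⁺ P∩Q≡⊥ B ≡i ≡j ≡size))

  nCk≥1 : ∀ m k → k ≤ m → 1 ≤ m C k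
  nCk≥1 m       zero    _       = ≤-refl
  nCk≥1 (suc m) (suc k) (s≤s k≤m) = begin
    1                  ≤⟨ nCk≥1 m k k≤m ⟩
    m C k              ≤⟨ m≤m+n (m C k) (m C suc k) ⟩
    m C k + m C suc k  ≡⟨ nCk+nC[k+1]≡[n+1]C[k+1] m k ⟩
    suc m C suc k      ∎
    where open ≤-Reasoning

  [1+n]Cn≡1+n : ∀ m → suc m C m ≡ suc m
  [1+n]Cn≡1+n m = trans (nCk≡nC[n∸k] (n≤1+n m)) (trans (cong (suc m C_) (m+n∸n≡m 1 m)) (nC1≡n (suc m)))

  n≤[1+n]C2 : ∀ m → m ≤ suc m C 2
  n≤[1+n]C2 m = begin
    m              ≡⟨ nC1≡n m ⟨
    m C 1          ≤⟨ m≤m+n (m C 1) (m C 2) ⟩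
    m C 1 + m C 2  ≡⟨ nCk+nC[k+1]≡[n+1]C[k+1] m 1 ⟩
    suc m C 2      ∎
    where open ≤-Reasoning


module Bounds where

  open import Defs
  open Counting
  open SubsetSize
  open Profile
  open NatFacts
  open import Data.Nat using (ℕ; suc; _+_; _*_; _∸_; _≤_; _<_; z≤n; _≟_; _≤?_; _<?_)
  open import Data.Nat.Properties
  open import Data.Nat.Combinatorics using (_C_; nCn≡1; nC1≡n)
  open import Data.Nat.Tactic.RingSolver using (solve-∀)
  open import Data.Bool using (true; false; _∧_; not; if_then_else_)
  open import Data.Bool.Properties using (∧-conicalˡ; ∧-conicalʳ; ∧-zeroʳ; not-injective)
  open import Data.Fin using (Fin)
  open import Data.Fin.Subset
  open import Data.Fin.Subset.Properties
  open import Data.Product using (Σ-syntax; _×_; _,_; proj₁; proj₂)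
  open import Data.Sum using (_⊎_; inj₁; inj₂)
  open import Relation.Binary.PropositionalEquality
  open import Relation.Nullary using (¬_; contradiction)
  open import Relation.Nullary.Decidable using (⌊_⌋)

  private variable
    n : ℕ

  module _ (t : ℕ) (A B : Subset n) where

    tDisjoint⁺ : ∣ A ∩ B ∣ < t → tDisjoint? t A B ≡ true
    tDisjoint⁺ = ⌊⌋-true (∣ A ∩ B ∣ <? t)

    tDisjoint⁻ : tDisjoint? t A B ≡ true → ∣ A ∩ B ∣ < t
    tDisjoint⁻ = ⌊⌋-true⁻¹ (∣ A ∩ B ∣ <? t)

    tIntersecting⁺ : t ≤ ∣ A ∩ B ∣ → tDisjoint? t A B ≡ false
    tIntersecting⁺ t≤ = ⌊⌋-false (∣ A ∩ B ∣ <? t) (≤⇒≯ t≤)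

    tIntersecting⁻ : tDisjoint? t A B ≡ false → t ≤ ∣ A ∩ B ∣
    tIntersecting⁻ A∩̸B = ≮⇒≥ (⌊⌋-false⁻¹ (∣ A ∩ B ∣ <? t) A∩̸B)

    tDisjoint?-comm : tDisjoint? t A B ≡ tDisjoint? t B A
    tDisjoint?-comm = cong (λ k → ⌊ k <? t ⌋) (∣p∩q∣≡∣q∩p∣ A B)

  H₁⁺ : {X W : Subset n} {k : ℕ} (A : Subset n) → A ⊆ X → ∣ A ∣ ≡ k → W ⊆ A → A ∈F H₁ X W k
  H₁⁺ {X = X} {W} {k} A A⊆X ∣A∣≡k W⊆A =
    ∧-true (⌊⌋-true (A ⊆? X) A⊆X) (∧-true (⌊⌋-true (∣ A ∣ ≟ k) ∣A∣≡k) (⌊⌋-true (W ⊆? A) W⊆A))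

  H₁⁻ : (X W : Subset n) (k : ℕ) (A : Subset n) → A ∈F H₁ X W k → A ⊆ X × ∣ A ∣ ≡ k × W ⊆ A
  H₁⁻ X W k A A∈ = ⌊⌋-true⁻¹ (A ⊆? X) (∧-conicalˡ ⌊ A ⊆? X ⌋ _ A∈)
    , ⌊⌋-true⁻¹ (∣ A ∣ ≟ k) (∧-conicalˡ ⌊ ∣ A ∣ ≟ k ⌋ _ rest)
    , ⌊⌋-true⁻¹ (W ⊆? A) (∧-conicalʳ ⌊ ∣ A ∣ ≟ k ⌋ _ rest)
    where
    rest = ∧-conicalʳ ⌊ A ⊆? X ⌋ _ A∈

  M₁⁺ : (Y A : Subset n) {k t : ℕ} → ∣ A ∣ ≡ k → t ≤ ∣ A ∩ Y ∣ → A ∈F M₁ Y k t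
  M₁⁺ Y A {k} {t} ∣A∣≡k t≤ = ∧-true (⌊⌋-true (∣ A ∣ ≟ k) ∣A∣≡k) (⌊⌋-true (t ≤? ∣ A ∩ Y ∣) t≤)

  M₁⁻ : (Y : Subset n) (k t : ℕ) (A : Subset n) → A ∈F M₁ Y k t → ∣ A ∣ ≡ k × t ≤ ∣ A ∩ Y ∣
  M₁⁻ Y k t A A∈ = ⌊⌋-true⁻¹ (∣ A ∣ ≟ k) (∧-conicalˡ ⌊ ∣ A ∣ ≟ k ⌋ _ A∈)
                 , ⌊⌋-true⁻¹ (t ≤? ∣ A ∩ Y ∣) (∧-conicalʳ ⌊ ∣ A ∣ ≟ k ⌋ _ A∈)

  M₁-∉⁺ : (Y A : Subset n) {k t : ℕ} → ∣ A ∩ Y ∣ < t → M₁ Y k t A ≡ false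
  M₁-∉⁺ Y A {k} {t} ∣A∩Y∣<t = trans (cong (⌊ ∣ A ∣ ≟ k ⌋ ∧_) (⌊⌋-false (t ≤? ∣ A ∩ Y ∣) (<⇒≱ ∣A∩Y∣<t))) (∧-zeroʳ _)

  M₁-∉⁻ : (Y : Subset n) (k t : ℕ) (A : Subset n) → ∣ A ∣ ≡ k → M₁ Y k t A ≡ false → ∣ A ∩ Y ∣ < t
  M₁-∉⁻ Y k t A ∣A∣≡k A∉ rewrite ⌊⌋-true (∣ A ∣ ≟ k) ∣A∣≡k = ≰⇒> (⌊⌋-false⁻¹ (t ≤? ∣ A ∩ Y ∣) A∉)

  private
    1+t≡t+1+0 : ∀ t → suc t ≡ t + 1 + 0
    1+t≡t+1+0 t = trans (+-comm 1 t) (sym (+-identityʳ (t + 1)))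

  H₁≐profile : (Z W : Subset n) (t : ℕ) → W ⊆ Z → ∣ W ∣ ≡ t → H₁ Z W (suc t) ≐ profile W (Z ∩ ∁ W) t 1 0
  H₁≐profile Z W t W⊆Z ∣W∣≡t B = bool-ext _ _ to from
    where
    disjoint = p∩[q∩∁p]≡⊥ W Z
    to : B ∈F H₁ Z W (suc t) → B ∈F profile W (Z ∩ ∁ W) t 1 0
    to B∈ = profile⁺ disjoint B ∣B∩W∣≡t ∣B∩[Z∖W]∣≡1 (trans ∣B∣≡ (1+t≡t+1+0 t))
      where
      B⊆Z = proj₁ (H₁⁻ Z W (suc t) B B∈)
      ∣B∣≡ = proj₁ (proj₂ (H₁⁻ Z W (suc t) B B∈))
      ∣B∩W∣≡t : ∣ B ∩ W ∣ ≡ t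
      ∣B∩W∣≡t = trans (q⊆p⇒∣p∩q∣≡∣q∣ (proj₂ (proj₂ (H₁⁻ Z W (suc t) B B∈)))) ∣W∣≡t
      ∣B∩[Z∖W]∣≡1 : ∣ B ∩ (Z ∩ ∁ W) ∣ ≡ 1
      ∣B∩[Z∖W]∣≡1 = trans (cong ∣_∣ (trans (sym (∩-assoc B Z (∁ W))) (cong (_∩ ∁ W) (p⊆q⇒p∩q≡p B⊆Z))))
                          (∣p∩∁q∣≡1 B W ∣B∣≡ ∣B∩W∣≡t)
    from : B ∈F profile W (Z ∩ ∁ W) t 1 0 → B ∈F H₁ Z W (suc t)
    from B∈ = H₁⁺ B B⊆Z (trans (profile⁻-∣∣ disjoint B B∈) (sym (1+t≡t+1+0 t))) W⊆B
      where
      counts = profile⁻ B B∈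
      W⊆B : W ⊆ B
      W⊆B = ∣q∣≤∣p∩q∣⇒q⊆p B W (≤-reflexive (trans ∣W∣≡t (sym (proj₁ counts))))
      B⊆Z : B ⊆ Z
      B⊆Z {x} x∈B with x∈p∪q⁻ W (Z ∩ ∁ W) (x∉∁p⇒x∈p (λ x∈∁ → <-irrefl (sym (proj₂ (proj₂ counts)))
                                                    (x∈p⇒∣p∣≥1 (x∈p∩q⁺ (x∈B , x∈∁)))))
      ... | inj₁ x∈W     = W⊆Z x∈W
      ... | inj₂ x∈Z∖W   = proj₁ (x∈p∩q⁻ Z (∁ W) x∈Z∖W)

  card-H₁ : (Z W : Subset n) (t : ℕ) → W ⊆ Z → ∣ W ∣ ≡ t → card (H₁ Z W (suc t)) ≡ ∣ Z ∣ ∸ t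
  card-H₁ Z W t W⊆Z ∣W∣≡t = begin
    card (H₁ Z W (suc t))                                ≡⟨ card-cong _ _ (H₁≐profile Z W t W⊆Z ∣W∣≡t) ⟩
    card (profile W (Z ∩ ∁ W) t 1 0)                     ≡⟨ card-profile W (Z ∩ ∁ W) (p∩[q∩∁p]≡⊥ W Z) t 1 0 ⟩
    (∣ W ∣ C t) * (∣ Z ∩ ∁ W ∣ C 1) * 1                  ≡⟨ *-identityʳ _ ⟩
    (∣ W ∣ C t) * (∣ Z ∩ ∁ W ∣ C 1)                      ≡⟨ cong₂ _*_ (trans (cong (_C t) ∣W∣≡t) (nCn≡1 t)) (nC1≡n _) ⟩
    1 * ∣ Z ∩ ∁ W ∣                                      ≡⟨ *-identityˡ _ ⟩
    ∣ Z ∩ ∁ W ∣                                          ≡⟨ ∣p∩∁q∣≡∣p∣∸∣p∩q∣ Z W ⟩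
    ∣ Z ∣ ∸ ∣ Z ∩ W ∣                                    ≡⟨ cong (∣ Z ∣ ∸_) (trans (q⊆p⇒∣p∩q∣≡∣q∣ W⊆Z) ∣W∣≡t) ⟩
    ∣ Z ∣ ∸ t                                            ∎
    where open ≡-Reasoning

  card-H₁-⊤ : (W : Subset n) (t : ℕ) → ∣ W ∣ ≡ t → card (H₁ ⊤ W (suc t)) ≡ n ∸ t
  card-H₁-⊤ {n} W t ∣W∣≡t = trans (card-H₁ ⊤ W t (λ _ → ∈⊤) ∣W∣≡t) (cong (_∸ t) (∣⊤∣≡n n))

  Meets : Subset n → ℕ → Family n
  Meets Y k B = ⌊ ∣ B ∩ Y ∣ ≟ k ⌋

  module _ (Y : Subset n) (t : ℕ) where

    M₁∩Meets≐profile : (M₁ Y (suc t) t ∩F Meets Y (suc t)) ≐ profile Y (∁ Y) (suc t) 0 0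
    M₁∩Meets≐profile B = bool-ext _ _ to from
      where
      to : B ∈F (M₁ Y (suc t) t ∩F Meets Y (suc t)) → B ∈F profile Y (∁ Y) (suc t) 0 0
      to B∈ = profile⁺ (∩-inverseʳ Y) B ∣B∩Y∣≡ ∣B∖Y∣≡0 (trans ∣B∣≡ (sym (trans (+-identityʳ _) (+-identityʳ _))))
        where
        ∣B∣≡ = proj₁ (M₁⁻ Y (suc t) t B (∧-conicalˡ (M₁ Y (suc t) t B) _ B∈))
        ∣B∩Y∣≡ = ⌊⌋-true⁻¹ (∣ B ∩ Y ∣ ≟ suc t) (∧-conicalʳ (M₁ Y (suc t) t B) _ B∈)
        ∣B∖Y∣≡0 : ∣ B ∩ ∁ Y ∣ ≡ 0
        ∣B∖Y∣≡0 = trans (∣p∩∁q∣≡∣p∣∸∣p∩q∣ B Y) (trans (cong₂ _∸_ ∣B∣≡ ∣B∩Y∣≡) (n∸n≡0 (suc t)))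
      from : B ∈F profile Y (∁ Y) (suc t) 0 0 → B ∈F (M₁ Y (suc t) t ∩F Meets Y (suc t))
      from B∈ = ∧-true (M₁⁺ Y B ∣B∣≡ (≤-trans (n≤1+n t) (≤-reflexive (sym ∣B∩Y∣≡)))) (⌊⌋-true (∣ B ∩ Y ∣ ≟ suc t) ∣B∩Y∣≡)
        where
        ∣B∩Y∣≡ = proj₁ (profile⁻ B B∈)
        ∣B∣≡ = trans (profile⁻-∣∣ (∩-inverseʳ Y) B B∈) (trans (+-identityʳ _) (+-identityʳ _))

    M₁∖Meets≐profile : (M₁ Y (suc t) t ∖F Meets Y (suc t)) ≐ profile Y (∁ Y) t 1 0
    M₁∖Meets≐profile B = bool-ext _ _ to from
      where
      to : B ∈F (M₁ Y (suc t) t ∖F Meets Y (suc t)) → B ∈F profile Y (∁ Y) t 1 0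
      to B∈ = profile⁺ (∩-inverseʳ Y) B ∣B∩Y∣≡t (∣p∩∁q∣≡1 B Y ∣B∣≡ ∣B∩Y∣≡t) (trans ∣B∣≡ (1+t≡t+1+0 t))
        where
        B∈M₁ = ∧-conicalˡ (M₁ Y (suc t) t B) _ B∈
        ∣B∣≡ = proj₁ (M₁⁻ Y (suc t) t B B∈M₁)
        ∣B∩Y∣≢ = ⌊⌋-false⁻¹ (∣ B ∩ Y ∣ ≟ suc t) (not-injective (∧-conicalʳ (M₁ Y (suc t) t B) _ B∈))
        ∣B∩Y∣≡t : ∣ B ∩ Y ∣ ≡ t
        ∣B∩Y∣≡t = ≤-antisym (≤-pred (≤∧≢⇒< (≤-trans (∣p∩q∣≤∣p∣ B Y) (≤-reflexive ∣B∣≡)) ∣B∩Y∣≢))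
                            (proj₂ (M₁⁻ Y (suc t) t B B∈M₁))
      from : B ∈F profile Y (∁ Y) t 1 0 → B ∈F (M₁ Y (suc t) t ∖F Meets Y (suc t))
      from B∈ = ∧-true (M₁⁺ Y B ∣B∣≡ (≤-reflexive (sym ∣B∩Y∣≡)))
                       (cong not (⌊⌋-false (∣ B ∩ Y ∣ ≟ suc t) (λ ∣B∩Y∣≡1+t →
                         <-irrefl (trans (sym ∣B∩Y∣≡) ∣B∩Y∣≡1+t) (n<1+n t))))
        where
        ∣B∩Y∣≡ = proj₁ (profile⁻ B B∈)
        ∣B∣≡ = trans (profile⁻-∣∣ (∩-inverseʳ Y) B B∈) (sym (1+t≡t+1+0 t))

  card-M₁ : (Y : Subset n) (t : ℕ) → ∣ Y ∣ ≡ suc t → card (M₁ Y (suc t) t) ≡ suc (suc t * (n ∸ suc t))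
  card-M₁ {n} Y t ∣Y∣≡ = begin
    card (M₁ Y (suc t) t)
      ≡⟨ card-split (M₁ Y (suc t) t) (Meets Y (suc t)) ⟩
    card (M₁ Y (suc t) t ∩F Meets Y (suc t)) + card (M₁ Y (suc t) t ∖F Meets Y (suc t))
      ≡⟨ cong₂ _+_ (card-cong _ _ (M₁∩Meets≐profile Y t)) (card-cong _ _ (M₁∖Meets≐profile Y t)) ⟩
    card (profile Y (∁ Y) (suc t) 0 0) + card (profile Y (∁ Y) t 1 0)
      ≡⟨ cong₂ _+_ (card-profile Y (∁ Y) (∩-inverseʳ Y) (suc t) 0 0) (card-profile Y (∁ Y) (∩-inverseʳ Y) t 1 0) ⟩
    (∣ Y ∣ C suc t) * 1 * 1 + (∣ Y ∣ C t) * (∣ ∁ Y ∣ C 1) * 1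
      ≡⟨ cong₂ (λ a b → (a C suc t) * 1 * 1 + (a C t) * b * 1) ∣Y∣≡
               (trans (nC1≡n _) (trans (∣∁p∣≡n∸∣p∣ Y) (cong (n ∸_) ∣Y∣≡))) ⟩
    (suc t C suc t) * 1 * 1 + (suc t C t) * (n ∸ suc t) * 1
      ≡⟨ cong₂ (λ a b → a * 1 * 1 + b * (n ∸ suc t) * 1) (nCn≡1 (suc t)) ([1+n]Cn≡1+n t) ⟩
    1 + suc t * (n ∸ suc t) * 1
      ≡⟨ cong suc (*-identityʳ _) ⟩
    suc (suc t * (n ∸ suc t))
      ∎
    where open ≡-Reasoning

  _△_ : Subset n → Subset n → Subset n
  p △ q = (p ∪ q) ∩ ∁ (p ∩ q)

  ∣p△q∣+2∣p∩q∣≡∣p∣+∣q∣ : (p q : Subset n) → ∣ p △ q ∣ + 2 * ∣ p ∩ q ∣ ≡ ∣ p ∣ + ∣ q ∣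
  ∣p△q∣+2∣p∩q∣≡∣p∣+∣q∣ p q = begin
    ∣ p △ q ∣ + 2 * ∣ p ∩ q ∣                       ≡⟨ rearrange ∣ p △ q ∣ ∣ p ∩ q ∣ ⟩
    ∣ p ∩ q ∣ + ∣ p △ q ∣ + ∣ p ∩ q ∣               ≡⟨ cong (λ k → k + ∣ p △ q ∣ + ∣ p ∩ q ∣) ∣[p∪q]∩[p∩q]∣≡∣p∩q∣ ⟨
    ∣ (p ∪ q) ∩ (p ∩ q) ∣ + ∣ p △ q ∣ + ∣ p ∩ q ∣   ≡⟨ cong (_+ ∣ p ∩ q ∣) (∣p∩q∣+∣p∩∁q∣≡∣p∣ (p ∪ q) (p ∩ q)) ⟩
    ∣ p ∪ q ∣ + ∣ p ∩ q ∣                           ≡⟨ ∣p∪q∣+∣p∩q∣≡∣p∣+∣q∣ p q ⟩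
    ∣ p ∣ + ∣ q ∣                                   ∎
    where
    open ≡-Reasoning
    rearrange : ∀ a b → a + 2 * b ≡ b + a + b
    rearrange = solve-∀
    ∣[p∪q]∩[p∩q]∣≡∣p∩q∣ : ∣ (p ∪ q) ∩ (p ∩ q) ∣ ≡ ∣ p ∩ q ∣
    ∣[p∪q]∩[p∩q]∣≡∣p∩q∣ = q⊆p⇒∣p∩q∣≡∣q∣ (λ x∈p∩q → x∈p∪q⁺ (inj₁ (p∩q⊆p p q x∈p∩q)))

  tIntersecting-pair-counts : (A A′ B : Subset n) (k : ℕ) → ∣ B ∣ ≡ suc (suc k) →
    suc k ≤ ∣ B ∩ A ∣ → suc k ≤ ∣ B ∩ A′ ∣ → ∣ B ∩ (A ∩ A′) ∣ ≤ k →
    ∣ B ∩ (A ∪ A′) ∣ ≡ suc (suc k) × ∣ B ∩ (A ∩ A′) ∣ ≡ k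
  tIntersecting-pair-counts A A′ B k ∣B∣≡ k<∣B∩A∣ k<∣B∩A′∣ ∣B∩K∣≤k =
    +-≤-tight (≤-trans (∣p∩q∣≤∣p∣ B (A ∪ A′)) (≤-reflexive ∣B∣≡)) ∣B∩K∣≤k (begin
      suc (suc k) + k                       ≡⟨ +-suc (suc k) k ⟨
      suc k + suc k                         ≤⟨ +-mono-≤ k<∣B∩A∣ k<∣B∩A′∣ ⟩
      ∣ B ∩ A ∣ + ∣ B ∩ A′ ∣                ≡⟨ inclusion-exclusion B A A′ ⟨
      ∣ B ∩ (A ∪ A′) ∣ + ∣ B ∩ (A ∩ A′) ∣   ∎)
    where open ≤-Reasoning

  module _ (W A B : Subset n) {t : ℕ} (∣W∣≡t : ∣ W ∣ ≡ t) where

    ∣p∩q∣≤1+∣p∩W∣ : W ⊆ A → ∣ A ∣ ≡ suc t → ∣ B ∩ A ∣ ≤ suc ∣ B ∩ W ∣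
    ∣p∩q∣≤1+∣p∩W∣ W⊆A ∣A∣≡ = begin
      ∣ B ∩ A ∣                               ≡⟨ ∣p∩q∣+∣p∩∁q∣≡∣p∣ (B ∩ A) W ⟨
      ∣ (B ∩ A) ∩ W ∣ + ∣ (B ∩ A) ∩ ∁ W ∣     ≤⟨ +-mono-≤ (p⊆q⇒∣p∣≤∣q∣ (p∩q⊆r∩q W (p∩q⊆p B A)))
                                                          (p⊆q⇒∣p∣≤∣q∣ (p∩q⊆r∩q (∁ W) (p∩q⊆q B A))) ⟩
      ∣ B ∩ W ∣ + ∣ A ∩ ∁ W ∣                 ≡⟨ cong (∣ B ∩ W ∣ +_) (∣p∩∁q∣≡1 A W ∣A∣≡ (trans (q⊆p⇒∣p∩q∣≡∣q∣ W⊆A) ∣W∣≡t)) ⟩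
      ∣ B ∩ W ∣ + 1                           ≡⟨ +-comm _ 1 ⟩
      suc ∣ B ∩ W ∣                           ∎
      where open ≤-Reasoning

    ⊆W∪B : ∣ B ∩ W ∣ < t → W ⊆ A → ∣ A ∣ ≡ suc t → t ≤ ∣ B ∩ A ∣ → A ⊆ W ∪ B
    ⊆W∪B ∣B∩W∣<t W⊆A ∣A∣≡ t≤∣B∩A∣ = ∣p∣≤∣p∩q∣⇒p⊆q A (W ∪ B) (subst (_≤ ∣ A ∩ (W ∪ B) ∣) (sym ∣A∣≡)
      (t+t≤m+n⇒n<t⇒t<m t _ _ (begin
        t + t                                 ≤⟨ +-mono-≤ (≤-reflexive (sym (trans (q⊆p⇒∣p∩q∣≡∣q∣ W⊆A) ∣W∣≡t)))
                                                          (subst (t ≤_) (∣p∩q∣≡∣q∩p∣ B A) t≤∣B∩A∣) ⟩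
        ∣ A ∩ W ∣ + ∣ A ∩ B ∣                 ≡⟨ inclusion-exclusion A W B ⟨
        ∣ A ∩ (W ∪ B) ∣ + ∣ A ∩ (W ∩ B) ∣     ∎)
        (≤-<-trans (∣p∩q∣≤∣q∣ A (W ∩ B)) (subst (_< t) (∣p∩q∣≡∣q∩p∣ B W) ∣B∩W∣<t))))
      where open ≤-Reasoning

  ∣W∪B∣≡t+2 : (W B : Subset n) {t : ℕ} → ∣ W ∣ ≡ t → ∣ B ∣ ≡ suc t → t ≡ suc ∣ B ∩ W ∣ → ∣ W ∪ B ∣ ≡ t + 2
  ∣W∪B∣≡t+2 W B {t} ∣W∣≡t ∣B∣≡ t≡1+x = +-cancelʳ-≡ x _ _ (begin
    ∣ W ∪ B ∣ + x                ≡⟨ cong (∣ W ∪ B ∣ +_) (∣p∩q∣≡∣q∩p∣ B W) ⟩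
    ∣ W ∪ B ∣ + ∣ W ∩ B ∣        ≡⟨ ∣p∪q∣+∣p∩q∣≡∣p∣+∣q∣ W B ⟩
    ∣ W ∣ + ∣ B ∣                ≡⟨ cong₂ _+_ (trans ∣W∣≡t t≡1+x) (trans ∣B∣≡ (cong suc t≡1+x)) ⟩
    suc x + suc (suc x)          ≡⟨ sizes x ⟩
    suc x + 2 + x                ≡⟨ cong (λ t → t + 2 + x) t≡1+x ⟨
    t + 2 + x                    ∎)
    where
    open ≡-Reasoning
    x = ∣ B ∩ W ∣
    sizes : ∀ x → suc x + suc (suc x) ≡ suc x + 2 + x
    sizes = solve-∀

  module _ (𝓐 : Family n) where

    subfamily-H₁-bound : (X K : Subset n) (t : ℕ) → K ⊆ X → ∣ K ∣ ≡ t → 𝓐 ⊆F H₁ X K (suc t) → card 𝓐 ≤ ∣ X ∣ ∸ t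
    subfamily-H₁-bound X K t K⊆X ∣K∣≡t 𝓐⊆ = ≤-trans (card-mono 𝓐 (H₁ X K (suc t)) 𝓐⊆) (≤-reflexive (card-H₁ X K t K⊆X ∣K∣≡t))

    inside-bound : (Z : Subset n) (t : ℕ) → ∣ Z ∣ ≡ suc (suc t) →
      (∀ A → A ∈F 𝓐 → A ⊆ Z × ∣ A ∣ ≡ suc t) → card 𝓐 ≤ suc (suc t)
    inside-bound Z t ∣Z∣≡ 𝓐⊆ = subst (card 𝓐 ≤_) C≡ (card≤profile 𝓐 Z (∁ Z) (∩-inverseʳ Z) in-profile)
      where
      in-profile : ∀ A → A ∈F 𝓐 → ∣ A ∩ Z ∣ ≡ suc t × ∣ A ∩ ∁ Z ∣ ≡ 0 × ∣ A ∣ ≡ suc t + 0 + 0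
      in-profile A A∈ = ∣A∩Z∣≡ , ∣A∖Z∣≡0 , sym (trans (+-identityʳ _) (trans (+-identityʳ _) (sym ∣A∣≡)))
        where
        A⊆Z = proj₁ (𝓐⊆ A A∈)
        ∣A∣≡ = proj₂ (𝓐⊆ A A∈)
        ∣A∩Z∣≡ = trans (p⊆q⇒∣p∩q∣≡∣p∣ A⊆Z) ∣A∣≡
        ∣A∖Z∣≡0 = trans (∣p∩∁q∣≡∣p∣∸∣p∩q∣ A Z) (trans (cong₂ _∸_ ∣A∣≡ ∣A∩Z∣≡) (n∸n≡0 (suc t)))
      C≡ : (∣ Z ∣ C suc t) * (∣ ∁ Z ∣ C 0) * (∣ ∁ (Z ∪ ∁ Z) ∣ C 0) ≡ suc (suc t)
      C≡ = trans (*-identityʳ _) (trans (*-identityʳ _) (trans (cong (_C suc t) ∣Z∣≡) ([1+n]Cn≡1+n (suc t))))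

    tIntersecting-inside-bound : (Z B : Subset n) (t : ℕ) → ∣ Z ∣ ≡ suc (suc t) → ¬ B ⊆ Z → ∣ B ∣ ≡ suc t →
      (∀ A → A ∈F 𝓐 → A ⊆ Z × ∣ A ∣ ≡ suc t × t ≤ ∣ B ∩ A ∣) → card 𝓐 ≤ 2
    tIntersecting-inside-bound Z B t ∣Z∣≡ B⊄Z ∣B∣≡ 𝓐⊆ with member-or-empty 𝓐
    ... | inj₂ card≡0 = subst (_≤ 2) (sym card≡0) z≤n
    ... | inj₁ (A₀ , A₀∈) =
      subst (card 𝓐 ≤_) (trans (cong (_∸ t) ∣Z∣≡) (m+n∸n≡m 2 t)) (subfamily-H₁-bound Z K t (p∩q⊆q B Z) ∣K∣≡t 𝓐⊆H₁)
      where
      K = B ∩ Z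
      B∩A⊆K : ∀ {A} → A ⊆ Z → B ∩ A ⊆ K
      B∩A⊆K A⊆Z x∈B∩A = let (x∈B , x∈A) = x∈p∩q⁻ B _ x∈B∩A in x∈p∩q⁺ (x∈B , A⊆Z x∈A)
      ∣K∣≡t : ∣ K ∣ ≡ t
      ∣K∣≡t = ≤-antisym (≤-pred (subst (∣ K ∣ <_) ∣B∣≡ (p⊄q⇒∣p∩q∣<∣p∣ B Z B⊄Z)))
        (let (A₀⊆Z , _ , t≤) = 𝓐⊆ A₀ A₀∈ in ≤-trans t≤ (p⊆q⇒∣p∣≤∣q∣ (B∩A⊆K A₀⊆Z)))
      𝓐⊆H₁ : 𝓐 ⊆F H₁ Z K (suc t)
      𝓐⊆H₁ A A∈ = H₁⁺ A A⊆Z ∣A∣≡ K⊆A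
        where
        A⊆Z = proj₁ (𝓐⊆ A A∈)
        ∣A∣≡ = proj₁ (proj₂ (𝓐⊆ A A∈))
        B∩A≡K : B ∩ A ≡ K
        B∩A≡K = p⊆q⇒∣q∣≤∣p∣⇒p≡q (B∩A⊆K A⊆Z) (≤-trans (≤-reflexive ∣K∣≡t) (proj₂ (proj₂ (𝓐⊆ A A∈))))
        K⊆A : K ⊆ A
        K⊆A x∈K = proj₂ (x∈p∩q⁻ B A (subst (_ ∈_) (sym B∩A≡K) x∈K))

    tIntersecting-⊇W-bound : (W B : Subset n) (t : ℕ) → ∣ W ∣ ≡ t → ¬ W ⊆ B → ∣ B ∣ ≡ suc t →
      (∀ A → A ∈F 𝓐 → W ⊆ A × ∣ A ∣ ≡ suc t × t ≤ ∣ B ∩ A ∣) → card 𝓐 ≤ 2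
    tIntersecting-⊇W-bound W B t ∣W∣≡t W⊄B ∣B∣≡ 𝓐⊆ with member-or-empty 𝓐
    ... | inj₂ card≡0 = subst (_≤ 2) (sym card≡0) z≤n
    ... | inj₁ (A₀ , A₀∈) = subst (card 𝓐 ≤_) ∣W∪B∣∸t≡2 (subfamily-H₁-bound (W ∪ B) W t (p⊆p∪q B) ∣W∣≡t 𝓐⊆H₁)
      where
      ∣B∩W∣<t : ∣ B ∩ W ∣ < t
      ∣B∩W∣<t = subst (∣ B ∩ W ∣ <_) ∣W∣≡t (q⊄p⇒∣p∩q∣<∣q∣ B W W⊄B)
      t≡1+∣B∩W∣ : t ≡ suc ∣ B ∩ W ∣
      t≡1+∣B∩W∣ = let (W⊆A₀ , ∣A₀∣≡ , t≤∣B∩A₀∣) = 𝓐⊆ A₀ A₀∈ in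
        ≤-antisym (≤-trans t≤∣B∩A₀∣ (∣p∩q∣≤1+∣p∩W∣ W A₀ B ∣W∣≡t W⊆A₀ ∣A₀∣≡)) ∣B∩W∣<t
      ∣W∪B∣∸t≡2 : ∣ W ∪ B ∣ ∸ t ≡ 2
      ∣W∪B∣∸t≡2 = trans (cong (_∸ t) (∣W∪B∣≡t+2 W B ∣W∣≡t ∣B∣≡ t≡1+∣B∩W∣)) (m+n∸m≡n t 2)
      𝓐⊆H₁ : 𝓐 ⊆F H₁ (W ∪ B) W (suc t)
      𝓐⊆H₁ A A∈ = let (W⊆A , ∣A∣≡ , t≤∣B∩A∣) = 𝓐⊆ A A∈ in
        H₁⁺ A (⊆W∪B W A B ∣W∣≡t ∣B∩W∣<t W⊆A ∣A∣≡ t≤∣B∩A∣) ∣A∣≡ W⊆A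

    tIntersecting-pair-bound : (A A′ : Subset n) (k : ℕ) →
      (∀ B → B ∈F 𝓐 → ∣ B ∣ ≡ suc (suc k) × suc k ≤ ∣ B ∩ A ∣ × suc k ≤ ∣ B ∩ A′ ∣ × ∣ B ∩ (A ∩ A′) ∣ ≤ k) →
      card 𝓐 ≤ (∣ A ∩ A′ ∣ C k) * (∣ A △ A′ ∣ C 2)
    tIntersecting-pair-bound A A′ k 𝓐⊆ =
      subst (card 𝓐 ≤_) (*-identityʳ _) (card≤profile 𝓐 (A ∩ A′) (A △ A′) (p∩[q∩∁p]≡⊥ (A ∩ A′) (A ∪ A′)) in-profile)
      where
      in-profile : ∀ B → B ∈F 𝓐 → ∣ B ∩ (A ∩ A′) ∣ ≡ k × ∣ B ∩ (A △ A′) ∣ ≡ 2 × ∣ B ∣ ≡ k + 2 + 0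
      in-profile B B∈ = ∣B∩K∣≡k , ∣B∩[A△A′]∣≡2 , trans ∣B∣≡ (size k)
        where
        ∣B∣≡ = proj₁ (𝓐⊆ B B∈)
        counts = let (_ , k<∣B∩A∣ , k<∣B∩A′∣ , ∣B∩K∣≤k) = 𝓐⊆ B B∈ in
          tIntersecting-pair-counts A A′ B k ∣B∣≡ k<∣B∩A∣ k<∣B∩A′∣ ∣B∩K∣≤k
        ∣B∩K∣≡k = proj₂ counts
        size : ∀ k → suc (suc k) ≡ k + 2 + 0
        size = solve-∀
        ∣B∩[A△A′]∣≡2 : ∣ B ∩ (A △ A′) ∣ ≡ 2
        ∣B∩[A△A′]∣≡2 = begin
          ∣ B ∩ ((A ∪ A′) ∩ ∁ (A ∩ A′)) ∣                        ≡⟨ cong ∣_∣ (∩-assoc B (A ∪ A′) (∁ (A ∩ A′))) ⟨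
          ∣ (B ∩ (A ∪ A′)) ∩ ∁ (A ∩ A′) ∣                        ≡⟨ ∣p∩∁q∣≡∣p∣∸∣p∩q∣ (B ∩ (A ∪ A′)) (A ∩ A′) ⟩
          ∣ B ∩ (A ∪ A′) ∣ ∸ ∣ (B ∩ (A ∪ A′)) ∩ (A ∩ A′) ∣        ≡⟨ cong (∣ B ∩ (A ∪ A′) ∣ ∸_) (cong ∣_∣ B∩X∩K≡B∩K) ⟩
          ∣ B ∩ (A ∪ A′) ∣ ∸ ∣ B ∩ (A ∩ A′) ∣                    ≡⟨ cong₂ _∸_ (proj₁ counts) ∣B∩K∣≡k ⟩
          suc (suc k) ∸ k                                        ≡⟨ m+n∸n≡m 2 k ⟩
          2                                                      ∎
          where
          open ≡-Reasoning
          B∩X∩K≡B∩K : (B ∩ (A ∪ A′)) ∩ (A ∩ A′) ≡ B ∩ (A ∩ A′)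
          B∩X∩K≡B∩K = trans (∩-assoc B (A ∪ A′) (A ∩ A′)) (cong (B ∩_) (trans (∩-comm (A ∪ A′) (A ∩ A′))
            (p⊆q⇒p∩q≡p (λ x∈A∩A′ → x∈p∪q⁺ (inj₁ (p∩q⊆p A A′ x∈A∩A′))))))

    tIntersecting-pair-bound-⊉core : (A A′ : Subset n) (k : ℕ) →
      ∣ A ∣ ≡ suc (suc k) → ∣ A′ ∣ ≡ suc (suc k) → ∣ A ∩ A′ ∣ ≡ suc k →
      (∀ B → B ∈F 𝓐 → ∣ B ∣ ≡ suc (suc k) × ¬ A ∩ A′ ⊆ B × suc k ≤ ∣ B ∩ A ∣ × suc k ≤ ∣ B ∩ A′ ∣) →
      card 𝓐 ≤ suc k
    tIntersecting-pair-bound-⊉core A A′ k ∣A∣≡ ∣A′∣≡ ∣A∩A′∣≡ 𝓐⊆ = subst (card 𝓐 ≤_) C≡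
      (tIntersecting-pair-bound A A′ k (λ B B∈ → let (∣B∣≡ , K⊄B , k<∣B∩A∣ , k<∣B∩A′∣) = 𝓐⊆ B B∈ in
        ∣B∣≡ , k<∣B∩A∣ , k<∣B∩A′∣ , ≤-pred (subst (∣ B ∩ (A ∩ A′) ∣ <_) ∣A∩A′∣≡ (q⊄p⇒∣p∩q∣<∣q∣ B (A ∩ A′) K⊄B))))
      where
      ∣A△A′∣≡2 : ∣ A △ A′ ∣ ≡ 2
      ∣A△A′∣≡2 = +-cancelʳ-≡ (2 * suc k) _ _ (begin
        ∣ A △ A′ ∣ + 2 * suc k          ≡⟨ cong (λ x → ∣ A △ A′ ∣ + 2 * x) ∣A∩A′∣≡ ⟨
        ∣ A △ A′ ∣ + 2 * ∣ A ∩ A′ ∣     ≡⟨ ∣p△q∣+2∣p∩q∣≡∣p∣+∣q∣ A A′ ⟩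
        ∣ A ∣ + ∣ A′ ∣                  ≡⟨ cong₂ _+_ ∣A∣≡ ∣A′∣≡ ⟩
        suc (suc k) + suc (suc k)       ≡⟨ sizes k ⟩
        2 + 2 * suc k                   ∎)
        where
        open ≡-Reasoning
        sizes : ∀ k → suc (suc k) + suc (suc k) ≡ 2 + 2 * suc k
        sizes = solve-∀
      C≡ : (∣ A ∩ A′ ∣ C k) * (∣ A △ A′ ∣ C 2) ≡ suc k
      C≡ = trans (cong₂ (λ a b → (a C k) * (b C 2)) ∣A∩A′∣≡ ∣A△A′∣≡2) (trans (*-identityʳ _) ([1+n]Cn≡1+n k))

    tIntersecting-pair-bound-tDisjoint : (A A′ : Subset n) (k : ℕ) →
      ∣ A ∣ ≡ suc (suc k) → ∣ A′ ∣ ≡ suc (suc k) → ∣ A ∩ A′ ∣ ≤ k →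
      (∀ B → B ∈F 𝓐 → ∣ B ∣ ≡ suc (suc k) × suc k ≤ ∣ B ∩ A ∣ × suc k ≤ ∣ B ∩ A′ ∣) →
      card 𝓐 ≤ 6
    tIntersecting-pair-bound-tDisjoint A A′ k ∣A∣≡ ∣A′∣≡ ∣A∩A′∣≤k 𝓐⊆ with member-or-empty 𝓐
    ... | inj₂ card≡0 = subst (_≤ 6) (sym card≡0) z≤n
    ... | inj₁ (B₀ , B₀∈) = subst (card 𝓐 ≤_) C≡ (tIntersecting-pair-bound A A′ k 𝓐⊆′)
      where
      𝓐⊆′ : ∀ B → B ∈F 𝓐 → ∣ B ∣ ≡ suc (suc k) × suc k ≤ ∣ B ∩ A ∣ × suc k ≤ ∣ B ∩ A′ ∣ × ∣ B ∩ (A ∩ A′) ∣ ≤ k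
      𝓐⊆′ B B∈ = let (∣B∣≡ , k<∣B∩A∣ , k<∣B∩A′∣) = 𝓐⊆ B B∈ in
        ∣B∣≡ , k<∣B∩A∣ , k<∣B∩A′∣ , ≤-trans (∣p∩q∣≤∣q∣ B (A ∩ A′)) ∣A∩A′∣≤k
      ∣A∩A′∣≡k : ∣ A ∩ A′ ∣ ≡ k
      ∣A∩A′∣≡k = let (∣B₀∣≡ , k<∣B₀∩A∣ , k<∣B₀∩A′∣ , ∣B₀∩K∣≤k) = 𝓐⊆′ B₀ B₀∈ in
        ≤-antisym ∣A∩A′∣≤k (begin
          k                      ≡⟨ proj₂ (tIntersecting-pair-counts A A′ B₀ k ∣B₀∣≡ k<∣B₀∩A∣ k<∣B₀∩A′∣ ∣B₀∩K∣≤k) ⟨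
          ∣ B₀ ∩ (A ∩ A′) ∣      ≤⟨ ∣p∩q∣≤∣q∣ B₀ (A ∩ A′) ⟩
          ∣ A ∩ A′ ∣             ∎)
        where open ≤-Reasoning
      ∣A△A′∣≡4 : ∣ A △ A′ ∣ ≡ 4
      ∣A△A′∣≡4 = +-cancelʳ-≡ (2 * k) _ _ (begin
        ∣ A △ A′ ∣ + 2 * k              ≡⟨ cong (λ x → ∣ A △ A′ ∣ + 2 * x) ∣A∩A′∣≡k ⟨
        ∣ A △ A′ ∣ + 2 * ∣ A ∩ A′ ∣     ≡⟨ ∣p△q∣+2∣p∩q∣≡∣p∣+∣q∣ A A′ ⟩
        ∣ A ∣ + ∣ A′ ∣                  ≡⟨ cong₂ _+_ ∣A∣≡ ∣A′∣≡ ⟩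
        suc (suc k) + suc (suc k)       ≡⟨ sizes k ⟩
        4 + 2 * k                       ∎)
        where
        open ≡-Reasoning
        sizes : ∀ k → suc (suc k) + suc (suc k) ≡ 4 + 2 * k
        sizes = solve-∀
      C≡ : (∣ A ∩ A′ ∣ C k) * (∣ A △ A′ ∣ C 2) ≡ 6
      C≡ = trans (cong₂ (λ a b → (a C k) * (b C 2)) ∣A∩A′∣≡k ∣A△A′∣≡4) (cong (_* 6) (nCn≡1 k))

  ∑-disjCount-comm : (t : ℕ) (𝓕 𝓖 : Family n) → ∑[ A ∈ 𝓕 ] disjCount t A 𝓖 ≡ ∑[ B ∈ 𝓖 ] disjCount t B 𝓕
  ∑-disjCount-comm {n} t 𝓕 𝓖 = trans (double-counting 𝓕 𝓖 (tDisjoint? t))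
    (∑-cong (allSubsets n) (λ B → cong (λ c → if 𝓖 B then c else 0)
      (card-cong _ _ (λ A → cong (𝓕 A ∧_) (tDisjoint?-comm t A B)))))

  tIntersecting-or-tDisjoint-pair : (t : ℕ) (𝓕 : Family n) →
    (∀ A A′ → A ∈F 𝓕 → A′ ∈F 𝓕 → t ≤ ∣ A ∩ A′ ∣) ⊎
    (Σ[ A ∈ Subset n ] Σ[ A′ ∈ Subset n ] A ∈F 𝓕 × A′ ∈F 𝓕 × ∣ A ∩ A′ ∣ < t)
  tIntersecting-or-tDisjoint-pair t 𝓕 with member-or-empty (𝓕 ∩F λ A → ⌊ 1 ≤? disjCount t A 𝓕 ⌋)
  ... | inj₁ (A , A∈) with member-or-empty (𝓕 ∩F tDisjoint? t A)
  ...   | inj₁ (A′ , A′∈) =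
    inj₂ (A , A′ , ∧-conicalˡ (𝓕 A) _ A∈ , ∧-conicalˡ (𝓕 A′) _ A′∈ , tDisjoint⁻ t A A′ (∧-conicalʳ (𝓕 A′) _ A′∈))
  ...   | inj₂ card≡0 = contradiction (subst (1 ≤_) card≡0 (⌊⌋-true⁻¹ (1 ≤? disjCount t A 𝓕) (∧-conicalʳ (𝓕 A) _ A∈))) λ ()
  tIntersecting-or-tDisjoint-pair t 𝓕 | inj₂ card≡0 = inj₁ pairwise
    where
    pairwise : ∀ A A′ → A ∈F 𝓕 → A′ ∈F 𝓕 → t ≤ ∣ A ∩ A′ ∣
    pairwise A A′ A∈ A′∈ with tDisjoint? t A A′ in A∩A′
    ... | false = tIntersecting⁻ t A A′ A∩A′
    ... | true  = contradiction (trans (sym (card≡0⇒∉ _ card≡0 A)) (∧-true A∈ (⌊⌋-true (1 ≤? disjCount t A 𝓕) A-disjoint))) λ ()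
      where
      A-disjoint : 1 ≤ disjCount t A 𝓕
      A-disjoint = member⇒card≥1 (𝓕 ∩F tDisjoint? t A) A′ (∧-true A′∈ A∩A′)


module BigCapCup where

  open import Defs
  open SubsetSize
  open import Data.Nat using (ℕ; suc; _+_; _<_)
  open import Data.Nat.Properties using (≤-pred; +-comm; module ≤-Reasoning)
  open import Relation.Nullary using (¬_; contradiction)
  open import Data.Bool using (true; false)
  import Data.Bool as Bool
  open import Data.List using (List; []; _∷_; map)
  open import Data.List.Membership.Propositional using () renaming (_∈_ to _∈ᴸ_)
  open import Data.List.Membership.Propositional.Properties using (∈-map⁺; ∈-++⁺ˡ; ∈-++⁺ʳ; ∈-filter⁺; ∈-filter⁻)
  open import Data.List.Relation.Unary.Any using (here; there)
  open import Data.Vec using ([]; _∷_)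
  open import Data.Fin using (Fin)
  open import Data.Fin.Subset
  open import Data.Fin.Subset.Properties using (x∈p∩q⁺; x∈p∩q⁻; x∈p∪q⁺; x∈p∪q⁻; ∈⊤; ∉⊥)
  open import Data.Product using (Σ-syntax; _×_; _,_; proj₁; proj₂)
  open import Data.Sum using (inj₁; inj₂)
  open import Relation.Binary.PropositionalEquality

  private variable
    n : ℕ

  ∈-allSubsets : (A : Subset n) → A ∈ᴸ allSubsets n
  ∈-allSubsets []                  = here refl
  ∈-allSubsets {suc n} (true ∷ A)  = ∈-++⁺ˡ (∈-map⁺ (true ∷_) (∈-allSubsets A))
  ∈-allSubsets {suc n} (false ∷ A) = ∈-++⁺ʳ (map (true ∷_) (allSubsets n)) (∈-map⁺ (false ∷_) (∈-allSubsets A))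

  ∈-members : (𝓗 : Family n) (A : Subset n) → A ∈F 𝓗 → A ∈ᴸ members 𝓗
  ∈-members 𝓗 A A∈𝓗 = ∈-filter⁺ (λ B → 𝓗 B Bool.≟ true) (∈-allSubsets A) A∈𝓗

  members-∈F : (𝓗 : Family n) {A : Subset n} → A ∈ᴸ members 𝓗 → A ∈F 𝓗
  members-∈F {n} 𝓗 A∈ = proj₂ (∈-filter⁻ (λ B → 𝓗 B Bool.≟ true) {xs = allSubsets n} A∈)

  ⋂-⊆ : {As : List (Subset n)} {A : Subset n} → A ∈ᴸ As → ⋂ As ⊆ A
  ⋂-⊆ {As = B ∷ As} (here refl) x∈ = proj₁ (x∈p∩q⁻ B (⋂ As) x∈)
  ⋂-⊆ {As = B ∷ As} (there A∈)  x∈ = ⋂-⊆ A∈ (proj₂ (x∈p∩q⁻ B (⋂ As) x∈))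

  ⊆-⋂ : (As : List (Subset n)) {W : Subset n} → (∀ {A} → A ∈ᴸ As → W ⊆ A) → W ⊆ ⋂ As
  ⊆-⋂ []       _   _   = ∈⊤
  ⊆-⋂ (A ∷ As) W⊆ x∈W = x∈p∩q⁺ (W⊆ (here refl) x∈W , ⊆-⋂ As (λ A∈ → W⊆ (there A∈)) x∈W)

  ⊆-⋃ : {As : List (Subset n)} {A : Subset n} → A ∈ᴸ As → A ⊆ ⋃ As
  ⊆-⋃ (here refl) x∈A = x∈p∪q⁺ (inj₁ x∈A)
  ⊆-⋃ (there A∈)  x∈A = x∈p∪q⁺ (inj₂ (⊆-⋃ A∈ x∈A))

  ⋃⁻ : (As : List (Subset n)) {x : Fin n} → x ∈ ⋃ As → Σ[ A ∈ Subset n ] A ∈ᴸ As × x ∈ A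
  ⋃⁻ []       x∈ = contradiction x∈ ∉⊥
  ⋃⁻ (A ∷ As) x∈ with x∈p∪q⁻ A (⋃ As) x∈
  ... | inj₁ x∈A = A , here refl , x∈A
  ... | inj₂ x∈⋃ = let (B , B∈ , x∈B) = ⋃⁻ As x∈⋃ in B , there B∈ , x∈B

  bigCap-⊆ : (𝓗 : Family n) (A : Subset n) → A ∈F 𝓗 → bigCap 𝓗 ⊆ A
  bigCap-⊆ 𝓗 A A∈ = ⋂-⊆ (∈-members 𝓗 A A∈)

  ⊆-bigCap : (𝓗 : Family n) (W : Subset n) → (∀ A → A ∈F 𝓗 → W ⊆ A) → W ⊆ bigCap 𝓗
  ⊆-bigCap 𝓗 W W⊆ = ⊆-⋂ (members 𝓗) (λ A∈ → W⊆ _ (members-∈F 𝓗 A∈))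

  bigCup : Family n → Subset n
  bigCup 𝓗 = ⋃ (members 𝓗)

  ⊆-bigCup : (𝓗 : Family n) (A : Subset n) → A ∈F 𝓗 → A ⊆ bigCup 𝓗
  ⊆-bigCup 𝓗 A A∈ = ⊆-⋃ (∈-members 𝓗 A A∈)

  bigCup⁻ : (𝓗 : Family n) {x : Fin n} → x ∈ bigCup 𝓗 → Σ[ A ∈ Subset n ] A ∈F 𝓗 × x ∈ A
  bigCup⁻ 𝓗 x∈ = let (A , A∈ , x∈A) = ⋃⁻ (members 𝓗) x∈ in A , members-∈F 𝓗 A∈ , x∈A

  ∣bigCap∣<t : (𝓗 : Family n) (A B₁ B₂ : Subset n) (y₁ y₂ : Fin n) (t : ℕ) →
    A ∈F 𝓗 → B₁ ∈F 𝓗 → B₂ ∈F 𝓗 → y₁ ∈ A → y₂ ∈ A → y₁ ∉ B₁ → y₂ ∉ B₂ → ¬ y₁ ≡ y₂ → ∣ A ∣ ≡ suc t →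
    ∣ bigCap 𝓗 ∣ < t
  ∣bigCap∣<t 𝓗 A B₁ B₂ y₁ y₂ t A∈ B₁∈ B₂∈ y₁∈A y₂∈A y₁∉B₁ y₂∉B₂ y₁≢y₂ ∣A∣≡ = ≤-pred (begin
    suc (suc ∣ bigCap 𝓗 ∣)  ≡⟨ +-comm 2 _ ⟩
    ∣ bigCap 𝓗 ∣ + 2        ≤⟨ p⊆q∖⁅x,y⁆⇒∣p∣+2≤∣q∣ (bigCap-⊆ 𝓗 A A∈) y₁∈A y₂∈A
                                 (λ y₁∈ → y₁∉B₁ (bigCap-⊆ 𝓗 B₁ B₁∈ y₁∈)) (λ y₂∈ → y₂∉B₂ (bigCap-⊆ 𝓗 B₂ B₂∈ y₂∈)) y₁≢y₂ ⟩
    ∣ A ∣                   ≡⟨ ∣A∣≡ ⟩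
    suc t                   ∎)
    where open ≤-Reasoning


module Constructions where

  open import Defs
  open Counting
  open SubsetSize
  open Profile
  open Bounds
  open BigCapCup
  open import Data.Nat using (ℕ; zero; suc; _+_; _*_; _∸_; _≤_; _<_; z≤n; s≤s; _≟_)
  open import Data.List using (List; []; _∷_; length)
  open import Data.List.Membership.Propositional using () renaming (_∈_ to _∈ᴸ_)
  open import Data.List.Relation.Unary.Any using (here; there)
  open import Data.List.Relation.Unary.All as All using (All)
  open import Data.List.Relation.Unary.Unique.Propositional using (Unique; []; _∷_)
  open import Data.Nat.Properties
  open import Data.Nat.DivMod using (_mod_; m<n⇒m%n≡m)
  open import Data.Nat.Combinatorics using (_C_)
  open import Data.Bool using (true; false; not)
  open import Data.Bool.Properties using (∧-conicalˡ; ∧-conicalʳ)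
  open import Data.Vec using ([]; _∷_; here; there)
  open import Data.Fin using (Fin; zero; suc; toℕ)
  open import Data.Fin.Properties using (toℕ-fromℕ<; toℕ-injective)
  open import Data.Fin.Subset
  open import Data.Fin.Subset.Properties
  open import Data.Product using (Σ-syntax; _×_; _,_; proj₁; proj₂)
  open import Data.Sum using (_⊎_; inj₁; inj₂; [_,_]′)
  open import Relation.Binary.PropositionalEquality
  open import Relation.Nullary using (¬_; yes; no; contradiction)
  open import Data.Empty using (⊥-elim)
  open import Relation.Nullary.Decidable using (⌊_⌋)
  open import Data.Nat.Tactic.RingSolver using (solve-∀)

  initial : (n k : ℕ) → Subset n
  initial zero    _       = []
  initial (suc n) zero    = false ∷ initial n zero
  initial (suc n) (suc k) = true ∷ initial n k

  ∈initial⁺ : {n k : ℕ} (x : Fin n) → toℕ x < k → x ∈ initial n k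
  ∈initial⁺ {k = suc k} zero    _           = here
  ∈initial⁺ {k = suc k} (suc x) (s≤s x<k) = there (∈initial⁺ x x<k)

  ∈initial⁻ : {n k : ℕ} (x : Fin n) → x ∈ initial n k → toℕ x < k
  ∈initial⁻ {k = zero}  (suc x) (there x∈) with () ← ∈initial⁻ x x∈
  ∈initial⁻ {k = suc k} zero    _          = s≤s z≤n
  ∈initial⁻ {k = suc k} (suc x) (there x∈) = s≤s (∈initial⁻ x x∈)

  ∣initial∣ : (n k : ℕ) → k ≤ n → ∣ initial n k ∣ ≡ k
  ∣initial∣ zero    zero    _         = refl
  ∣initial∣ (suc n) zero    _         = ∣initial∣ n zero z≤n
  ∣initial∣ (suc n) (suc k) (s≤s k≤n) = cong suc (∣initial∣ n k k≤n)

  initial-mono : {n k k′ : ℕ} → k ≤ k′ → initial n k ⊆ initial n k′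
  initial-mono k≤k′ {x} x∈ = ∈initial⁺ x (≤-trans (∈initial⁻ x x∈) k≤k′)

  toℕ-mod : (N i : ℕ) → i < suc N → toℕ (i mod suc N) ≡ i
  toℕ-mod N i i<n = trans (toℕ-fromℕ< _) (m<n⇒m%n≡m i<n)

  mod-injective : (N i j : ℕ) → i < suc N → j < suc N → i mod suc N ≡ j mod suc N → i ≡ j
  mod-injective N i j i<n j<n i≡j = trans (sym (toℕ-mod N i i<n)) (trans (cong toℕ i≡j) (toℕ-mod N j j<n))

  listFamily : {n : ℕ} → List (Subset n) → Family n
  listFamily []       = ∅F
  listFamily (A ∷ As) = Single A ∪F listFamily As

  listFamily⁺ : {n : ℕ} {A : Subset n} (As : List (Subset n)) → A ∈ᴸ As → A ∈F listFamily As
  listFamily⁺ {A = A} (B ∷ As) (here refl) = ∪F⁺ˡ (Single A) (listFamily As) A (Single-∋ A)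
  listFamily⁺ {A = A} (B ∷ As) (there A∈)  = ∪F⁺ʳ (Single B) (listFamily As) A (listFamily⁺ As A∈)

  listFamily⁻ : {n : ℕ} {A : Subset n} (As : List (Subset n)) → A ∈F listFamily As → A ∈ᴸ As
  listFamily⁻ {A = A} (B ∷ As) A∈ with ∪F⁻ (Single B) (listFamily As) A A∈
  ... | inj₁ A∈B  = here (Single-≡ B A A∈B)
  ... | inj₂ A∈As = there (listFamily⁻ As A∈As)

  card-listFamily : {n : ℕ} {As : List (Subset n)} → Unique As → card (listFamily As) ≡ length As
  card-listFamily {n} {[]}     []          = card-∅ {n} ∅F (λ _ → refl)
  card-listFamily {As = A ∷ As} (A≢As ∷ u) = trans (card-insert A (listFamily As) A∉) (cong suc (card-listFamily u))
    where
    A∉ : listFamily As A ≡ false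
    A∉ with listFamily As A in A∈
    ... | false = refl
    ... | true  = contradiction refl (All.lookup A≢As (listFamily⁻ As A∈))

  swap : {n : ℕ} → Subset n → Fin n → Fin n → Subset n
  swap Y y x = (Y ∩ ∁ ⁅ y ⁆) ∪ ⁅ x ⁆

  module _ {n : ℕ} {Y : Subset n} {y x : Fin n} (y∈Y : y ∈ Y) (x∉Y : x ∉ Y) where

    ∣Y∖y∣ : {t : ℕ} → ∣ Y ∣ ≡ suc t → ∣ Y ∩ ∁ ⁅ y ⁆ ∣ ≡ t
    ∣Y∖y∣ {t} ∣Y∣≡ = suc-injective (begin
      suc ∣ Y ∩ ∁ ⁅ y ⁆ ∣                 ≡⟨ cong (_+ ∣ Y ∩ ∁ ⁅ y ⁆ ∣) (∣⁅x⁆∩p∣≡1 Y y y∈Y) ⟨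
      ∣ ⁅ y ⁆ ∩ Y ∣ + ∣ Y ∩ ∁ ⁅ y ⁆ ∣     ≡⟨ cong (_+ ∣ Y ∩ ∁ ⁅ y ⁆ ∣) (∣p∩q∣≡∣q∩p∣ ⁅ y ⁆ Y) ⟩
      ∣ Y ∩ ⁅ y ⁆ ∣ + ∣ Y ∩ ∁ ⁅ y ⁆ ∣     ≡⟨ ∣p∩q∣+∣p∩∁q∣≡∣p∣ Y ⁅ y ⁆ ⟩
      ∣ Y ∣                               ≡⟨ ∣Y∣≡ ⟩
      suc t                               ∎)
      where open ≡-Reasoning

    ∣swap∣ : {t : ℕ} → ∣ Y ∣ ≡ suc t → ∣ swap Y y x ∣ ≡ suc t
    ∣swap∣ ∣Y∣≡ = trans (∣p∪⁅x⁆∣≡1+∣p∣ _ x (λ x∈ → x∉Y (p∩q⊆p Y _ x∈))) (cong suc (∣Y∖y∣ ∣Y∣≡))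

    swap∈M₁ : {t : ℕ} → ∣ Y ∣ ≡ suc t → swap Y y x ∈F M₁ Y (suc t) t
    swap∈M₁ ∣Y∣≡ = M₁⁺ Y (swap Y y x) (∣swap∣ ∣Y∣≡) (begin
      _                          ≡⟨ ∣Y∖y∣ ∣Y∣≡ ⟨
      ∣ Y ∩ ∁ ⁅ y ⁆ ∣            ≤⟨ p⊆q⇒∣p∣≤∣q∣ (λ x∈ → x∈p∩q⁺ (x∈p∪q⁺ (inj₁ x∈) , p∩q⊆p Y _ x∈)) ⟩
      ∣ swap Y y x ∩ Y ∣         ∎)
      where open ≤-Reasoning

    y∉swap : ¬ y ≡ x → y ∉ swap Y y x
    y∉swap y≢x y∈ with x∈p∪⁅y⁆⁻ y∈
    ... | inj₁ y∈Y∖y = x∈∁p⇒x∉p (p∩q⊆q Y _ y∈Y∖y) (x∈⁅x⁆ y)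
    ... | inj₂ y≡x   = y≢x y≡x

  module SingletonConstruction (N t′ s : ℕ) (1≤s : 1 ≤ s) (room : suc t′ + s + 3 ≤ suc N) where

    n t : ℕ
    n = suc N
    t = suc t′

    <n : ∀ i → i ≤ suc t → i < n
    <n i i≤1+t = ≤-trans (s≤s i≤1+t) (≤-trans (m≤m+n (suc (suc t)) (s + 1)) (≤-trans (≤-reflexive (rearrange t s)) room))
      where
      rearrange : ∀ t s → suc (suc t) + (s + 1) ≡ t + s + 3
      rearrange = solve-∀

    Y : Subset n
    Y = initial n (suc t)

    ∣Y∣≡ : ∣ Y ∣ ≡ suc t
    ∣Y∣≡ = ∣initial∣ n (suc t) (<⇒≤ (<n (suc t) ≤-refl))

    y₁ y₂ x : Fin n
    y₁ = 0 mod n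
    y₂ = 1 mod n
    x  = suc t mod n

    y₁∈Y : y₁ ∈ Y
    y₁∈Y = ∈initial⁺ y₁ (subst (_< suc t) (sym (toℕ-mod N 0 (<n 0 z≤n))) (s≤s z≤n))

    y₂∈Y : y₂ ∈ Y
    y₂∈Y = ∈initial⁺ y₂ (subst (_< suc t) (sym (toℕ-mod N 1 (<n 1 (s≤s z≤n)))) (s≤s (s≤s z≤n)))

    x∉Y : x ∉ Y
    x∉Y x∈ = <-irrefl (toℕ-mod N (suc t) (<n (suc t) ≤-refl)) (∈initial⁻ x x∈)

    y₁≢y₂ : ¬ y₁ ≡ y₂
    y₁≢y₂ y₁≡y₂ with () ← mod-injective N 0 1 (<n 0 z≤n) (<n 1 (s≤s z≤n)) y₁≡y₂

    y≢x : ∀ i → i ≤ 1 → ¬ i mod n ≡ x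
    y≢x i i≤1 i≡x = <-irrefl (mod-injective N i (suc t) (<n i (≤-trans i≤1 (s≤s z≤n))) (<n (suc t) ≤-refl) i≡x)
                             (s≤s (≤-trans i≤1 (s≤s z≤n)))

    𝓜 𝓧 : Family n
    𝓜 = M₁ Y (suc t) t
    𝓧 = Binom (suc t) ∖F 𝓜

    s≤card𝓧 : s ≤ card 𝓧
    s≤card𝓧 = begin
      s                                  ≤⟨ ≤-trans (m≤m+n s 1) (m≤m+n (s + 1) r) ⟩
      s + 1 + r                          ≤⟨ n≤[1+n]C2 (s + 1 + r) ⟩
      suc (s + 1 + r) C 2                ≡⟨ cong (_C 2) ∣∁Y∣≡ ⟨
      ∣ ∁ Y ∣ C 2                        ≡⟨ *-identityˡ _ ⟨
      1 * (∣ ∁ Y ∣ C 2)                  ≤⟨ *-monoˡ-≤ (∣ ∁ Y ∣ C 2) (nCk≥1 ∣ Y ∣ t′ t′≤∣Y∣) ⟩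
      (∣ Y ∣ C t′) * (∣ ∁ Y ∣ C 2)       ≡⟨ *-identityʳ _ ⟨
      (∣ Y ∣ C t′) * (∣ ∁ Y ∣ C 2) * 1   ≡⟨ card-profile Y (∁ Y) (∩-inverseʳ Y) t′ 2 0 ⟨
      card (profile Y (∁ Y) t′ 2 0)      ≤⟨ card-mono _ 𝓧 profile⊆𝓧 ⟩
      card 𝓧                             ∎
      where
      open ≤-Reasoning
      r = n ∸ (t + s + 3)
      t′≤∣Y∣ : t′ ≤ ∣ Y ∣
      t′≤∣Y∣ = subst (t′ ≤_) (sym ∣Y∣≡) (≤-trans (n≤1+n t′) (n≤1+n t))
      ∣∁Y∣≡ : ∣ ∁ Y ∣ ≡ suc (s + 1 + r)
      ∣∁Y∣≡ = begin-equality
        ∣ ∁ Y ∣                          ≡⟨ ∣∁p∣≡n∸∣p∣ Y ⟩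
        n ∸ ∣ Y ∣                        ≡⟨ cong₂ _∸_ (sym (m+[n∸m]≡n room)) ∣Y∣≡ ⟩
        t + s + 3 + r ∸ suc t            ≡⟨ cong (_∸ suc t) (rearrange t s r) ⟩
        suc t + suc (s + 1 + r) ∸ suc t  ≡⟨ m+n∸m≡n (suc t) _ ⟩
        suc (s + 1 + r)                  ∎
        where
        rearrange : ∀ t s r → t + s + 3 + r ≡ suc t + suc (s + 1 + r)
        rearrange = solve-∀
      profile⊆𝓧 : profile Y (∁ Y) t′ 2 0 ⊆F 𝓧
      profile⊆𝓧 B B∈ = ∧-true (⌊⌋-true (∣ B ∣ ≟ suc t) (trans (profile⁻-∣∣ (∩-inverseʳ Y) B B∈) (size t′)))
                              (cong not (M₁-∉⁺ Y B (≤-reflexive (cong suc (proj₁ (profile⁻ B B∈))))))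
        where
        size : ∀ t′ → t′ + 2 + 0 ≡ suc (suc t′)
        size = solve-∀

    𝓒 : Family n
    𝓒 = proj₁ (subfamily-of-size 𝓧 s s≤card𝓧)

    𝓒⊆𝓧 : 𝓒 ⊆F 𝓧
    𝓒⊆𝓧 = proj₁ (proj₂ (subfamily-of-size 𝓧 s s≤card𝓧))

    card𝓒 : card 𝓒 ≡ s
    card𝓒 = proj₂ (proj₂ (subfamily-of-size 𝓧 s s≤card𝓧))

    𝓒∌𝓜 : ∀ B → B ∈F 𝓜 → 𝓒 B ≡ false
    𝓒∌𝓜 B B∈𝓜 with 𝓒 B in B∈𝓒
    ... | false = refl
    ... | true  = contradiction (trans (sym (cong not B∈𝓜)) (∧-conicalʳ (Binom (suc t) B) _ (𝓒⊆𝓧 B B∈𝓒))) λ ()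

    𝓕 𝓖 : Family n
    𝓕 = Single Y
    𝓖 = 𝓜 ∪F 𝓒

    Y∈𝓜 : Y ∈F 𝓜
    Y∈𝓜 = M₁⁺ Y Y ∣Y∣≡ (≤-trans (n≤1+n t) (≤-reflexive (sym (trans (cong ∣_∣ (∩-idem Y)) ∣Y∣≡))))

    card𝓖 : card 𝓖 ≡ suc (suc t * (n ∸ suc t)) + s
    card𝓖 = trans (card-∪ 𝓜 𝓒 𝓒∌𝓜) (cong₂ _+_ (card-M₁ Y t ∣Y∣≡) card𝓒)

    admissible : Admissible n t s 𝓕 𝓖
    admissible = 𝓕-uniform , 𝓖-uniform , (𝓕-side , 𝓖-side) , ∣⋂∣<t , 𝓕≤𝓖
      where
      𝓕-uniform : Uniform (suc t) 𝓕
      𝓕-uniform A A∈ = trans (cong ∣_∣ (Single-≡ Y A A∈)) ∣Y∣≡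
      𝓖-uniform : Uniform (suc t) 𝓖
      𝓖-uniform B B∈ = [ (λ B∈𝓜 → proj₁ (M₁⁻ Y (suc t) t B B∈𝓜))
                       , (λ B∈𝓒 → ⌊⌋-true⁻¹ (∣ B ∣ ≟ suc t) (∧-conicalˡ (Binom (suc t) B) _ (𝓒⊆𝓧 B B∈𝓒))) ]′ (∪F⁻ 𝓜 𝓒 B B∈)
      𝓕-side : ∀ A → A ∈F 𝓕 → disjCount t A 𝓖 ≤ s
      𝓕-side A A∈ = subst (λ A → disjCount t A 𝓖 ≤ s) (sym (Single-≡ Y A A∈))
        (≤-trans (card-mono _ 𝓒 disjoint⊆𝓒) (≤-reflexive card𝓒))
        where
        disjoint⊆𝓒 : (𝓖 ∩F tDisjoint? t Y) ⊆F 𝓒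
        disjoint⊆𝓒 B B∈ = [ (λ B∈𝓜 → contradiction (trans (sym (∧-conicalʳ (𝓖 B) _ B∈))
                                (tIntersecting⁺ t Y B (subst (t ≤_) (∣p∩q∣≡∣q∩p∣ B Y) (proj₂ (M₁⁻ Y (suc t) t B B∈𝓜))))) λ ())
                          , (λ B∈𝓒 → B∈𝓒) ]′ (∪F⁻ 𝓜 𝓒 B (∧-conicalˡ (𝓖 B) _ B∈))
      𝓖-side : ∀ B → B ∈F 𝓖 → disjCount t B 𝓕 ≤ s
      𝓖-side B _ = ≤-trans (card-mono _ 𝓕 (λ A A∈ → ∧-conicalˡ (𝓕 A) _ A∈)) (≤-trans (≤-reflexive (card-Single Y)) 1≤s)
      ∣⋂∣<t : ∣ bigCap (𝓕 ∪F 𝓖) ∣ < t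
      ∣⋂∣<t = ∣bigCap∣<t (𝓕 ∪F 𝓖) Y (swap Y y₁ x) (swap Y y₂ x) y₁ y₂ t
        (∪F⁺ˡ 𝓕 𝓖 Y (Single-∋ Y))
        (∪F⁺ʳ 𝓕 𝓖 (swap Y y₁ x) (∪F⁺ˡ 𝓜 𝓒 (swap Y y₁ x) (swap∈M₁ y₁∈Y x∉Y ∣Y∣≡)))
        (∪F⁺ʳ 𝓕 𝓖 (swap Y y₂ x) (∪F⁺ˡ 𝓜 𝓒 (swap Y y₂ x) (swap∈M₁ y₂∈Y x∉Y ∣Y∣≡)))
        y₁∈Y y₂∈Y (y∉swap y₁∈Y x∉Y (y≢x 0 z≤n)) (y∉swap y₂∈Y x∉Y (y≢x 1 ≤-refl)) y₁≢y₂ ∣Y∣≡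
      𝓕≤𝓖 : card 𝓕 ≤ card 𝓖
      𝓕≤𝓖 = subst (_≤ card 𝓖) (sym (card-Single Y)) (member⇒card≥1 𝓖 Y (∪F⁺ˡ 𝓜 𝓒 Y Y∈𝓜))

    product : card 𝓕 * card 𝓖 ≡ suc (suc t * (n ∸ suc t)) + s
    product = trans (cong (_* card 𝓖) (card-Single Y)) (trans (*-identityˡ _) card𝓖)

  -- W = W₀ ∪ {w₀} = {0, …, t − 1} and z j = t + j for j < s + 2; 𝓓 is the cycle of the s + 2 sets
  -- W₀ ∪ {z j , z (j + 1 mod s + 2)}, so every z j lies in exactly two of its members.
  module CycleConstruction (N t′ s : ℕ) (1≤s : 1 ≤ s) (room : suc t′ + s + 3 ≤ suc N) where

    n t m : ℕ
    n = suc N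
    t = suc t′
    m = suc (suc s)

    t+m≤n : t + m ≤ n
    t+m≤n = ≤-trans (m≤m+n (t + m) 1) (≤-trans (≤-reflexive (rearrange t s)) room)
      where
      rearrange : ∀ t s → t + suc (suc s) + 1 ≡ t + s + 3
      rearrange = solve-∀

    t+j<n : ∀ {j} → j < m → t + j < n
    t+j<n {j} j<m = ≤-trans (≤-reflexive (sym (+-suc t j))) (≤-trans (+-monoʳ-≤ t j<m) t+m≤n)

    W₀ W Z : Subset n
    W₀ = initial n t′
    W  = initial n t
    Z  = initial n (t + m)

    ∣W₀∣≡ : ∣ W₀ ∣ ≡ t′
    ∣W₀∣≡ = ∣initial∣ n t′ (≤-trans (n≤1+n t′) (≤-trans (m≤m+n t m) t+m≤n))

    ∣W∣≡ : ∣ W ∣ ≡ t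
    ∣W∣≡ = ∣initial∣ n t (≤-trans (m≤m+n t m) t+m≤n)

    ∣Z∣≡ : ∣ Z ∣ ≡ t + m
    ∣Z∣≡ = ∣initial∣ n (t + m) t+m≤n

    W₀⊆W : W₀ ⊆ W
    W₀⊆W = initial-mono (n≤1+n t′)

    W⊆Z : W ⊆ Z
    W⊆Z = initial-mono (m≤m+n t m)

    w₀ : Fin n
    w₀ = t′ mod n

    toℕ-w₀ : toℕ w₀ ≡ t′
    toℕ-w₀ = toℕ-mod N t′ (≤-trans (m≤m+n t m) t+m≤n)

    w₀∈W : w₀ ∈ W
    w₀∈W = ∈initial⁺ w₀ (≤-reflexive (cong suc toℕ-w₀))

    w₀∉W₀ : w₀ ∉ W₀
    w₀∉W₀ w₀∈ = <-irrefl toℕ-w₀ (∈initial⁻ w₀ w₀∈)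

    z : ℕ → Fin n
    z j = (t + j) mod n

    toℕ-z : ∀ {j} → j < m → toℕ (z j) ≡ t + j
    toℕ-z j<m = toℕ-mod N _ (t+j<n j<m)

    z-injective : ∀ {j k} → j < m → k < m → z j ≡ z k → j ≡ k
    z-injective j<m k<m zj≡zk = +-cancelˡ-≡ t _ _ (mod-injective N _ _ (t+j<n j<m) (t+j<n k<m) zj≡zk)

    z∉W : ∀ {j} → j < m → z j ∉ W
    z∉W {j} j<m zj∈W = <⇒≱ (subst (_< t) (toℕ-z j<m) (∈initial⁻ (z j) zj∈W)) (m≤m+n t j)

    z∉W₀ : ∀ {j} → j < m → z j ∉ W₀
    z∉W₀ j<m zj∈W₀ = z∉W j<m (W₀⊆W zj∈W₀)

    z∈Z : ∀ {j} → j < m → z j ∈ Z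
    z∈Z {j} j<m = ∈initial⁺ (z j) (subst (_< t + m) (sym (toℕ-z j<m)) (+-monoʳ-< t j<m))

    w₀≢z : ∀ {j} → j < m → ¬ w₀ ≡ z j
    w₀≢z {j} j<m w₀≡zj = <-irrefl (trans (sym toℕ-w₀) (trans (cong toℕ w₀≡zj) (toℕ-z j<m))) (m≤m+n t j)

    edge : ℕ → ℕ → Subset n
    edge a b = (W₀ ∪ ⁅ z a ⁆) ∪ ⁅ z b ⁆

    W₀∪za⊆edge : ∀ a b → W₀ ∪ ⁅ z a ⁆ ⊆ edge a b
    W₀∪za⊆edge a b = p⊆p∪q ⁅ z b ⁆

    W₀∪zb⊆edge : ∀ a b → W₀ ∪ ⁅ z b ⁆ ⊆ edge a b
    W₀∪zb⊆edge a b x∈ with x∈p∪⁅y⁆⁻ x∈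
    ... | inj₁ x∈W₀ = x∈p∪q⁺ (inj₁ (x∈p∪q⁺ (inj₁ x∈W₀)))
    ... | inj₂ refl = x∈p∪⁅x⁆ _ (z b)

    za∈edge : ∀ a b → z a ∈ edge a b
    za∈edge a b = W₀∪za⊆edge a b (x∈p∪⁅x⁆ W₀ (z a))

    zb∈edge : ∀ a b → z b ∈ edge a b
    zb∈edge a b = x∈p∪⁅x⁆ _ (z b)

    edge⁻ : ∀ a b {x} → x ∈ edge a b → (x ∈ W₀) ⊎ (x ≡ z a) ⊎ (x ≡ z b)
    edge⁻ a b x∈ with x∈p∪⁅y⁆⁻ x∈
    ... | inj₂ x≡zb = inj₂ (inj₂ x≡zb)
    ... | inj₁ x∈W₀∪za with x∈p∪⁅y⁆⁻ x∈W₀∪za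
    ...   | inj₁ x∈W₀ = inj₁ x∈W₀
    ...   | inj₂ x≡za = inj₂ (inj₁ x≡za)

    z∈edge⁻ : ∀ {j a b} → j < m → a < m → b < m → z j ∈ edge a b → (j ≡ a) ⊎ (j ≡ b)
    z∈edge⁻ j<m a<m b<m zj∈ with edge⁻ _ _ zj∈
    ... | inj₁ zj∈W₀         = contradiction zj∈W₀ (z∉W₀ j<m)
    ... | inj₂ (inj₁ zj≡za) = inj₁ (z-injective j<m a<m zj≡za)
    ... | inj₂ (inj₂ zj≡zb) = inj₂ (z-injective j<m b<m zj≡zb)

    w₀∉edge : ∀ {a b} → a < m → b < m → w₀ ∉ edge a b
    w₀∉edge a<m b<m w₀∈ with edge⁻ _ _ w₀∈
    ... | inj₁ w₀∈W₀         = w₀∉W₀ w₀∈W₀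
    ... | inj₂ (inj₁ w₀≡za) = w₀≢z a<m w₀≡za
    ... | inj₂ (inj₂ w₀≡zb) = w₀≢z b<m w₀≡zb

    ∣W₀∪z∣≡t : ∀ {a} → a < m → ∣ W₀ ∪ ⁅ z a ⁆ ∣ ≡ t
    ∣W₀∪z∣≡t a<m = trans (∣p∪⁅x⁆∣≡1+∣p∣ W₀ _ (z∉W₀ a<m)) (cong suc ∣W₀∣≡)

    ∣edge∣≡ : ∀ {a b} → a < m → b < m → ¬ a ≡ b → ∣ edge a b ∣ ≡ suc t
    ∣edge∣≡ {a} {b} a<m b<m a≢b = trans (∣p∪⁅x⁆∣≡1+∣p∣ _ (z b) zb∉) (cong suc (∣W₀∪z∣≡t a<m))
      where
      zb∉ : z b ∉ W₀ ∪ ⁅ z a ⁆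
      zb∉ zb∈ with x∈p∪⁅y⁆⁻ zb∈
      ... | inj₁ zb∈W₀ = z∉W₀ b<m zb∈W₀
      ... | inj₂ zb≡za = a≢b (sym (z-injective b<m a<m zb≡za))

    step : ℕ → Subset n
    step j = edge j (suc j)

    closing : Subset n
    closing = edge (suc s) 0

    path : ℕ → List (Subset n)
    path zero    = []
    path (suc k) = step k ∷ path k

    cycle : List (Subset n)
    cycle = closing ∷ path (suc s)

    path⁻ : ∀ k {B} → B ∈ᴸ path k → Σ[ j ∈ ℕ ] j < k × B ≡ step j
    path⁻ (suc k) (here B≡) = k , ≤-refl , B≡
    path⁻ (suc k) (there B∈) = let (j , j<k , B≡) = path⁻ k B∈ in j , m≤n⇒m≤1+n j<k , B≡

    path⁺ : ∀ k {j} → j < k → step j ∈ᴸ path k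
    path⁺ (suc k) {j} j<1+k with j ≟ k
    ... | yes refl = here refl
    ... | no j≢k   = there (path⁺ k (≤∧≢⇒< (≤-pred j<1+k) j≢k))

    length-path : ∀ k → length (path k) ≡ k
    length-path zero    = refl
    length-path (suc k) = cong suc (length-path k)

    <m : ∀ {j} → j ≤ suc s → j < m
    <m = s≤s

    step≢step : ∀ {j k} → j < k → k ≤ s → ¬ step j ≡ step k
    step≢step {j} {k} j<k k≤s step≡ with z∈edge⁻ (<m (s≤s k≤s)) (<m j≤1+s) (<m (≤-trans j<k (m≤n⇒m≤1+n k≤s)))
                                           (subst (z (suc k) ∈_) (sym step≡) (zb∈edge k (suc k)))
      where
      j≤1+s : j ≤ suc s
      j≤1+s = ≤-trans (n≤1+n j) (m≤n⇒m≤1+n (≤-trans j<k k≤s))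
    ... | inj₁ 1+k≡j   = <-asym j<k (≤-reflexive 1+k≡j)
    ... | inj₂ 1+k≡1+j = <-irrefl (sym (suc-injective 1+k≡1+j)) j<k

    closing≢step : ∀ {j} → j ≤ s → ¬ closing ≡ step j
    closing≢step {j} j≤s closing≡ with j ≟ s
    ... | no j≢s with z∈edge⁻ (<m ≤-refl) (<m (m≤n⇒m≤1+n j≤s)) (<m (s≤s j≤s))
                                (subst (z (suc s) ∈_) closing≡ (za∈edge (suc s) 0))
    ...   | inj₁ 1+s≡j   = <-irrefl refl (≤-trans (≤-reflexive 1+s≡j) j≤s)
    ...   | inj₂ 1+s≡1+j = j≢s (sym (suc-injective 1+s≡1+j))
    closing≢step {j} j≤s closing≡ | yes refl with z∈edge⁻ (<m z≤n) (<m (n≤1+n s)) (<m ≤-refl)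
                                                  (subst (z 0 ∈_) closing≡ (zb∈edge (suc s) 0))
    ... | inj₁ 0≡s = <-irrefl 0≡s 1≤s
    ... | inj₂ ()

    path-unique : ∀ k → k ≤ suc s → Unique (path k)
    path-unique zero    _         = []
    path-unique (suc k) 1+k≤1+s = All.tabulate step-k≢ ∷ path-unique k (m≤n⇒m≤1+n (≤-pred 1+k≤1+s))
      where
      step-k≢ : ∀ {B} → B ∈ᴸ path k → ¬ step k ≡ B
      step-k≢ B∈ step-k≡B = let (j , j<k , B≡) = path⁻ k B∈ in
        step≢step j<k (≤-pred 1+k≤1+s) (sym (trans step-k≡B B≡))

    cycle-unique : Unique cycle
    cycle-unique = All.tabulate closing≢ ∷ path-unique (suc s) ≤-refl
      where
      closing≢ : ∀ {B} → B ∈ᴸ path (suc s) → ¬ closing ≡ B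
      closing≢ B∈ closing≡B = let (j , j<1+s , B≡) = path⁻ (suc s) B∈ in
        closing≢step (≤-pred j<1+s) (trans closing≡B B≡)

    abstract

      𝓓 : Family n
      𝓓 = listFamily cycle

      card𝓓 : card 𝓓 ≡ m
      card𝓓 = trans (card-listFamily cycle-unique) (cong suc (length-path (suc s)))

      𝓓⁻ : ∀ B → B ∈F 𝓓 → Σ[ a ∈ ℕ ] Σ[ b ∈ ℕ ] a < m × b < m × ¬ a ≡ b × B ≡ edge a b
      𝓓⁻ B B∈ with listFamily⁻ cycle B∈
      ... | here B≡closing = suc s , 0 , <m ≤-refl , <m z≤n , (λ ()) , B≡closing
      ... | there B∈path   = let (j , j<1+s , B≡) = path⁻ (suc s) B∈path in
        j , suc j , <m (<⇒≤ j<1+s) , <m j<1+s , (λ j≡1+j → <-irrefl j≡1+j (n<1+n j)) , B≡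

      step∈𝓓 : ∀ {j} → j ≤ s → step j ∈F 𝓓
      step∈𝓓 j≤s = listFamily⁺ cycle (there (path⁺ (suc s) (s≤s j≤s)))

      closing∈𝓓 : closing ∈F 𝓓
      closing∈𝓓 = listFamily⁺ cycle (here refl)

    𝓓-covers-twice : ∀ {j} → j < m →
      Σ[ X ∈ Subset n ] Σ[ X′ ∈ Subset n ] X ∈F 𝓓 × X′ ∈F 𝓓 × ¬ X ≡ X′ × z j ∈ X × z j ∈ X′
    𝓓-covers-twice {zero} _ =
      step 0 , closing , step∈𝓓 z≤n , closing∈𝓓 , (λ ≡c → closing≢step z≤n (sym ≡c)) , za∈edge 0 1 , zb∈edge (suc s) 0
    𝓓-covers-twice {suc j} (s≤s (s≤s j≤s)) with m≤n⇒m<n∨m≡n j≤s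
    ... | inj₁ j<s  = step j , step (suc j) , step∈𝓓 (<⇒≤ j<s) , step∈𝓓 j<s , step≢step ≤-refl j<s ,
                      zb∈edge j (suc j) , za∈edge (suc j) (suc (suc j))
    ... | inj₂ refl = step s , closing , step∈𝓓 ≤-refl , closing∈𝓓 , (λ ≡c → closing≢step ≤-refl (sym ≡c)) ,
                      zb∈edge s (suc s) , za∈edge (suc s) 0

    𝓕 𝓢 𝓖 : Family n
    𝓕 = H₁ Z W (suc t)
    𝓢 = H₁ ⊤ W (suc t)
    𝓖 = 𝓢 ∪F 𝓓

    petal : ℕ → Subset n
    petal j = W ∪ ⁅ z j ⁆

    ∣petal∣≡ : ∀ {j} → j < m → ∣ petal j ∣ ≡ suc t
    ∣petal∣≡ j<m = trans (∣p∪⁅x⁆∣≡1+∣p∣ W _ (z∉W j<m)) (cong suc ∣W∣≡)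

    petal∈𝓕 : ∀ {j} → j < m → petal j ∈F 𝓕
    petal∈𝓕 {j} j<m = H₁⁺ (petal j) petal⊆Z (∣petal∣≡ j<m) (p⊆p∪q ⁅ z j ⁆)
      where
      petal⊆Z : petal j ⊆ Z
      petal⊆Z x∈ with x∈p∪⁅y⁆⁻ x∈
      ... | inj₁ x∈W = W⊆Z x∈W
      ... | inj₂ refl = z∈Z j<m

    𝓕-petal : ∀ A → A ∈F 𝓕 → Σ[ j ∈ ℕ ] j < m × z j ∈ A
    𝓕-petal A A∈ with ∣p∣≥1⇒nonempty (A ∩ ∁ W) (≤-reflexive (sym ∣A∖W∣≡1))
      where
      ∣A∖W∣≡1 : ∣ A ∩ ∁ W ∣ ≡ 1
      ∣A∖W∣≡1 = let (_ , ∣A∣≡ , W⊆A) = H₁⁻ Z W (suc t) A A∈ in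
        ∣p∩∁q∣≡1 A W ∣A∣≡ (trans (q⊆p⇒∣p∩q∣≡∣q∣ W⊆A) ∣W∣≡)
    ... | a , a∈A∖W = toℕ a ∸ t , j<m , subst (_∈ A) (sym z[j]≡a) a∈A
      where
      a∈A = proj₁ (x∈p∩q⁻ A (∁ W) a∈A∖W)
      t≤a : t ≤ toℕ a
      t≤a = ≮⇒≥ (λ a<t → x∈∁p⇒x∉p (proj₂ (x∈p∩q⁻ A (∁ W) a∈A∖W)) (∈initial⁺ a a<t))
      a<t+m : toℕ a < t + m
      a<t+m = ∈initial⁻ a (proj₁ (H₁⁻ Z W (suc t) A A∈) a∈A)
      t+j≡a : t + (toℕ a ∸ t) ≡ toℕ a
      t+j≡a = m+[n∸m]≡n t≤a
      j<m : toℕ a ∸ t < m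
      j<m = +-cancelˡ-< t _ _ (subst (_< t + m) (sym t+j≡a) a<t+m)
      z[j]≡a : z (toℕ a ∸ t) ≡ a
      z[j]≡a = toℕ-injective (trans (toℕ-z j<m) t+j≡a)

    W₀∪z⊆petal : ∀ a → W₀ ∪ ⁅ z a ⁆ ⊆ petal a
    W₀∪z⊆petal a x∈ with x∈p∪⁅y⁆⁻ x∈
    ... | inj₁ x∈W₀ = x∈p∪q⁺ (inj₁ (W₀⊆W x∈W₀))
    ... | inj₂ refl = x∈p∪⁅x⁆ W (z a)

    share-W₀∪z : ∀ {a} → a < m → (A B : Subset n) → W₀ ∪ ⁅ z a ⁆ ⊆ A → W₀ ∪ ⁅ z a ⁆ ⊆ B → tDisjoint? t A B ≡ false
    share-W₀∪z a<m A B ⊆A ⊆B = tIntersecting⁺ t A B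
      (≤-trans (≤-reflexive (sym (∣W₀∪z∣≡t a<m))) (p⊆q⇒∣p∣≤∣q∣ (λ x∈ → x∈p∩q⁺ (⊆A x∈ , ⊆B x∈))))

    share-W : (A B : Subset n) → W ⊆ A → W ⊆ B → tDisjoint? t A B ≡ false
    share-W A B W⊆A W⊆B = tIntersecting⁺ t A B
      (≤-trans (≤-reflexive (sym ∣W∣≡)) (p⊆q⇒∣p∣≤∣q∣ (λ x∈ → x∈p∩q⁺ (W⊆A x∈ , W⊆B x∈))))

    𝓓∌W : ∀ B → B ∈F 𝓓 → ¬ W ⊆ B
    𝓓∌W B B∈ W⊆B with 𝓓⁻ B B∈
    ... | a , b , a<m , b<m , _ , refl = w₀∉edge a<m b<m (W⊆B w₀∈W)

    card𝓕 : card 𝓕 ≡ m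
    card𝓕 = trans (card-H₁ Z W t W⊆Z ∣W∣≡) (trans (cong (_∸ t) ∣Z∣≡) (m+n∸m≡n t m))

    card𝓖 : card 𝓖 ≡ (n ∸ t) + m
    card𝓖 = trans (card-∪ 𝓢 𝓓 𝓓∌𝓢) (cong₂ _+_ (card-H₁-⊤ W t ∣W∣≡) card𝓓)
      where
      𝓓∌𝓢 : ∀ B → B ∈F 𝓢 → 𝓓 B ≡ false
      𝓓∌𝓢 B B∈𝓢 with 𝓓 B in B∈𝓓
      ... | false = refl
      ... | true  = ⊥-elim (𝓓∌W B B∈𝓓 (proj₂ (proj₂ (H₁⁻ ⊤ W (suc t) B B∈𝓢))))

    𝓕-side : ∀ A → A ∈F 𝓕 → disjCount t A 𝓖 ≤ s
    𝓕-side A A∈ = through-petal (𝓕-petal A A∈)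
      where
      W⊆A = proj₂ (proj₂ (H₁⁻ Z W (suc t) A A∈))
      through-petal : Σ[ j ∈ ℕ ] j < m × z j ∈ A → disjCount t A 𝓖 ≤ s
      through-petal (j , j<m , zj∈A) =
        ≤-trans (card-mono (𝓖 ∩F tDisjoint? t A) (𝓓 ∖F ∋zj) disjoint⊆) (card-∖≤ 𝓓 ∋zj s (trans card𝓓 (+-comm 2 s)) two∋zj)
        where
        ∋zj : Family n
        ∋zj B = ⌊ z j ∈? B ⌋
        intersects : ∀ B → B ∈F 𝓓 → B ∈F ∋zj → tDisjoint? t A B ≡ false
        intersects B B∈𝓓 zj∈B with 𝓓⁻ B B∈𝓓
        ... | a , b , _ , _ , _ , refl = share-W₀∪z j<m A B W₀∪zj⊆A W₀∪zj⊆B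
          where
          W₀∪zj⊆A : W₀ ∪ ⁅ z j ⁆ ⊆ A
          W₀∪zj⊆A x∈ with x∈p∪⁅y⁆⁻ x∈
          ... | inj₁ x∈W₀ = W⊆A (W₀⊆W x∈W₀)
          ... | inj₂ refl = zj∈A
          W₀∪zj⊆B : W₀ ∪ ⁅ z j ⁆ ⊆ B
          W₀∪zj⊆B x∈ with x∈p∪⁅y⁆⁻ x∈
          ... | inj₁ x∈W₀ = x∈p∪q⁺ (inj₁ (x∈p∪q⁺ (inj₁ x∈W₀)))
          ... | inj₂ refl = ⌊⌋-true⁻¹ (z j ∈? B) zj∈B
        disjoint⊆ : (𝓖 ∩F tDisjoint? t A) ⊆F (𝓓 ∖F ∋zj)
        disjoint⊆ B B∈ with ∪F⁻ 𝓢 𝓓 B (∧-conicalˡ (𝓖 B) _ B∈)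
        ... | inj₁ B∈𝓢 = contradiction (trans (sym disjoint) (share-W A B W⊆A (proj₂ (proj₂ (H₁⁻ ⊤ W (suc t) B B∈𝓢))))) λ ()
          where disjoint = ∧-conicalʳ (𝓖 B) _ B∈
        ... | inj₂ B∈𝓓 with ∋zj B in zj∈?B
        ...   | false = ∧-true B∈𝓓 refl
        ...   | true  = contradiction (trans (sym (∧-conicalʳ (𝓖 B) _ B∈)) (intersects B B∈𝓓 zj∈?B)) λ ()
        two∋zj : 2 ≤ card (𝓓 ∩F ∋zj)
        two∋zj = let (X , X′ , X∈ , X′∈ , X≢X′ , zj∈X , zj∈X′) = 𝓓-covers-twice j<m in
          two-members⇒card≥2 (𝓓 ∩F ∋zj) X X′ (∧-true X∈ (⌊⌋-true (z j ∈? X) zj∈X))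
                                             (∧-true X′∈ (⌊⌋-true (z j ∈? X′) zj∈X′)) X≢X′

    𝓖-side : ∀ B → B ∈F 𝓖 → disjCount t B 𝓕 ≤ s
    𝓖-side B B∈ with ∪F⁻ 𝓢 𝓓 B B∈
    ... | inj₁ B∈𝓢 = ≤-trans (≤-reflexive (card-∅ (𝓕 ∩F tDisjoint? t B) none)) z≤n
      where
      none : ∀ A → (𝓕 ∩F tDisjoint? t B) A ≡ false
      none A with 𝓕 A in A∈
      ... | false = refl
      ... | true  = share-W B A (proj₂ (proj₂ (H₁⁻ ⊤ W (suc t) B B∈𝓢))) (proj₂ (proj₂ (H₁⁻ Z W (suc t) A A∈)))
    ... | inj₂ B∈𝓓 with 𝓓⁻ B B∈𝓓
    ...   | a , b , a<m , b<m , a≢b , refl =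
      card-∩≤ 𝓕 (tDisjoint? t (edge a b)) s (trans card𝓕 (+-comm 2 s))
        (two-members⇒card≥2 _ (petal a) (petal b)
          (petal-meets a<m (W₀∪za⊆edge a b)) (petal-meets b<m (W₀∪zb⊆edge a b)) petal≢)
      where
      petal-meets : ∀ {c} → c < m → W₀ ∪ ⁅ z c ⁆ ⊆ edge a b → petal c ∈F (𝓕 ∖F tDisjoint? t (edge a b))
      petal-meets {c} c<m ⊆edge = ∧-true (petal∈𝓕 c<m) (cong not (share-W₀∪z c<m (edge a b) (petal c) ⊆edge (W₀∪z⊆petal c)))
      petal≢ : ¬ petal a ≡ petal b
      petal≢ petal≡ with x∈p∪⁅y⁆⁻ (subst (z b ∈_) (sym petal≡) (x∈p∪⁅x⁆ W (z b)))
      ... | inj₁ zb∈W = z∉W b<m zb∈W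
      ... | inj₂ zb≡za = a≢b (sym (z-injective b<m a<m zb≡za))

    2<m : 2 < m
    2<m = s≤s (s≤s 1≤s)

    ∣⋂∣<t : ∣ bigCap (𝓕 ∪F 𝓖) ∣ < t
    ∣⋂∣<t = ∣bigCap∣<t (𝓕 ∪F 𝓖) (petal 2) (step 0) (step 0) w₀ (z 2) t
      (∪F⁺ˡ 𝓕 𝓖 (petal 2) (petal∈𝓕 2<m))
      (∪F⁺ʳ 𝓕 𝓖 (step 0) (∪F⁺ʳ 𝓢 𝓓 (step 0) (step∈𝓓 z≤n)))
      (∪F⁺ʳ 𝓕 𝓖 (step 0) (∪F⁺ʳ 𝓢 𝓓 (step 0) (step∈𝓓 z≤n)))
      (x∈p∪q⁺ (inj₁ w₀∈W)) (x∈p∪⁅x⁆ W (z 2)) (w₀∉edge (<m z≤n) (<m (s≤s z≤n))) z2∉step0 (w₀≢z 2<m) (∣petal∣≡ 2<m)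
      where
      z2∉step0 : z 2 ∉ step 0
      z2∉step0 z2∈ with z∈edge⁻ 2<m (<m z≤n) (<m (s≤s z≤n)) z2∈
      ... | inj₁ ()
      ... | inj₂ ()

    admissible : Admissible n t s 𝓕 𝓖
    admissible = 𝓕-uniform , 𝓖-uniform , (𝓕-side , 𝓖-side) , ∣⋂∣<t ,
                 subst₂ _≤_ (sym card𝓕) (sym card𝓖) (m≤n+m m (n ∸ t))
      where
      𝓕-uniform : Uniform (suc t) 𝓕
      𝓕-uniform A A∈ = proj₁ (proj₂ (H₁⁻ Z W (suc t) A A∈))
      𝓖-uniform : Uniform (suc t) 𝓖
      𝓖-uniform B B∈ with ∪F⁻ 𝓢 𝓓 B B∈
      ... | inj₁ B∈𝓢 = proj₁ (proj₂ (H₁⁻ ⊤ W (suc t) B B∈𝓢))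
      ... | inj₂ B∈𝓓 with 𝓓⁻ B B∈𝓓
      ...   | a , b , a<m , b<m , a≢b , refl = ∣edge∣≡ a<m b<m a≢b

    product : card 𝓕 * card 𝓖 ≡ m * ((n ∸ t) + m)
    product = cong₂ _*_ card𝓕 card𝓖


module Inequalities where

  open NatFacts
  open import Data.Nat using (ℕ; suc; _+_; _*_; _∸_; _≤_; _<_; s≤s; _^_)
  open import Data.Nat.Properties
  open import Data.Product using (_×_)
  open import Relation.Binary.PropositionalEquality
  open import Data.Nat.Tactic.RingSolver using (solve-∀)

  Lᵢ : (n t s : ℕ) → ℕ
  Lᵢ n t s = suc (suc t * (n ∸ suc t)) + s

  Lᵢᵢ : (n t s : ℕ) → ℕ
  Lᵢᵢ n t s = suc (suc s) * ((n ∸ t) + suc (suc s))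

  Lᵢᵢ-tight : (n t s g d : ℕ) → g ≤ n ∸ t → d ≤ suc (suc s) → Lᵢᵢ n t s ≤ suc (suc s) * (g + d) →
    g ≡ n ∸ t × d ≡ suc (suc s)
  Lᵢᵢ-tight n t s g d g≤ d≤ Lᵢᵢ≤ = +-≤-tight g≤ d≤ (*-cancelˡ-≤ (suc (suc s)) Lᵢᵢ≤)

  -- With a = t − 1, b = s − 1 and r = n − 5s(t+1)², X a b r = n − t and X⁻ a b r = n − t − 1. Each inequality
  -- below is certified by an identity lhs + 1 + slack ≡ rhs whose slack has nonnegative coefficients.
  X X⁻ : ℕ → ℕ → ℕ → ℕ
  X  a b r = 5 * a * a + 19 * a + 19 + 5 * b * (a + 2) * (a + 2) + r
  X⁻ a b r = 5 * a * a + 19 * a + 18 + 5 * b * (a + 2) * (a + 2) + r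

  private
    n≡ : ∀ a b r →
      5 * suc b * (suc (suc a) * (suc (suc a) * 1)) + r ≡
      suc a + (5 * a * a + 19 * a + 19 + 5 * b * (a + 2) * (a + 2) + r)
    n≡ = solve-∀

    n≡′ : ∀ a b r →
      5 * suc b * (suc (suc a) * (suc (suc a) * 1)) + r ≡
      suc (suc a) + (5 * a * a + 19 * a + 18 + 5 * b * (a + 2) * (a + 2) + r)
    n≡′ = solve-∀

    room-certificate : ∀ a b r →
      suc a + suc b + 3 + (15 + r + 19 * b + 19 * a + 20 * a * b + 5 * a * a + 5 * a * a * b) ≡
      5 * suc b * (suc (suc a) * (suc (suc a) * 1)) + r
    room-certificate = solve-∀

    Lᵢ<Lᵢᵢ-certificate : ∀ a b r →
      suc (suc (suc (suc (suc b)) * (5 * a * a + 19 * a + 18 + 5 * b * (a + 2) * (a + 2) + r)) + suc b +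
        (b * b + 6 * b + 9)) ≡
      suc (suc (suc b)) * ((5 * a * a + 19 * a + 19 + 5 * b * (a + 2) * (a + 2) + r) + suc (suc (suc b)))
    Lᵢ<Lᵢᵢ-certificate = solve-∀

    Lᵢᵢ<Lᵢ-certificate : ∀ b k r →
      suc (suc (suc (suc b)) *
             ((5 * (b + 2 + k) * (b + 2 + k) + 19 * (b + 2 + k) + 19 + 5 * b * (b + 2 + k + 2) * (b + 2 + k + 2) + r) +
              suc (suc (suc b))) +
        (65 + r + 115 * k + k * r + 44 * k * k + 5 * k * k * k + 113 * b + 169 * b * k + 55 * b * k * k +
         5 * b * k * k * k + 44 * b * b + 55 * b * b * k + 10 * b * b * k * k + 5 * b * b * b + 5 * b * b * b * k)) ≡
      suc (suc (suc (b + 2 + k)) *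
             (5 * (b + 2 + k) * (b + 2 + k) + 19 * (b + 2 + k) + 18 + 5 * b * (b + 2 + k + 2) * (b + 2 + k + 2) + r)) +
        suc b
    Lᵢᵢ<Lᵢ-certificate = solve-∀

    [2s+6]²-certificate : ∀ a b r →
      suc ((suc b + suc b + 6) * (suc b + suc b + 6) +
        (1 + 3 * r + 53 * b + b * r + 17 * b * b + 57 * a + 79 * a * b + 20 * a * b * b + 15 * a * a +
         20 * a * a * b + 5 * a * a * b * b)) ≡
      suc (suc (suc b)) * ((5 * a * a + 19 * a + 19 + 5 * b * (a + 2) * (a + 2) + r) + suc (suc (suc b)))
    [2s+6]²-certificate = solve-∀

    [t+3s+2]²-certificate : ∀ a b r →
      suc ((suc (suc (suc a)) + 3 * suc b) * (suc (suc (suc a)) + 3 * suc b) +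
        (29 + 3 * r + 49 * b + b * r + 12 * b * b + 45 * a + 73 * a * b + 20 * a * b * b + 14 * a * a +
         20 * a * a * b + 5 * a * a * b * b)) ≡
      suc (suc (suc b)) * ((5 * a * a + 19 * a + 19 + 5 * b * (a + 2) * (a + 2) + r) + suc (suc (suc b)))
    [t+3s+2]²-certificate = solve-∀

    2[X+2s+t]-certificate : ∀ a b r →
      suc (2 * ((5 * a * a + 19 * a + 19 + 5 * b * (a + 2) * (a + 2) + r) + (suc b + suc b + suc a)) +
        (21 + r + 41 * b + b * r + 21 * b * b + 17 * a + 39 * a * b + 20 * a * b * b + 5 * a * a +
         10 * a * a * b + 5 * a * a * b * b)) ≡
      suc (suc (suc b)) * ((5 * a * a + 19 * a + 19 + 5 * b * (a + 2) * (a + 2) + r) + suc (suc (suc b)))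
    2[X+2s+t]-certificate = solve-∀

    f[X+d]-certificate : ∀ a c e r →
      suc ((c + 3) * (5 * a * a + 19 * a + 19 + 5 * (c + 1 + e) * (a + 2) * (a + 2) + r) * (c + 1) +
           (c + 3) * ((c + 3) * suc (c + 1 + e)) +
        (36 + r + 58 * e + e * r + 21 * e * e + 62 * c + c * r + 83 * c * e + c * e * r + 21 * c * e * e + 21 * c * c +
         21 * c * c * e + 39 * a + 59 * a * e + 20 * a * e * e + 59 * a * c + 79 * a * c * e + 20 * a * c * e * e +
         20 * a * c * c + 20 * a * c * c * e + 10 * a * a + 15 * a * a * e + 5 * a * a * e * e + 15 * a * a * c +
         20 * a * a * c * e + 5 * a * a * c * e * e + 5 * a * a * c * c + 5 * a * a * c * c * e)) ≡
      suc (suc (suc (c + 1 + e))) *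
        ((5 * a * a + 19 * a + 19 + 5 * (c + 1 + e) * (a + 2) * (a + 2) + r) + suc (suc (suc (c + 1 + e)))) * (c + 1)
    f[X+d]-certificate = solve-∀

    ≤-by : ∀ {x y} k → x + k ≡ y → x ≤ y
    ≤-by {x} k x+k≡y = subst (x ≤_) x+k≡y (m≤m+n x k)

    <-by : ∀ {x y} k → suc (x + k) ≡ y → x < y
    <-by {x} k 1+x+k≡y = subst (x <_) 1+x+k≡y (s≤s (m≤m+n x k))

  module _ (N a b : ℕ) (large : 5 * suc b * (suc (suc a) ^ 2) ≤ suc N) where

    private
      n t s m r : ℕ
      n = suc N
      t = suc a
      s = suc b
      m = suc (suc s)
      r = n ∸ 5 * s * (suc t ^ 2)

      n≡5s[t+1]²+r : n ≡ 5 * s * (suc t * (suc t * 1)) + r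
      n≡5s[t+1]²+r = sym (m+[n∸m]≡n large)

      n∸t≡ : n ∸ t ≡ X a b r
      n∸t≡ = trans (cong (_∸ t) (trans n≡5s[t+1]²+r (n≡ a b r))) (m+n∸m≡n t (X a b r))

      n∸[1+t]≡ : n ∸ suc t ≡ X⁻ a b r
      n∸[1+t]≡ = trans (cong (_∸ suc t) (trans n≡5s[t+1]²+r (n≡′ a b r))) (m+n∸m≡n (suc t) (X⁻ a b r))

      Lᵢᵢ≡ : Lᵢᵢ n t s ≡ m * (X a b r + m)
      Lᵢᵢ≡ = cong (λ x → m * (x + m)) n∸t≡

      Lᵢ≡ : Lᵢ n t s ≡ suc (suc t * X⁻ a b r) + s
      Lᵢ≡ = cong (λ x → suc (suc t * x) + s) n∸[1+t]≡

      <Lᵢᵢ-by : ∀ {x} k → suc (x + k) ≡ m * (X a b r + m) → x < Lᵢᵢ n t s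
      <Lᵢᵢ-by {x} k certificate = subst (x <_) (sym Lᵢᵢ≡) (<-by k certificate)

    room : t + s + 3 ≤ n
    room = ≤-by _ (trans (room-certificate a b r) (sym n≡5s[t+1]²+r))

    Lᵢ<Lᵢᵢ : t ≤ s + 1 → Lᵢ n t s < Lᵢᵢ n t s
    Lᵢ<Lᵢᵢ t≤s+1 = subst₂ _<_ (sym Lᵢ≡) (sym Lᵢᵢ≡) (begin-strict
      suc (suc t * X⁻ a b r) + s          ≤⟨ +-monoˡ-≤ s (s≤s (*-monoˡ-≤ (X⁻ a b r) 1+t≤2+s)) ⟩
      suc (suc (suc s) * X⁻ a b r) + s    <⟨ <-by _ (Lᵢ<Lᵢᵢ-certificate a b r) ⟩
      m * (X a b r + m)                   ∎)
      where
      open ≤-Reasoning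
      1+t≤2+s : suc t ≤ suc (suc s)
      1+t≤2+s = s≤s (≤-trans t≤s+1 (≤-reflexive (+-comm s 1)))

    Lᵢᵢ<Lᵢ : s + 2 ≤ t → Lᵢᵢ n t s < Lᵢ n t s
    Lᵢᵢ<Lᵢ s+2≤t = subst₂ _<_ (sym Lᵢᵢ≡) (sym Lᵢ≡)
      (subst (λ a → m * (X a b r + m) < suc (suc (suc a) * X⁻ a b r) + s) (sym a≡b+2+k)
             (<-by _ (Lᵢᵢ<Lᵢ-certificate b k r)))
      where
      k = a ∸ (b + 2)
      a≡b+2+k : a ≡ b + 2 + k
      a≡b+2+k = sym (m+[n∸m]≡n (≤-pred s+2≤t))

    [2s+6]²<Lᵢᵢ : ∀ g → g ≤ s + s + 6 → g * g < Lᵢᵢ n t s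
    [2s+6]²<Lᵢᵢ g g≤ = ≤-<-trans (*-mono-≤ g≤ g≤) (<Lᵢᵢ-by _ ([2s+6]²-certificate a b r))

    [t+3s+2]²<Lᵢᵢ : ∀ g → g ≤ suc (suc t) + 3 * s → g * g < Lᵢᵢ n t s
    [t+3s+2]²<Lᵢᵢ g g≤ = ≤-<-trans (*-mono-≤ g≤ g≤) (<Lᵢᵢ-by _ ([t+3s+2]²-certificate a b r))

    2[X+2s+t]<Lᵢᵢ : ∀ g d → g ≤ n ∸ t → d ≤ s + s + t → 2 * (g + d) < Lᵢᵢ n t s
    2[X+2s+t]<Lᵢᵢ g d g≤ d≤ = ≤-<-trans (*-monoʳ-≤ 2 (+-mono-≤ (≤-trans g≤ (≤-reflexive n∸t≡)) d≤))
      (<Lᵢᵢ-by _ (2[X+2s+t]-certificate a b r))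

    f[X+d]<Lᵢᵢ : ∀ f g d → 3 ≤ f → f ≤ s + 1 → g ≤ n ∸ t → d * (f ∸ 2) ≤ f * s → f * (g + d) < Lᵢᵢ n t s
    f[X+d]<Lᵢᵢ f g d 3≤f f≤s+1 g≤ d[f∸2]≤fs = subst (f * (g + d) <_) (sym Lᵢᵢ≡)
      (subst₂ (λ f b → d * (f ∸ 2) ≤ f * suc b → f * (g + d) < suc (suc (suc b)) * (X a b r + suc (suc (suc b))))
              (sym f≡c+3) (sym b≡c+1+e) bound d[f∸2]≤fs)
      where
      c = f ∸ 3
      f≡c+3 : f ≡ c + 3
      f≡c+3 = trans (sym (m+[n∸m]≡n 3≤f)) (+-comm 3 c)
      c+1≤b : c + 1 ≤ b
      c+1≤b = +-cancelʳ-≤ 2 (c + 1) b (begin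
        c + 1 + 2   ≡⟨ trans (+-assoc c 1 2) (sym f≡c+3) ⟩
        f           ≤⟨ f≤s+1 ⟩
        s + 1       ≡⟨ trans (+-comm s 1) (+-comm 2 b) ⟩
        b + 2       ∎)
        where open ≤-Reasoning
      e = b ∸ (c + 1)
      b≡c+1+e : b ≡ c + 1 + e
      b≡c+1+e = sym (m+[n∸m]≡n c+1≤b)
      g≤X : g ≤ X a (c + 1 + e) r
      g≤X = ≤-trans g≤ (≤-reflexive (trans n∸t≡ (cong (λ b → X a b r) b≡c+1+e)))
      bound : d * (c + 3 ∸ 2) ≤ (c + 3) * suc (c + 1 + e) →
        (c + 3) * (g + d) < suc (suc (suc (c + 1 + e))) * (X a (c + 1 + e) r + suc (suc (suc (c + 1 + e))))
      bound d[f∸2]≤ = *-cancelʳ-< (c + 1) _ _ (begin-strict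
        (c + 3) * (g + d) * (c + 1)
          ≡⟨ distrib (c + 3) g d c ⟩
        (c + 3) * g * (c + 1) + (c + 3) * (d * (c + 1))
          ≤⟨ +-mono-≤ (*-monoˡ-≤ (c + 1) (*-monoʳ-≤ (c + 3) g≤X)) (*-monoʳ-≤ (c + 3) d[c+1]≤) ⟩
        (c + 3) * X a (c + 1 + e) r * (c + 1) + (c + 3) * ((c + 3) * suc (c + 1 + e))
          <⟨ <-by _ (f[X+d]-certificate a c e r) ⟩
        suc (suc (suc (c + 1 + e))) * (X a (c + 1 + e) r + suc (suc (suc (c + 1 + e)))) * (c + 1)
          ∎)
        where
        open ≤-Reasoning
        distrib : ∀ f g d c → f * (g + d) * (c + 1) ≡ f * g * (c + 1) + f * (d * (c + 1))
        distrib = solve-∀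
        d[c+1]≤ : d * (c + 1) ≤ (c + 3) * suc (c + 1 + e)
        d[c+1]≤ = subst (λ x → d * x ≤ (c + 3) * suc (c + 1 + e)) (trans (cong (_∸ 2) (sym (+-assoc c 1 2))) (m+n∸n≡m (c + 1) 2))
                        d[f∸2]≤


module Extremal where

  open import Defs
  open Counting
  open SubsetSize
  open NatFacts
  open Bounds
  open BigCapCup
  open Constructions
  open Inequalities
  open import Data.Nat using (ℕ; suc; _+_; _*_; _∸_; _≤_; _<_; z≤n; s≤s; _≟_; _^_)
  open import Data.Nat.Properties
  open import Data.Bool using (Bool; true; false; _∧_; not)
  open import Data.Bool.Properties using (∧-conicalˡ; ∧-conicalʳ; ∧-identityʳ; ∧-zeroʳ; not-injective)
  open import Data.Fin using (Fin)
  open import Data.Fin.Subset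
  open import Data.Fin.Subset.Properties
  open import Data.Product using (Σ; Σ-syntax; _×_; _,_; proj₁; proj₂)
  open import Data.Sum using (inj₁; inj₂)
  open import Data.Empty using (⊥-elim)
  open import Relation.Binary.PropositionalEquality
  open import Relation.Nullary using (¬_; yes; no; contradiction)
  open import Relation.Nullary.Decidable using (⌊_⌋)

  ConclusionI : (n t s : ℕ) → Family n → Family n → Set
  ConclusionI n t s 𝓕 𝓖 = Σ[ Y ∈ Subset n ] Σ[ 𝓒 ∈ Family n ]
    ∣ Y ∣ ≡ suc t × card 𝓒 ≡ s × 𝓒 ⊆F (Binom (suc t) ∖F M₁ Y (suc t) t) ×
    𝓕 ≐ Single Y × 𝓖 ≐ (M₁ Y (suc t) t ∪F 𝓒)

  ConclusionII : (n t s : ℕ) → Family n → Family n → Set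
  ConclusionII n t s 𝓕 𝓖 = Σ[ Z ∈ Subset n ] Σ[ W ∈ Subset n ] Σ[ 𝓓 ∈ Family n ]
    ∣ Z ∣ ≡ t + s + 2 × W ⊆ Z × ∣ W ∣ ≡ t × card 𝓓 ≡ s + 2 × 𝓓 ⊆F M₂ Z W t ×
    (∀ (x : Fin n) → x ∈ Z → x ∉ W → containCount x 𝓓 ≡ 2) ×
    𝓕 ≐ H₁ Z W (suc t) × 𝓖 ≐ (H₁ ⊤ W (suc t) ∪F 𝓓)

  module Classification (N t′ s′ : ℕ) (𝓕 𝓖 : Family (suc N))
    (admissible : Admissible (suc N) (suc t′) (suc s′) 𝓕 𝓖)
    (maximal : ∀ 𝓕′ 𝓖′ → Admissible (suc N) (suc t′) (suc s′) 𝓕′ 𝓖′ → card 𝓕′ * card 𝓖′ ≤ card 𝓕 * card 𝓖)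
    (large : 5 * suc s′ * (suc (suc t′) ^ 2) ≤ suc N) where

    n t s m P : ℕ
    n = suc N
    t = suc t′
    s = suc s′
    m = suc (suc s)
    P = card 𝓕 * card 𝓖

    𝓕-uniform : Uniform (suc t) 𝓕
    𝓕-uniform = proj₁ admissible

    𝓖-uniform : Uniform (suc t) 𝓖
    𝓖-uniform = proj₁ (proj₂ admissible)

    𝓕-side : ∀ A → A ∈F 𝓕 → disjCount t A 𝓖 ≤ s
    𝓕-side = proj₁ (proj₁ (proj₂ (proj₂ admissible)))

    𝓖-side : ∀ B → B ∈F 𝓖 → disjCount t B 𝓕 ≤ s
    𝓖-side = proj₂ (proj₁ (proj₂ (proj₂ admissible)))

    ∣⋂∣<t : ∣ bigCap (𝓕 ∪F 𝓖) ∣ < t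
    ∣⋂∣<t = proj₁ (proj₂ (proj₂ (proj₂ admissible)))

    card𝓕≤card𝓖 : card 𝓕 ≤ card 𝓖
    card𝓕≤card𝓖 = proj₂ (proj₂ (proj₂ (proj₂ admissible)))

    Lᵢ≤P : Lᵢ n t s ≤ P
    Lᵢ≤P = subst (_≤ P) C.product (maximal C.𝓕 C.𝓖 C.admissible)
      where module C = SingletonConstruction N t′ s (s≤s z≤n) (room N t′ s′ large)

    Lᵢᵢ≤P : Lᵢᵢ n t s ≤ P
    Lᵢᵢ≤P = subst (_≤ P) C.product (maximal C.𝓕 C.𝓖 C.admissible)
      where module C = CycleConstruction N t′ s (s≤s z≤n) (room N t′ s′ large)

    P≤card𝓖² : P ≤ card 𝓖 * card 𝓖
    P≤card𝓖² = *-monoˡ-≤ (card 𝓖) card𝓕≤card𝓖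

    Conclusion : Set
    Conclusion = (s + 2 ≤ t → ConclusionI n t s 𝓕 𝓖) × (t ≤ s + 1 → ConclusionII n t s 𝓕 𝓖)

    P≮Lᵢᵢ : ¬ P < Lᵢᵢ n t s
    P≮Lᵢᵢ = ≤⇒≯ Lᵢᵢ≤P

    Disjoint : Subset n → Family n
    Disjoint A = tDisjoint? t A

    meets : ∀ A B → Disjoint A B ≡ false → t ≤ ∣ B ∩ A ∣
    meets A B A∩̸B = subst (t ≤_) (∣p∩q∣≡∣q∩p∣ A B) (tIntersecting⁻ t A B A∩̸B)

    card𝓕≢0 : ¬ card 𝓕 ≡ 0
    card𝓕≢0 card𝓕≡0 = P≮Lᵢᵢ (subst (_< Lᵢᵢ n t s) (sym (cong (_* card 𝓖) card𝓕≡0)) 0<Lᵢᵢ)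
      where
      0<Lᵢᵢ : 0 < Lᵢᵢ n t s
      0<Lᵢᵢ = ≤-trans (s≤s z≤n) (≤-trans (m≤n+m m (n ∸ t)) (m≤m+n (n ∸ t + m) _))

    module OneMember (A₁ : Subset n) (A₁∈ : A₁ ∈F 𝓕) (card𝓕≡1 : card 𝓕 ≡ 1) where

      𝓜 𝓒 : Family n
      𝓜 = M₁ A₁ (suc t) t
      𝓒 = 𝓖 ∖F 𝓜

      ∣A₁∣≡ : ∣ A₁ ∣ ≡ suc t
      ∣A₁∣≡ = 𝓕-uniform A₁ A₁∈

      card𝓒≤s : card 𝓒 ≤ s
      card𝓒≤s = ≤-trans (card-mono 𝓒 (𝓖 ∩F Disjoint A₁) 𝓒⊆) (𝓕-side A₁ A₁∈)
        where
        𝓒⊆ : 𝓒 ⊆F (𝓖 ∩F Disjoint A₁)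
        𝓒⊆ B B∈ = ∧-true B∈𝓖 (tDisjoint⁺ t A₁ B (subst (_< t) (∣p∩q∣≡∣q∩p∣ B A₁)
          (M₁-∉⁻ A₁ (suc t) t B (𝓖-uniform B B∈𝓖) (not-injective (∧-conicalʳ (𝓖 B) _ B∈)))))
          where B∈𝓖 = ∧-conicalˡ (𝓖 B) _ B∈

      card𝓖∩𝓜≤card𝓜 : card (𝓖 ∩F 𝓜) ≤ card 𝓜
      card𝓖∩𝓜≤card𝓜 = card-mono (𝓖 ∩F 𝓜) 𝓜 (λ B B∈ → ∧-conicalʳ (𝓖 B) _ B∈)

      P≡card𝓖 : P ≡ card 𝓖
      P≡card𝓖 = trans (cong (_* card 𝓖) card𝓕≡1) (*-identityˡ _)

      card𝓖≡ : card 𝓖 ≡ card (𝓖 ∩F 𝓜) + card 𝓒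
      card𝓖≡ = card-split 𝓖 𝓜

      card𝓜≡ : card 𝓜 ≡ suc (suc t * (n ∸ suc t))
      card𝓜≡ = card-M₁ A₁ t ∣A₁∣≡

      P≤Lᵢ : P ≤ Lᵢ n t s
      P≤Lᵢ = begin
        P                                ≡⟨ trans P≡card𝓖 card𝓖≡ ⟩
        card (𝓖 ∩F 𝓜) + card 𝓒           ≤⟨ +-mono-≤ card𝓖∩𝓜≤card𝓜 card𝓒≤s ⟩
        card 𝓜 + s                       ≡⟨ cong (_+ s) card𝓜≡ ⟩
        Lᵢ n t s                          ∎
        where open ≤-Reasoning

      tight : card (𝓖 ∩F 𝓜) ≡ card 𝓜 × card 𝓒 ≡ s
      tight = +-≤-tight card𝓖∩𝓜≤card𝓜 card𝓒≤s (begin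
        card 𝓜 + s                       ≡⟨ cong (_+ s) card𝓜≡ ⟩
        Lᵢ n t s                          ≤⟨ Lᵢ≤P ⟩
        P                                ≡⟨ trans P≡card𝓖 card𝓖≡ ⟩
        card (𝓖 ∩F 𝓜) + card 𝓒           ∎)
        where open ≤-Reasoning

      𝓜⊆𝓖 : 𝓜 ⊆F 𝓖
      𝓜⊆𝓖 B B∈ = ∧-conicalˡ (𝓖 B) _ (card-≥⇒⊇ (𝓖 ∩F 𝓜) 𝓜 (λ C C∈ → ∧-conicalʳ (𝓖 C) _ C∈)
                                        (≤-reflexive (sym (proj₁ tight))) B B∈)

      conclusion : Conclusion
      conclusion = conclusionI , conclusionII
        where
        conclusionI : s + 2 ≤ t → ConclusionI n t s 𝓕 𝓖
        conclusionI _ = A₁ , 𝓒 , ∣A₁∣≡ , proj₂ tight , 𝓒⊆ , card≡1⇒≐Single 𝓕 A₁ card𝓕≡1 A₁∈ ,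
                        ≐-∪∖ 𝓖 𝓜 𝓜 𝓜⊆𝓖 (λ _ _ → refl)
          where
          𝓒⊆ : 𝓒 ⊆F (Binom (suc t) ∖F 𝓜)
          𝓒⊆ B B∈ = ∧-true (⌊⌋-true (∣ B ∣ ≟ suc t) (𝓖-uniform B (∧-conicalˡ (𝓖 B) _ B∈))) (∧-conicalʳ (𝓖 B) _ B∈)
        conclusionII : t ≤ s + 1 → ConclusionII n t s 𝓕 𝓖
        conclusionII t≤s+1 = contradiction (≤-trans Lᵢᵢ≤P P≤Lᵢ) (<⇒≱ (Lᵢ<Lᵢᵢ N t′ s′ large t≤s+1))

    tDisjoint-pair⇒P<Lᵢᵢ : ∀ A A′ → A ∈F 𝓕 → A′ ∈F 𝓕 → ∣ A ∩ A′ ∣ < t → P < Lᵢᵢ n t s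
    tDisjoint-pair⇒P<Lᵢᵢ A A′ A∈ A′∈ ∣A∩A′∣<t = ≤-<-trans P≤card𝓖² ([2s+6]²<Lᵢᵢ N t′ s′ large (card 𝓖) card𝓖≤2s+6)
      where
      𝓖₁ 𝓖₂ 𝓖₃ : Family n
      𝓖₁ = 𝓖 ∖F Disjoint A
      𝓖₂ = 𝓖₁ ∩F Disjoint A′
      𝓖₃ = 𝓖₁ ∖F Disjoint A′
      card𝓖₂≤s : card 𝓖₂ ≤ s
      card𝓖₂≤s = ≤-trans (card-mono 𝓖₂ (𝓖 ∩F Disjoint A′)
        (λ B B∈ → ∧-true (∧-conicalˡ (𝓖 B) _ (∧-conicalˡ (𝓖₁ B) _ B∈)) (∧-conicalʳ (𝓖₁ B) _ B∈))) (𝓕-side A′ A′∈)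
      card𝓖₃≤6 : card 𝓖₃ ≤ 6
      card𝓖₃≤6 = tIntersecting-pair-bound-tDisjoint 𝓖₃ A A′ t′ (𝓕-uniform A A∈) (𝓕-uniform A′ A′∈) (≤-pred ∣A∩A′∣<t)
        (λ B B∈ → let B∈𝓖₁ = ∧-conicalˡ (𝓖₁ B) _ B∈ in
          𝓖-uniform B (∧-conicalˡ (𝓖 B) _ B∈𝓖₁) ,
          meets A B (not-injective (∧-conicalʳ (𝓖 B) _ B∈𝓖₁)) ,
          meets A′ B (not-injective (∧-conicalʳ (𝓖₁ B) _ B∈)))
      card𝓖≤2s+6 : card 𝓖 ≤ s + s + 6
      card𝓖≤2s+6 = begin
        card 𝓖
          ≡⟨ card-split 𝓖 (Disjoint A) ⟩
        card (𝓖 ∩F Disjoint A) + card 𝓖₁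
          ≡⟨ cong (card (𝓖 ∩F Disjoint A) +_) (card-split 𝓖₁ (Disjoint A′)) ⟩
        card (𝓖 ∩F Disjoint A) + (card 𝓖₂ + card 𝓖₃)
          ≤⟨ +-mono-≤ (𝓕-side A A∈) (+-mono-≤ card𝓖₂≤s card𝓖₃≤6) ⟩
        s + (s + 6)
          ≡⟨ +-assoc s s 6 ⟨
        s + s + 6
          ∎
        where open ≤-Reasoning

    double-counting-bound : (𝓓 : Family n) → 𝓓 ⊆F 𝓖 → (c : ℕ) → (∀ B → B ∈F 𝓓 → c ≤ disjCount t B 𝓕) →
      card 𝓓 * c ≤ card 𝓕 * s
    double-counting-bound 𝓓 𝓓⊆𝓖 c c≤ = begin
      card 𝓓 * c                           ≤⟨ ∑F-≥ 𝓓 (λ B → disjCount t B 𝓕) c c≤ ⟩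
      ∑[ B ∈ 𝓓 ] disjCount t B 𝓕           ≤⟨ ∑F-monoˡ 𝓓 𝓖 (λ B → disjCount t B 𝓕) 𝓓⊆𝓖 ⟩
      ∑[ B ∈ 𝓖 ] disjCount t B 𝓕           ≡⟨ ∑-disjCount-comm t 𝓕 𝓖 ⟨
      ∑[ A ∈ 𝓕 ] disjCount t A 𝓖           ≤⟨ ∑F-≤ 𝓕 (λ A → disjCount t A 𝓖) s 𝓕-side ⟩
      card 𝓕 * s                           ∎
      where open ≤-Reasoning

    few-meetings⇒many-disjoint : ∀ B → card (𝓕 ∖F Disjoint B) ≤ 2 → card 𝓕 ∸ 2 ≤ disjCount t B 𝓕
    few-meetings⇒many-disjoint B ≤2 = m≤n+2⇒m∸2≤n (card 𝓕) (disjCount t B 𝓕)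
      (≤-trans (≤-reflexive (card-split 𝓕 (Disjoint B))) (+-monoʳ-≤ (disjCount t B 𝓕) ≤2))

    module IntersectingFamily (A₁ A₂ : Subset n) (A₁∈ : A₁ ∈F 𝓕) (A₂∈ : A₂ ∈F 𝓕) (A₁≢A₂ : ¬ A₁ ≡ A₂)
      (pairwise : ∀ A A′ → A ∈F 𝓕 → A′ ∈F 𝓕 → t ≤ ∣ A ∩ A′ ∣) where

      W : Subset n
      W = A₁ ∩ A₂

      ∣W∣≡t : ∣ W ∣ ≡ t
      ∣W∣≡t = ≤-antisym (p≢q⇒∣p∩q∣≤k (𝓕-uniform A₁ A₁∈) (𝓕-uniform A₂ A₂∈) A₁≢A₂) (pairwise A₁ A₂ A₁∈ A₂∈)

      W⊄⇒∣p∩W∣<t : ∀ B → ¬ W ⊆ B → ∣ B ∩ W ∣ < t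
      W⊄⇒∣p∩W∣<t B W⊄B = subst (∣ B ∩ W ∣ <_) ∣W∣≡t (q⊄p⇒∣p∩q∣<∣q∣ B W W⊄B)

      module NoCommonCore (A₃ : Subset n) (A₃∈ : A₃ ∈F 𝓕) (W⊄A₃ : ¬ W ⊆ A₃) where

        Z : Subset n
        Z = A₁ ∪ A₂

        ∣Z∣≡ : ∣ Z ∣ ≡ suc (suc t)
        ∣Z∣≡ = +-cancelʳ-≡ t _ _ (begin
          ∣ Z ∣ + t              ≡⟨ cong (∣ Z ∣ +_) ∣W∣≡t ⟨
          ∣ Z ∣ + ∣ W ∣          ≡⟨ ∣p∪q∣+∣p∩q∣≡∣p∣+∣q∣ A₁ A₂ ⟩
          ∣ A₁ ∣ + ∣ A₂ ∣        ≡⟨ cong₂ _+_ (𝓕-uniform A₁ A₁∈) (𝓕-uniform A₂ A₂∈) ⟩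
          suc t + suc t          ≡⟨ +-suc (suc t) t ⟩
          suc (suc t) + t        ∎)
          where open ≡-Reasoning

        W⊄⇒⊆Z : ∀ A → A ∈F 𝓕 → ¬ W ⊆ A → A ⊆ Z
        W⊄⇒⊆Z A A∈ W⊄A = ∣p∣≤∣p∩q∣⇒p⊆q A Z (subst (_≤ ∣ A ∩ Z ∣) (sym (𝓕-uniform A A∈))
          (t+t≤m+n⇒n<t⇒t<m t _ _ (begin
            t + t                           ≤⟨ +-mono-≤ (pairwise A A₁ A∈ A₁∈) (pairwise A A₂ A∈ A₂∈) ⟩
            ∣ A ∩ A₁ ∣ + ∣ A ∩ A₂ ∣         ≡⟨ inclusion-exclusion A A₁ A₂ ⟨
            ∣ A ∩ Z ∣ + ∣ A ∩ W ∣           ∎) (W⊄⇒∣p∩W∣<t A W⊄A)))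
          where open ≤-Reasoning

        𝓕⊆Z : ∀ A → A ∈F 𝓕 → A ⊆ Z
        𝓕⊆Z A A∈ with A ⊆? Z | W ⊆? A
        ... | yes A⊆Z | _       = A⊆Z
        ... | no A⊄Z  | no W⊄A  = ⊥-elim (A⊄Z (W⊄⇒⊆Z A A∈ W⊄A))
        -- A ⊇ W outside Z would satisfy A ∩ Z = W, so A and A₃ would be t-disjoint.
        ... | no A⊄Z  | yes W⊆A = contradiction (pairwise A A₃ A∈ A₃∈) (<⇒≱ (≤-<-trans ∣A∩A₃∣≤∣W∩A₃∣ ∣W∩A₃∣<t))
          where
          A₃⊆Z = W⊄⇒⊆Z A₃ A₃∈ W⊄A₃
          W≡A∩Z : W ≡ A ∩ Z
          W≡A∩Z = p⊆q⇒∣q∣≤∣p∣⇒p≡q (λ x∈W → x∈p∩q⁺ (W⊆A x∈W , p⊆p∪q A₂ (p∩q⊆p A₁ A₂ x∈W)))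
            (≤-trans (≤-pred (subst (∣ A ∩ Z ∣ <_) (𝓕-uniform A A∈) (p⊄q⇒∣p∩q∣<∣p∣ A Z A⊄Z))) (≤-reflexive (sym ∣W∣≡t)))
          ∣A∩A₃∣≤∣W∩A₃∣ : ∣ A ∩ A₃ ∣ ≤ ∣ W ∩ A₃ ∣
          ∣A∩A₃∣≤∣W∩A₃∣ = p⊆q⇒∣p∣≤∣q∣ (λ x∈ → let (x∈A , x∈A₃) = x∈p∩q⁻ A A₃ x∈ in
            x∈p∩q⁺ (subst (_ ∈_) (sym W≡A∩Z) (x∈p∩q⁺ (x∈A , A₃⊆Z x∈A₃)) , x∈A₃))
          ∣W∩A₃∣<t : ∣ W ∩ A₃ ∣ < t
          ∣W∩A₃∣<t = subst (∣ W ∩ A₃ ∣ <_) ∣W∣≡t (p⊄q⇒∣p∩q∣<∣p∣ W A₃ W⊄A₃)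

        3≤card𝓕 : 3 ≤ card 𝓕
        3≤card𝓕 = three-members⇒card≥3 𝓕 A₁ A₂ A₃ A₁∈ A₂∈ A₃∈ A₁≢A₂
          (λ A₃≡A₁ → W⊄A₃ (subst (W ⊆_) (sym A₃≡A₁) (p∩q⊆p A₁ A₂)))
          (λ A₃≡A₂ → W⊄A₃ (subst (W ⊆_) (sym A₃≡A₂) (p∩q⊆q A₁ A₂)))

        ⊆Z : Family n
        ⊆Z B = ⌊ B ⊆? Z ⌋

        card-inside : card (𝓖 ∩F ⊆Z) ≤ suc (suc t)
        card-inside = inside-bound (𝓖 ∩F ⊆Z) Z t ∣Z∣≡
          (λ B B∈ → ⌊⌋-true⁻¹ (B ⊆? Z) (∧-conicalʳ (𝓖 B) _ B∈) , 𝓖-uniform B (∧-conicalˡ (𝓖 B) _ B∈))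

        outside-disjoint : ∀ B → B ∈F (𝓖 ∖F ⊆Z) → card 𝓕 ∸ 2 ≤ disjCount t B 𝓕
        outside-disjoint B B∈ = few-meetings⇒many-disjoint B
          (tIntersecting-inside-bound (𝓕 ∖F Disjoint B) Z B t ∣Z∣≡ B⊄Z (𝓖-uniform B (∧-conicalˡ (𝓖 B) _ B∈))
            (λ A A∈ → let A∈𝓕 = ∧-conicalˡ (𝓕 A) _ A∈ in
              𝓕⊆Z A A∈𝓕 , 𝓕-uniform A A∈𝓕 , tIntersecting⁻ t B A (not-injective (∧-conicalʳ (𝓕 A) _ A∈))))
          where
          B⊄Z : ¬ B ⊆ Z
          B⊄Z = ⌊⌋-false⁻¹ (B ⊆? Z) (not-injective (∧-conicalʳ (𝓖 B) _ B∈))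

        card-outside : card (𝓖 ∖F ⊆Z) ≤ 3 * s
        card-outside = c[f∸2]≤fs⇒c≤3s _ (card 𝓕) s
          (double-counting-bound (𝓖 ∖F ⊆Z) (λ B B∈ → ∧-conicalˡ (𝓖 B) _ B∈) (card 𝓕 ∸ 2) outside-disjoint) 3≤card𝓕

        P<Lᵢᵢ : P < Lᵢᵢ n t s
        P<Lᵢᵢ = ≤-<-trans P≤card𝓖² ([t+3s+2]²<Lᵢᵢ N t′ s′ large (card 𝓖)
          (≤-trans (≤-reflexive (card-split 𝓖 ⊆Z)) (+-mono-≤ card-inside card-outside)))

      module CommonCore (2≤card𝓕 : 2 ≤ card 𝓕) (𝓕⊇W : ∀ A → A ∈F 𝓕 → W ⊆ A) where

        ⊇W 𝓖ᵂ 𝓓 𝓢 : Family n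
        ⊇W B = ⌊ W ⊆? B ⌋
        𝓖ᵂ = 𝓖 ∩F ⊇W
        𝓓 = 𝓖 ∖F ⊇W
        𝓢 = H₁ ⊤ W (suc t)

        𝓖ᵂ⊆𝓢 : 𝓖ᵂ ⊆F 𝓢
        𝓖ᵂ⊆𝓢 B B∈ = H₁⁺ B (λ _ → ∈⊤) (𝓖-uniform B (∧-conicalˡ (𝓖 B) _ B∈)) (⌊⌋-true⁻¹ (W ⊆? B) (∧-conicalʳ (𝓖 B) _ B∈))

        card𝓖ᵂ≤ : card 𝓖ᵂ ≤ n ∸ t
        card𝓖ᵂ≤ = ≤-trans (card-mono 𝓖ᵂ 𝓢 𝓖ᵂ⊆𝓢) (≤-reflexive (card-H₁-⊤ W t ∣W∣≡t))

        𝓓⊆𝓖 : 𝓓 ⊆F 𝓖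
        𝓓⊆𝓖 B B∈ = ∧-conicalˡ (𝓖 B) _ B∈

        𝓓∌W : ∀ B → B ∈F 𝓓 → ¬ W ⊆ B
        𝓓∌W B B∈ = ⌊⌋-false⁻¹ (W ⊆? B) (not-injective (∧-conicalʳ (𝓖 B) _ B∈))

        𝓓-meets≤2 : ∀ B → B ∈F 𝓓 → card (𝓕 ∖F Disjoint B) ≤ 2
        𝓓-meets≤2 B B∈ = tIntersecting-⊇W-bound (𝓕 ∖F Disjoint B) W B t ∣W∣≡t (𝓓∌W B B∈) (𝓖-uniform B (𝓓⊆𝓖 B B∈))
          (λ A A∈ → let A∈𝓕 = ∧-conicalˡ (𝓕 A) _ A∈ in
            𝓕⊇W A A∈𝓕 , 𝓕-uniform A A∈𝓕 , tIntersecting⁻ t B A (not-injective (∧-conicalʳ (𝓕 A) _ A∈)))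

        𝓓-disjoint : ∀ B → B ∈F 𝓓 → card 𝓕 ∸ 2 ≤ disjCount t B 𝓕
        𝓓-disjoint B B∈ = few-meetings⇒many-disjoint B (𝓓-meets≤2 B B∈)

        𝓓-nonempty : Σ[ B ∈ Subset n ] B ∈F 𝓓
        𝓓-nonempty with member-or-empty 𝓓
        ... | inj₁ B∈𝓓    = B∈𝓓
        ... | inj₂ card≡0 = contradiction ∣⋂∣<t (≤⇒≯ (begin
          t                       ≡⟨ ∣W∣≡t ⟨
          ∣ W ∣                   ≤⟨ p⊆q⇒∣p∣≤∣q∣ (⊆-bigCap (𝓕 ∪F 𝓖) W every⊇W) ⟩
          ∣ bigCap (𝓕 ∪F 𝓖) ∣     ∎))
          where
          open ≤-Reasoning
          every⊇W : ∀ A → A ∈F (𝓕 ∪F 𝓖) → W ⊆ A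
          every⊇W A A∈ with ∪F⁻ 𝓕 𝓖 A A∈
          ... | inj₁ A∈𝓕 = 𝓕⊇W A A∈𝓕
          ... | inj₂ A∈𝓖 with ⊇W A in A⊇W
          ...   | true  = ⌊⌋-true⁻¹ (W ⊆? A) A⊇W
          ...   | false = contradiction (trans (sym (card≡0⇒∉ 𝓓 card≡0 A)) (∧-true A∈𝓖 (cong not A⊇W))) λ ()

        card𝓕≤m : card 𝓕 ≤ m
        card𝓕≤m = let (B , B∈) = 𝓓-nonempty in
          ≤-trans (m≤n+m∸n (card 𝓕) 2) (+-monoʳ-≤ 2 (≤-trans (𝓓-disjoint B B∈) (𝓖-side B (𝓓⊆𝓖 B B∈))))

        𝓓-double-count : card 𝓓 * (card 𝓕 ∸ 2) ≤ card 𝓕 * s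
        𝓓-double-count = double-counting-bound 𝓓 𝓓⊆𝓖 (card 𝓕 ∸ 2) 𝓓-disjoint

        P≡ : P ≡ card 𝓕 * (card 𝓖ᵂ + card 𝓓)
        P≡ = cong (card 𝓕 *_) (card-split 𝓖 ⊇W)

        card𝓕≢2 : ¬ card 𝓕 ≡ 2
        card𝓕≢2 card𝓕≡2 = P≮Lᵢᵢ (begin-strict
          P                                ≡⟨ trans P≡ (cong (_* (card 𝓖ᵂ + card 𝓓)) card𝓕≡2) ⟩
          2 * (card 𝓖ᵂ + card 𝓓)           <⟨ 2[X+2s+t]<Lᵢᵢ N t′ s′ large (card 𝓖ᵂ) (card 𝓓) card𝓖ᵂ≤ card𝓓≤2s+t ⟩
          Lᵢᵢ n t s                        ∎)
          where
          open ≤-Reasoning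
          𝓓₁ 𝓓₂ 𝓓₃ : Family n
          𝓓₁ = 𝓓 ∖F Disjoint A₁
          𝓓₂ = 𝓓₁ ∩F Disjoint A₂
          𝓓₃ = 𝓓₁ ∖F Disjoint A₂
          card𝓓₃≤t : card 𝓓₃ ≤ t
          card𝓓₃≤t = tIntersecting-pair-bound-⊉core 𝓓₃ A₁ A₂ t′ (𝓕-uniform A₁ A₁∈) (𝓕-uniform A₂ A₂∈) ∣W∣≡t
            (λ B B∈ → let B∈𝓓₁ = ∧-conicalˡ (𝓓₁ B) _ B∈ ; B∈𝓓 = ∧-conicalˡ (𝓓 B) _ B∈𝓓₁ in
              𝓖-uniform B (𝓓⊆𝓖 B B∈𝓓) , 𝓓∌W B B∈𝓓 ,
              meets A₁ B (not-injective (∧-conicalʳ (𝓓 B) _ B∈𝓓₁)) ,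
              meets A₂ B (not-injective (∧-conicalʳ (𝓓₁ B) _ B∈)))
          disjoint-from : ∀ A → A ∈F 𝓕 → (𝓓′ : Family n) → 𝓓′ ⊆F 𝓓 → card (𝓓′ ∩F Disjoint A) ≤ s
          disjoint-from A A∈ 𝓓′ 𝓓′⊆𝓓 = ≤-trans (card-mono (𝓓′ ∩F Disjoint A) (𝓖 ∩F Disjoint A)
            (λ B B∈ → ∧-true (𝓓⊆𝓖 B (𝓓′⊆𝓓 B (∧-conicalˡ (𝓓′ B) _ B∈))) (∧-conicalʳ (𝓓′ B) _ B∈))) (𝓕-side A A∈)
          card𝓓≤2s+t : card 𝓓 ≤ s + s + t
          card𝓓≤2s+t = begin
            card 𝓓
              ≡⟨ card-split 𝓓 (Disjoint A₁) ⟩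
            card (𝓓 ∩F Disjoint A₁) + card 𝓓₁
              ≡⟨ cong (card (𝓓 ∩F Disjoint A₁) +_) (card-split 𝓓₁ (Disjoint A₂)) ⟩
            card (𝓓 ∩F Disjoint A₁) + (card 𝓓₂ + card 𝓓₃)
              ≤⟨ +-mono-≤ (disjoint-from A₁ A₁∈ 𝓓 (λ _ B∈ → B∈))
                          (+-mono-≤ (disjoint-from A₂ A₂∈ 𝓓₁ (λ B B∈ → ∧-conicalˡ (𝓓 B) _ B∈)) card𝓓₃≤t) ⟩
            s + (s + t)
              ≡⟨ +-assoc s s t ⟨
            s + s + t
              ∎

        card𝓕∉[3,s+1] : 3 ≤ card 𝓕 → ¬ card 𝓕 ≤ s + 1
        card𝓕∉[3,s+1] 3≤ ≤s+1 = P≮Lᵢᵢ (subst (_< Lᵢᵢ n t s) (sym P≡)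
          (f[X+d]<Lᵢᵢ N t′ s′ large (card 𝓕) (card 𝓖ᵂ) (card 𝓓) 3≤ ≤s+1 card𝓖ᵂ≤ 𝓓-double-count))

        module Saturated (card𝓕≡m : card 𝓕 ≡ m) where

          card𝓓≤m : card 𝓓 ≤ m
          card𝓓≤m = *-cancelʳ-≤ (card 𝓓) m s
            (subst₂ (λ a b → card 𝓓 * a ≤ b * s) (cong (_∸ 2) card𝓕≡m) card𝓕≡m 𝓓-double-count)

          P≡m[𝓖ᵂ+𝓓] : P ≡ m * (card 𝓖ᵂ + card 𝓓)
          P≡m[𝓖ᵂ+𝓓] = trans P≡ (cong (_* (card 𝓖ᵂ + card 𝓓)) card𝓕≡m)

          tight : card 𝓖ᵂ ≡ n ∸ t × card 𝓓 ≡ m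
          tight = Lᵢᵢ-tight n t s (card 𝓖ᵂ) (card 𝓓) card𝓖ᵂ≤ card𝓓≤m (subst (Lᵢᵢ n t s ≤_) P≡m[𝓖ᵂ+𝓓] Lᵢᵢ≤P)

          P≤Lᵢᵢ : P ≤ Lᵢᵢ n t s
          P≤Lᵢᵢ = subst (_≤ Lᵢᵢ n t s) (sym P≡m[𝓖ᵂ+𝓓]) (*-monoʳ-≤ m (+-mono-≤ card𝓖ᵂ≤ card𝓓≤m))

          Z : Subset n
          Z = bigCup 𝓕

          W⊆Z : W ⊆ Z
          W⊆Z x∈W = ⊆-bigCup 𝓕 A₁ A₁∈ (p∩q⊆p A₁ A₂ x∈W)

          𝓕≐H₁ : 𝓕 ≐ H₁ Z W (suc t)
          𝓕≐H₁ B = bool-ext _ _ to from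
            where
            to : B ∈F 𝓕 → B ∈F H₁ Z W (suc t)
            to B∈ = H₁⁺ B (⊆-bigCup 𝓕 B B∈) (𝓕-uniform B B∈) (𝓕⊇W B B∈)
            from : B ∈F H₁ Z W (suc t) → B ∈F 𝓕
            from B∈ = through (∣p∣≥1⇒nonempty (B ∩ ∁ W) (≤-reflexive (sym ∣B∖W∣≡1)))
              where
              B⊆Z = proj₁ (H₁⁻ Z W (suc t) B B∈)
              ∣B∣≡ = proj₁ (proj₂ (H₁⁻ Z W (suc t) B B∈))
              W⊆B = proj₂ (proj₂ (H₁⁻ Z W (suc t) B B∈))
              ∣B∖W∣≡1 : ∣ B ∩ ∁ W ∣ ≡ 1
              ∣B∖W∣≡1 = ∣p∩∁q∣≡1 B W ∣B∣≡ (trans (q⊆p⇒∣p∩q∣≡∣q∣ W⊆B) ∣W∣≡t)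
              through : Σ[ x ∈ Fin n ] x ∈ B ∩ ∁ W → B ∈F 𝓕
              through (x , x∈B∖W) = through′ (bigCup⁻ 𝓕 (B⊆Z (p∩q⊆p B (∁ W) x∈B∖W)))
                where
                through′ : Σ[ A ∈ Subset n ] A ∈F 𝓕 × x ∈ A → B ∈F 𝓕
                through′ (A , A∈ , x∈A) = subst (_∈F 𝓕) (sym B≡A) A∈
                  where
                  B⊆A : B ⊆ A
                  B⊆A {y} y∈B with y ∈? W
                  ... | yes y∈W = 𝓕⊇W A A∈ y∈W
                  ... | no y∉W  = subst (_∈ A) (∣p∣≤1⇒x≡y (≤-reflexive ∣B∖W∣≡1) x∈B∖W (x∈p∩q⁺ (y∈B , x∉p⇒x∈∁p y∉W))) x∈A
                  B≡A : B ≡ A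
                  B≡A = p⊆q⇒∣q∣≤∣p∣⇒p≡q B⊆A (≤-reflexive (trans (𝓕-uniform A A∈) (sym ∣B∣≡)))

          ∣Z∣≡ : ∣ Z ∣ ≡ t + s + 2
          ∣Z∣≡ = begin
            ∣ Z ∣              ≡⟨ m+[n∸m]≡n t≤∣Z∣ ⟨
            t + (∣ Z ∣ ∸ t)    ≡⟨ cong (t +_) ∣Z∣∸t≡m ⟩
            t + m              ≡⟨ trans (cong (t +_) (+-comm 2 s)) (sym (+-assoc t s 2)) ⟩
            t + s + 2          ∎
            where
            open ≡-Reasoning
            t≤∣Z∣ : t ≤ ∣ Z ∣
            t≤∣Z∣ = ≤-trans (≤-reflexive (sym ∣W∣≡t)) (p⊆q⇒∣p∣≤∣q∣ W⊆Z)
            ∣Z∣∸t≡m : ∣ Z ∣ ∸ t ≡ m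
            ∣Z∣∸t≡m = trans (sym (card-H₁ Z W t W⊆Z ∣W∣≡t)) (trans (sym (card-cong 𝓕 _ 𝓕≐H₁)) card𝓕≡m)

          𝓓-disjoint≡s : ∀ B → B ∈F 𝓓 → disjCount t B 𝓕 ≡ s
          𝓓-disjoint≡s B B∈ = ≤-antisym (𝓖-side B (𝓓⊆𝓖 B B∈))
            (subst (_≤ disjCount t B 𝓕) (cong (_∸ 2) card𝓕≡m) (𝓓-disjoint B B∈))

          𝓓-meets≡2 : ∀ B → B ∈F 𝓓 → card (𝓕 ∖F Disjoint B) ≡ 2
          𝓓-meets≡2 B B∈ = +-cancelˡ-≡ s _ _ (begin
            s + card (𝓕 ∖F Disjoint B)                          ≡⟨ cong (_+ card (𝓕 ∖F Disjoint B)) (𝓓-disjoint≡s B B∈) ⟨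
            card (𝓕 ∩F Disjoint B) + card (𝓕 ∖F Disjoint B)     ≡⟨ card-split 𝓕 (Disjoint B) ⟨
            card 𝓕                                              ≡⟨ trans card𝓕≡m (+-comm 2 s) ⟩
            s + 2                                               ∎)
            where open ≡-Reasoning

          𝓓-shape : ∀ B → B ∈F 𝓓 → B ⊆ Z × ∣ B ∩ W ∣ ≡ t′
          𝓓-shape B B∈ = through (card≥2⇒two-members (𝓕 ∖F Disjoint B) (≤-reflexive (sym (𝓓-meets≡2 B B∈))))
            where
            through : Σ[ A ∈ Subset n ] Σ[ A′ ∈ Subset n ] A ∈F (𝓕 ∖F Disjoint B) × A′ ∈F (𝓕 ∖F Disjoint B) × ¬ A ≡ A′ →
              B ⊆ Z × ∣ B ∩ W ∣ ≡ t′
            through (A , A′ , A∈ , A′∈ , A≢A′) = B⊆Z , trans (cong (λ K → ∣ B ∩ K ∣) W≡A∩A′) (proj₂ counts)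
              where
              A∈𝓕 = ∧-conicalˡ (𝓕 A) _ A∈
              A′∈𝓕 = ∧-conicalˡ (𝓕 A′) _ A′∈
              W≡A∩A′ : W ≡ A ∩ A′
              W≡A∩A′ = p⊆q⇒∣q∣≤∣p∣⇒p≡q (λ x∈W → x∈p∩q⁺ (𝓕⊇W A A∈𝓕 x∈W , 𝓕⊇W A′ A′∈𝓕 x∈W))
                (≤-trans (p≢q⇒∣p∩q∣≤k (𝓕-uniform A A∈𝓕) (𝓕-uniform A′ A′∈𝓕) A≢A′) (≤-reflexive (sym ∣W∣≡t)))
              counts : ∣ B ∩ (A ∪ A′) ∣ ≡ suc t × ∣ B ∩ (A ∩ A′) ∣ ≡ t′
              counts = tIntersecting-pair-counts A A′ B t′ (𝓖-uniform B (𝓓⊆𝓖 B B∈))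
                (tIntersecting⁻ t B A (not-injective (∧-conicalʳ (𝓕 A) _ A∈)))
                (tIntersecting⁻ t B A′ (not-injective (∧-conicalʳ (𝓕 A′) _ A′∈)))
                (subst (λ K → ∣ B ∩ K ∣ ≤ t′) W≡A∩A′ (≤-pred (W⊄⇒∣p∩W∣<t B (𝓓∌W B B∈))))
              B⊆Z : B ⊆ Z
              B⊆A∪A′ : B ⊆ A ∪ A′
              B⊆A∪A′ = ∣p∣≤∣p∩q∣⇒p⊆q B (A ∪ A′) (≤-reflexive (trans (𝓖-uniform B (𝓓⊆𝓖 B B∈)) (sym (proj₁ counts))))
              B⊆Z x∈B with x∈p∪q⁻ A A′ (B⊆A∪A′ x∈B)
              ... | inj₁ x∈A  = ⊆-bigCup 𝓕 A A∈𝓕 x∈A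
              ... | inj₂ x∈A′ = ⊆-bigCup 𝓕 A′ A′∈𝓕 x∈A′

          𝓓⊆M₂ : 𝓓 ⊆F M₂ Z W t
          𝓓⊆M₂ B B∈ = let (B⊆Z , ∣B∩W∣≡) = 𝓓-shape B B∈ in
            ∧-true (⌊⌋-true (B ⊆? Z) B⊆Z)
              (∧-true (⌊⌋-true (∣ B ∣ ≟ suc t) (𝓖-uniform B (𝓓⊆𝓖 B B∈))) (⌊⌋-true (∣ B ∩ W ∣ ≟ t′) ∣B∩W∣≡))

          𝓕-disjoint≡s : ∀ A → A ∈F 𝓕 → disjCount t A 𝓖 ≡ s
          𝓕-disjoint≡s = ∑F-tight 𝓕 (λ A → disjCount t A 𝓖) s (begin
            card 𝓕 * s                         ≡⟨ cong (_* s) (trans card𝓕≡m (sym (proj₂ tight))) ⟩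
            card 𝓓 * s                         ≤⟨ ∑F-≥ 𝓓 (λ B → disjCount t B 𝓕) s
                                                          (λ B B∈ → ≤-reflexive (sym (𝓓-disjoint≡s B B∈))) ⟩
            ∑[ B ∈ 𝓓 ] disjCount t B 𝓕         ≤⟨ ∑F-monoˡ 𝓓 𝓖 (λ B → disjCount t B 𝓕) 𝓓⊆𝓖 ⟩
            ∑[ B ∈ 𝓖 ] disjCount t B 𝓕         ≡⟨ ∑-disjCount-comm t 𝓕 𝓖 ⟨
            ∑[ A ∈ 𝓕 ] disjCount t A 𝓖         ∎) 𝓕-side
            where open ≤-Reasoning

          𝓓∩Disjoint≐𝓖∩Disjoint : ∀ A → W ⊆ A → (𝓓 ∩F Disjoint A) ≐ (𝓖 ∩F Disjoint A)
          𝓓∩Disjoint≐𝓖∩Disjoint A W⊆A B with ⊇W B in B⊇W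
          ... | false = cong (_∧ Disjoint A B) (∧-identityʳ (𝓖 B))
          ... | true  rewrite tIntersecting⁺ t A B (≤-trans (≤-reflexive (sym ∣W∣≡t))
                                (p⊆q⇒∣p∣≤∣q∣ (λ y∈W → x∈p∩q⁺ (W⊆A y∈W , ⌊⌋-true⁻¹ (W ⊆? B) B⊇W y∈W))))
            = trans (∧-zeroʳ _) (sym (∧-zeroʳ (𝓖 B)))

          𝓕-meets≡2 : ∀ A → A ∈F 𝓕 → card (𝓓 ∖F Disjoint A) ≡ 2
          𝓕-meets≡2 A A∈ = +-cancelˡ-≡ s _ _ (begin
            s + card (𝓓 ∖F Disjoint A)                          ≡⟨ cong (_+ card (𝓓 ∖F Disjoint A)) card-disjoint≡s ⟨
            card (𝓓 ∩F Disjoint A) + card (𝓓 ∖F Disjoint A)     ≡⟨ card-split 𝓓 (Disjoint A) ⟨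
            card 𝓓                                              ≡⟨ trans (proj₂ tight) (+-comm 2 s) ⟩
            s + 2                                               ∎)
            where
            open ≡-Reasoning
            card-disjoint≡s : card (𝓓 ∩F Disjoint A) ≡ s
            card-disjoint≡s = trans (card-cong _ _ (𝓓∩Disjoint≐𝓖∩Disjoint A (𝓕⊇W A A∈))) (𝓕-disjoint≡s A A∈)

          ∣A∩B∣≡t′+∣⁅x⁆∩B∣ : ∀ A x B → A ∈F 𝓕 → x ∈ A → x ∉ W → B ∈F 𝓓 → ∣ A ∩ B ∣ ≡ t′ + ∣ ⁅ x ⁆ ∩ B ∣
          ∣A∩B∣≡t′+∣⁅x⁆∩B∣ A x B A∈ x∈A x∉W B∈ = begin
            ∣ A ∩ B ∣                              ≡⟨ ∣p∩q∣+∣p∩∁q∣≡∣p∣ (A ∩ B) W ⟨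
            ∣ (A ∩ B) ∩ W ∣ + ∣ (A ∩ B) ∩ ∁ W ∣    ≡⟨ cong₂ _+_ ∣A∩B∩W∣≡ (cong ∣_∣ A∩B∖W≡) ⟩
            t′ + ∣ ⁅ x ⁆ ∩ B ∣                     ∎
            where
            open ≡-Reasoning
            W⊆A = 𝓕⊇W A A∈
            ⁅x⁆≡A∖W : ⁅ x ⁆ ≡ A ∩ ∁ W
            ⁅x⁆≡A∖W = p⊆q⇒∣q∣≤∣p∣⇒p≡q
              (λ y∈⁅x⁆ → subst (_∈ A ∩ ∁ W) (sym (x∈⁅y⁆⇒x≡y _ y∈⁅x⁆)) (x∈p∩q⁺ (x∈A , x∉p⇒x∈∁p x∉W)))
              (≤-reflexive (trans (∣p∩∁q∣≡1 A W (𝓕-uniform A A∈) (trans (q⊆p⇒∣p∩q∣≡∣q∣ W⊆A) ∣W∣≡t)) (sym (∣⁅x⁆∣≡1 x))))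
            ∣A∩B∩W∣≡ : ∣ (A ∩ B) ∩ W ∣ ≡ t′
            ∣A∩B∩W∣≡ = trans (cong ∣_∣ (trans (cong (_∩ W) (∩-comm A B)) (trans (∩-assoc B A W)
                         (cong (B ∩_) (trans (∩-comm A W) (p⊆q⇒p∩q≡p W⊆A)))))) (proj₂ (𝓓-shape B B∈))
            A∩B∖W≡ : (A ∩ B) ∩ ∁ W ≡ ⁅ x ⁆ ∩ B
            A∩B∖W≡ = begin
              (A ∩ B) ∩ ∁ W    ≡⟨ ∩-assoc A B (∁ W) ⟩
              A ∩ (B ∩ ∁ W)    ≡⟨ cong (A ∩_) (∩-comm B (∁ W)) ⟩
              A ∩ (∁ W ∩ B)    ≡⟨ ∩-assoc A (∁ W) B ⟨
              (A ∩ ∁ W) ∩ B    ≡⟨ cong (_∩ B) ⁅x⁆≡A∖W ⟨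
              ⁅ x ⁆ ∩ B        ∎

          contained-twice : ∀ x → x ∈ Z → x ∉ W → containCount x 𝓓 ≡ 2
          contained-twice x x∈Z x∉W = through (bigCup⁻ 𝓕 x∈Z)
            where
            ∋x : Family n
            ∋x B = ⌊ x ∈? B ⌋
            through : Σ[ A ∈ Subset n ] A ∈F 𝓕 × x ∈ A → containCount x 𝓓 ≡ 2
            through (A , A∈ , x∈A) = trans (sym (card-cong (𝓓 ∖F Disjoint A) (𝓓 ∩F ∋x) meets≐∋x)) (𝓕-meets≡2 A A∈)
              where
              meets≐∋x : (𝓓 ∖F Disjoint A) ≐ (𝓓 ∩F ∋x)
              meets≐∋x B with 𝓓 B in B∈
              ... | false = refl
              ... | true with x ∈? B
              ...   | yes x∈B = cong not (tIntersecting⁺ t A B (≤-reflexive (sym (trans ∣A∩B∣≡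
                                  (trans (cong (t′ +_) (∣⁅x⁆∩p∣≡1 B x x∈B)) (+-comm t′ 1))))))
                where ∣A∩B∣≡ = ∣A∩B∣≡t′+∣⁅x⁆∩B∣ A x B A∈ x∈A x∉W B∈
              ...   | no x∉B  = cong not (tDisjoint⁺ t A B (≤-reflexive (cong suc (trans ∣A∩B∣≡
                                  (trans (cong (t′ +_) (∣⁅x⁆∩p∣≡0 B x x∉B)) (+-identityʳ t′))))))
                where ∣A∩B∣≡ = ∣A∩B∣≡t′+∣⁅x⁆∩B∣ A x B A∈ x∈A x∉W B∈

          𝓖≐𝓢∪𝓓 : 𝓖 ≐ (𝓢 ∪F 𝓓)
          𝓖≐𝓢∪𝓓 = ≐-∪∖ 𝓖 𝓢 ⊇W 𝓢⊆𝓖 (λ B B∈ → ⊇W≡𝓢 B (𝓖-uniform B B∈))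
            where
            𝓢⊆𝓖 : 𝓢 ⊆F 𝓖
            𝓢⊆𝓖 B B∈ = ∧-conicalˡ (𝓖 B) _ (card-≥⇒⊇ 𝓖ᵂ 𝓢 𝓖ᵂ⊆𝓢 card𝓢≤card𝓖ᵂ B B∈)
              where
              card𝓢≤card𝓖ᵂ : card 𝓢 ≤ card 𝓖ᵂ
              card𝓢≤card𝓖ᵂ = ≤-reflexive (trans (card-H₁-⊤ W t ∣W∣≡t) (sym (proj₁ tight)))
            ⊇W≡𝓢 : ∀ B → ∣ B ∣ ≡ suc t → ⊇W B ≡ 𝓢 B
            ⊇W≡𝓢 B ∣B∣≡ = sym (cong₂ (λ a b → a ∧ (b ∧ ⊇W B)) (⌊⌋-true (B ⊆? ⊤) (λ _ → ∈⊤)) (⌊⌋-true (∣ B ∣ ≟ suc t) ∣B∣≡))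

          conclusion : Conclusion
          conclusion = (λ s+2≤t → contradiction (≤-trans Lᵢ≤P P≤Lᵢᵢ) (<⇒≱ (Lᵢᵢ<Lᵢ N t′ s′ large s+2≤t)))
                     , (λ _ → Z , W , 𝓓 , ∣Z∣≡ , W⊆Z , ∣W∣≡t , trans (proj₂ tight) (+-comm 2 s) , 𝓓⊆M₂ ,
                              contained-twice , 𝓕≐H₁ , 𝓖≐𝓢∪𝓓)

        conclusion : Conclusion
        conclusion with card 𝓕 ≟ m
        ... | yes card𝓕≡m = Saturated.conclusion card𝓕≡m
        ... | no card𝓕≢m with card 𝓕 ≟ 2
        ...   | yes card𝓕≡2 = ⊥-elim (card𝓕≢2 card𝓕≡2)
        ...   | no card𝓕≢2′ = ⊥-elim (card𝓕∉[3,s+1] (≤∧≢⇒< 2≤card𝓕 (λ 2≡ → card𝓕≢2′ (sym 2≡)))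
                                                     (≤-trans (≤-pred (≤∧≢⇒< card𝓕≤m card𝓕≢m)) (≤-reflexive (+-comm 1 s))))

      conclusion : 2 ≤ card 𝓕 → Conclusion
      conclusion 2≤card𝓕 with member-or-empty (𝓕 ∖F λ A → ⌊ W ⊆? A ⌋)
      ... | inj₁ (A₃ , A₃∈) = ⊥-elim (P≮Lᵢᵢ (NoCommonCore.P<Lᵢᵢ A₃ (∧-conicalˡ (𝓕 A₃) _ A₃∈)
                                               (⌊⌋-false⁻¹ (W ⊆? A₃) (not-injective (∧-conicalʳ (𝓕 A₃) _ A₃∈)))))
      ... | inj₂ card≡0 = CommonCore.conclusion 2≤card𝓕 𝓕⊇W
        where
        𝓕⊇W : ∀ A → A ∈F 𝓕 → W ⊆ A
        𝓕⊇W A A∈ with W ⊆? A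
        ... | yes W⊆A = W⊆A
        ... | no W⊄A  = contradiction (trans (sym (card≡0⇒∉ _ card≡0 A)) (∧-true A∈ (cong not (⌊⌋-false (W ⊆? A) W⊄A)))) λ ()

    2≤card𝓕 : ∀ {A₀} → A₀ ∈F 𝓕 → ¬ card 𝓕 ≡ 1 → 2 ≤ card 𝓕
    2≤card𝓕 {A₀} A₀∈ card≢1 = ≤∧≢⇒< (member⇒card≥1 𝓕 A₀ A₀∈) (λ 1≡ → card≢1 (sym 1≡))

    classification : Conclusion
    classification with member-or-empty 𝓕
    ... | inj₂ card≡0 = ⊥-elim (card𝓕≢0 card≡0)
    ... | inj₁ (A₀ , A₀∈) with card 𝓕 ≟ 1
    ...   | yes card≡1 = OneMember.conclusion A₀ A₀∈ card≡1
    ...   | no card≢1 with tIntersecting-or-tDisjoint-pair t 𝓕 | card≥2⇒two-members 𝓕 (2≤card𝓕 A₀∈ card≢1)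
    ...     | inj₂ (A , A′ , A∈ , A′∈ , ∣A∩A′∣<t) | _ = ⊥-elim (P≮Lᵢᵢ (tDisjoint-pair⇒P<Lᵢᵢ A A′ A∈ A′∈ ∣A∩A′∣<t))
    ...     | inj₁ pairwise | A₁ , A₂ , A₁∈ , A₂∈ , A₁≢A₂ =
      IntersectingFamily.conclusion A₁ A₂ A₁∈ A₂∈ A₁≢A₂ pairwise (2≤card𝓕 A₀∈ card≢1)


corollary6p3 : (n t s : ℕ) → 1 ≤ n → 1 ≤ t → 1 ≤ s →
    5 * s * (suc t ^ 2) ≤ n →
    (𝓕 𝓖 : Family n) →
    Admissible n t s 𝓕 𝓖 →
    (∀ (𝓕′ 𝓖′ : Family n) → Admissible n t s 𝓕′ 𝓖′ →
      card 𝓕′ * card 𝓖′ ≤ card 𝓕 * card 𝓖) →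
    (s + 2 ≤ t →
      Σ (Subset n) λ Y → Σ (Family n) λ 𝓒 →
        ∣ Y ∣ ≡ suc t ×
        card 𝓒 ≡ s ×
        𝓒 ⊆F (λ F → Binom (suc t) F Data.Bool.∧ not (M₁ Y (suc t) t F)) ×
        𝓕 ≐ Single Y ×
        𝓖 ≐ (M₁ Y (suc t) t ∪F 𝓒))
    ×
    (t ≤ s + 1 →
      Σ (Subset n) λ Z → Σ (Subset n) λ W → Σ (Family n) λ 𝓓 →
        ∣ Z ∣ ≡ t + s + 2 × W ⊆ Z × ∣ W ∣ ≡ t ×
        card 𝓓 ≡ s + 2 ×
        𝓓 ⊆F M₂ Z W t ×
        (∀ (x : Fin n) → x ∈ Z → x ∉ W → containCount x 𝓓 ≡ 2) ×
        𝓕 ≐ H₁ Z W (suc t) ×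
        𝓖 ≐ (H₁ ⊤ W (suc t) ∪F 𝓓))
corollary6p3 (suc N) (suc t′) (suc s′) _ _ _ large 𝓕 𝓖 admissible maximal =
  Extremal.Classification.classification N t′ s′ 𝓕 𝓖 admissible maximal large
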